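{- Let $m,n,r,s,\lambda$ be positive integers with $m>5$ and $n\ge 5m$. Any $r$-factorization of $\lambda K_m^5$ can be extended to a connected $s$-factorization of $\lambda K_n^5$ if and only if (i) $(m,r,\lambda)$ and $(n,s,\lambda)$ are $5$-admissible; (ii) $1<s/r\le\binom{n-1}{4}/\binom{m-1}{4}$.
   Context: $\lambda K_n^h$: $n$ vertices, every $h$-subset an edge of multiplicity $\lambda$; $\lambda K_m^h$ is its sub-hypergraph induced on a fixed set of $m$ vertices. An $r$-factor is a spanning sub-hypergraph in which every vertex has degree $r$; an $r$-factorization is a partition of the edges into $r$-factors. An $r$-factorization of $\lambda K_m^h$ extends to a connected $s$-factorization of $\lambda K_n^h$ if there is a partition of the edges of $\lambda K_n^h$ into connected $s$-factors such that each given $r$-factor is contained in one of them and distinct $r$-factors are contained in distinct $s$-factors. $(n,r,\lambda)$ is $h$-admissible if $h\mid rn$ and $r\mid\lambda\binom{n-1}{h-1}$. -}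

module Defs where

open import Data.Nat using (ℕ; zero; suc; _*_; _∸_; _<_; _<?_)
open import Data.Nat.Divisibility using (_∣_)
open import Data.Nat.Combinatorics using (_C_)
open import Data.Fin using (Fin; toℕ; fromℕ<; _≟_)
open import Data.Fin.Subset using (Subset; inside; outside; ∣_∣; _∈_)
open import Data.Fin.Subset.Properties using (_∈?_)
open import Data.Vec using (Vec; []; _∷_; lookup; tabulate)
open import Data.List using (List; []; _∷_; _++_; map; filter; length; cartesianProduct; allFin)
open import Data.Product using (Σ; ∃; _×_; _,_)
open import Relation.Nullary using (yes; no)
open import Relation.Nullary.Decidable using (_×-dec_)
open import Relation.Binary.PropositionalEquality using (_≡_)
open import Function.Definitions using (Injective)

subsets : (n : ℕ) → List (Subset n)
subsets zero = [] ∷ []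
subsets (suc n) = map (outside ∷_) (subsets n) ++ map (inside ∷_) (subsets n)

hSubsets : (n h : ℕ) → List (Subset n)
hSubsets n h = filter (λ S → ∣ S ∣ Data.Nat.≟ h) (subsets n)
  where import Data.Nat

-- The edge multiset of lam K_n^h: an edge is an h-subset S together with
-- a copy index i : Fin lam (S has multiplicity lam).
edges : (n h lam : ℕ) → List (Subset n × Fin lam)
edges n h lam = cartesianProduct (hSubsets n h) (allFin lam)

-- A partition of the edges of lam K_n^h into k classes is a colouring
-- χ S i : Fin k of every copy i of every h-subset S (values on subsets of
-- size ≠ h are irrelevant).
Colouring : (n lam k : ℕ) → Set
Colouring n lam k = Subset n → Fin lam → Fin k

deg : {n lam k : ℕ} (h : ℕ) → Colouring n lam k → Fin k → Fin n → ℕ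
deg {n} {lam} h χ c v =
  length (filter (λ { (S , i) → (v ∈? S) ×-dec (χ S i ≟ c) }) (edges n h lam))

IsFactorization : {n lam k : ℕ} (h r : ℕ) → Colouring n lam k → Set
IsFactorization h r χ = ∀ c v → deg h χ c v ≡ r

data Reach {n lam k : ℕ} (h : ℕ) (χ : Colouring n lam k) (c : Fin k)
           : Fin n → Fin n → Set where
  here : ∀ {u} → Reach h χ c u u
  step : ∀ {u w v} (S : Subset n) → ∣ S ∣ ≡ h → (i : Fin lam) → χ S i ≡ c →
         u ∈ S → w ∈ S → Reach h χ c w v → Reach h χ c u v

IsConnectedFactor : {n lam k : ℕ} (h : ℕ) → Colouring n lam k → Fin k → Set
IsConnectedFactor {n} h χ c = ∀ (u v : Fin n) → Reach h χ c u v

IsConnectedFactorization : {n lam k : ℕ} (h s : ℕ) → Colouring n lam k → Set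
IsConnectedFactorization h s χ = IsFactorization h s χ × (∀ c → IsConnectedFactor h χ c)

-- lam K_m^h is induced on the fixed vertex set {0,…,m-1} ⊆ Fin n.
embed : {m n : ℕ} → Subset m → Subset n
embed {m} S = tabulate λ v → f v (toℕ v <? m)
  where
  f : ∀ {n} (v : Fin n) → Relation.Nullary.Dec (toℕ v < m) → _
  f v (yes p) = lookup S (fromℕ< p)
  f v (no _)  = outside
  import Relation.Nullary

-- The r-factorization ψ (with k factors) of lam K_m^h extends to a connected
-- s-factorization of lam K_n^h: the i-th copy of an h-subset S of the m
-- vertices is the i-th copy of S in lam K_n^h; factor j of ψ is contained
-- in factor g j, with g injective.
Extends : {m lam k : ℕ} (n h s : ℕ) → Colouring m lam k → Set
Extends {m} {lam} {k} n h s ψ =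
  Σ ℕ λ k' → Σ (Colouring n lam k') λ χ →
    IsConnectedFactorization h s χ ×
    Σ (Fin k → Fin k') λ g → Injective _≡_ _≡_ g ×
      (∀ (S : Subset m) → ∣ S ∣ ≡ h → ∀ (i : Fin lam) → χ (embed S) i ≡ g (ψ S i))

Admissible : (h n r lam : ℕ) → Set
Admissible h n r lam = (h ∣ r * n) × (r ∣ lam * ((n ∸ 1) C (h ∸ 1)))

-- Sufficiency is Baranyai's amalgamation argument.  Write Y for the m given
-- vertices and N = n − m ≥ 4m.  Conditions (i) and (ii) give K = λ C(n−1,4) / s
-- classes, of which k ≤ K contain one given factor each.  First choose how many
-- edges with i ≤ 4 vertices in Y each class gets: a greedy filling of the degree
-- m(s − r) or ms still needed on Y decides i = 4, 3, 2, and then i = 1, 0 are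
-- forced, with nonnegative values since n ≥ 5m.  Because an r-factor leaves the
-- same demand s − r at every vertex of Y, the vertices of Y, and afterwards the N
-- new ones, can be split off one at a time: at each step the fractional fair
-- distribution of the edges is a matrix with integral margins, which can be
-- rounded.  To keep the classes connected, the rounding also distributes fairly
-- over the components of the class outside the unsplit block.  The invariant is
-- that each component has at least two incidences with the block; it holds after Y
-- has been split because s > r and s ≥ 2, and it survives splitting.
--
-- Necessity is double counting; r < s because a connected class has an edge
-- leaving Y, which adds to the degree r of some vertex of Y.

module Submission where

open import Defs
open import Data.Nat hiding (less; equal; greater; compare; Ordering)
open import Data.Nat.Properties
open import Data.Nat.Combinatorics using (_C_; nCk+nC[k+1]≡[n+1]C[k+1]; k>n⇒nCk≡0; nCn≡1; nC1≡n)
open import Data.Nat.Divisibility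
open import Data.Nat.Tactic.RingSolver using (solve-∀)
open import Data.Bool using (Bool; true; false)
open import Data.Fin using (Fin; zero; suc; toℕ; _↑ˡ_; _↑ʳ_)
import Data.Fin as F
import Data.Fin.Properties as FP
open import Data.Fin.Subset using (Subset; inside; outside; ∣_∣; _∈_)
open import Data.Fin.Subset.Properties using (_∈?_)
open import Data.Vec using ([]; _∷_; lookup)
import Data.Vec as V
import Data.List as L
open import Data.List using (List; []; _∷_)
open import Data.Product
open import Data.Sum using (_⊎_; inj₁; inj₂; [_,_]′)
import Data.Sum
open import Data.Empty using (⊥-elim)
open import Relation.Nullary
open import Relation.Nullary.Decidable using (_×-dec_; ¬?; decidable-stable)
open import Relation.Binary.PropositionalEquality
open import Function using (_∘_; id; case_of_)
open import Function.Bundles using (_⇔_; mk⇔)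
import Data.Vec.Properties as VP
open import Data.List.Membership.Propositional using () renaming (_∈_ to _∈ₗ_)
open import Data.List.Membership.Propositional.Properties using (∈-filter⁺; ∈-cartesianProduct⁺; ∈-allFin)
open import Data.List.Relation.Unary.All using (All; []; _∷_)
open import Data.List.Relation.Unary.All.Properties using (all-filter)
open import Data.List.Relation.Unary.Any using (here; there)
open import Relation.Binary.Structures using (IsEquivalence)
open import Algebra.Properties.CommutativeSemigroup +-commutativeSemigroup using ()
  renaming (interchange to +-interchange; x∙yz≈y∙xz to m+[n+o]≡n+[m+o]; xy∙z≈xz∙y to [m+n]+o≡[m+o]+n)
open import Algebra.Properties.CommutativeSemigroup *-commutativeSemigroup using ()
  renaming (x∙yz≈y∙xz to m*[n*o]≡n*[m*o]; x∙yz≈z∙yx to m*[n*o]≡o*[n*m])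

-- Why two incidences: if a component has W of them with a block of `suc p` vertices, fairness gives
-- the new vertex at most W / (p + 1) of them, rounded up, and for p > 0 and W at least 2 this is
-- less than W. So no component is cut off from the rest of the block. The components that are hit
-- merge at the new vertex, and their leftovers must again add up to two; the delicate case is that
-- of a single hit component. Edges with no vertex outside the block are connected to nothing yet
-- and cannot be grouped. For them it suffices that each meets the block at least three times, since
-- one hit then leaves two.
--
-- Connectivity is carried as "every 2-colouring that no edge crosses is constant". This makes sense
-- for mere counts of edges of each type, before there are concrete edges, and it passes through a
-- splitting without any handling of paths.

-- Finite sums

-- Codes of finite types, so that sums over them compute along the type structure.
data Code : Set where
  fin sub : ℕ → Code
  _⊕_ _⊗_ : Code → Code → Code

El : Code → Set
El (fin n) = Fin n
El (sub n) = Subset n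
El (S ⊕ T) = El S ⊎ El T
El (S ⊗ T) = El S × El T

∑ : (T : Code) → (El T → ℕ) → ℕ
∑ (fin zero)    f = 0
∑ (fin (suc n)) f = f zero + ∑ (fin n) (f ∘ suc)
∑ (sub zero)    f = f []
∑ (sub (suc n)) f = ∑ (sub n) (f ∘ (outside ∷_)) + ∑ (sub n) (f ∘ (inside ∷_))
∑ (S ⊕ T)       f = ∑ S (f ∘ inj₁) + ∑ T (f ∘ inj₂)
∑ (S ⊗ T)       f = ∑ S λ s → ∑ T λ t → f (s , t)

∑-cong : ∀ T {f g : El T → ℕ} → (∀ t → f t ≡ g t) → ∑ T f ≡ ∑ T g
∑-cong (fin zero)    e = refl
∑-cong (fin (suc n)) e = cong₂ _+_ (e zero) (∑-cong (fin n) (e ∘ suc))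
∑-cong (sub zero)    e = e []
∑-cong (sub (suc n)) e = cong₂ _+_ (∑-cong (sub n) (e ∘ _)) (∑-cong (sub n) (e ∘ _))
∑-cong (S ⊕ T)       e = cong₂ _+_ (∑-cong S (e ∘ inj₁)) (∑-cong T (e ∘ inj₂))
∑-cong (S ⊗ T)       e = ∑-cong S λ s → ∑-cong T λ t → e (s , t)

∑-mono : ∀ T {f g : El T → ℕ} → (∀ t → f t ≤ g t) → ∑ T f ≤ ∑ T g
∑-mono (fin zero)    e = z≤n
∑-mono (fin (suc n)) e = +-mono-≤ (e zero) (∑-mono (fin n) (e ∘ suc))
∑-mono (sub zero)    e = e []
∑-mono (sub (suc n)) e = +-mono-≤ (∑-mono (sub n) (e ∘ _)) (∑-mono (sub n) (e ∘ _))
∑-mono (S ⊕ T)       e = +-mono-≤ (∑-mono S (e ∘ inj₁)) (∑-mono T (e ∘ inj₂))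
∑-mono (S ⊗ T)       e = ∑-mono S λ s → ∑-mono T λ t → e (s , t)

∑-+ : ∀ T (f g : El T → ℕ) → ∑ T (λ t → f t + g t) ≡ ∑ T f + ∑ T g
∑-+ (fin zero)    f g = refl
∑-+ (fin (suc n)) f g =
  trans (cong (f zero + g zero +_) (∑-+ (fin n) (f ∘ suc) (g ∘ suc))) (+-interchange (f zero) _ _ _)
∑-+ (sub zero)    f g = refl
∑-+ (sub (suc n)) f g =
  trans (cong₂ _+_ (∑-+ (sub n) _ _) (∑-+ (sub n) _ _)) (+-interchange (∑ (sub n) (f ∘ (outside ∷_))) _ _ _)
∑-+ (S ⊕ T)       f g =
  trans (cong₂ _+_ (∑-+ S _ _) (∑-+ T _ _)) (+-interchange (∑ S (f ∘ inj₁)) _ _ _)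
∑-+ (S ⊗ T)       f g = trans (∑-cong S λ s → ∑-+ T _ _) (∑-+ S _ _)

∑-*ˡ : ∀ T k (f : El T → ℕ) → ∑ T (λ t → k * f t) ≡ k * ∑ T f
∑-*ˡ (fin zero)    k f = sym (*-zeroʳ k)
∑-*ˡ (fin (suc n)) k f =
  trans (cong (k * f zero +_) (∑-*ˡ (fin n) k (f ∘ suc))) (sym (*-distribˡ-+ k (f zero) _))
∑-*ˡ (sub zero)    k f = refl
∑-*ˡ (sub (suc n)) k f =
  trans (cong₂ _+_ (∑-*ˡ (sub n) k _) (∑-*ˡ (sub n) k _)) (sym (*-distribˡ-+ k _ _))
∑-*ˡ (S ⊕ T)       k f =
  trans (cong₂ _+_ (∑-*ˡ S k _) (∑-*ˡ T k _)) (sym (*-distribˡ-+ k _ _))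
∑-*ˡ (S ⊗ T)       k f = trans (∑-cong S λ s → ∑-*ˡ T k _) (∑-*ˡ S k _)

∑-*ʳ : ∀ T k (f : El T → ℕ) → ∑ T (λ t → f t * k) ≡ ∑ T f * k
∑-*ʳ T k f = trans (∑-cong T λ t → *-comm (f t) k) (trans (∑-*ˡ T k f) (*-comm k _))

∑-zero : ∀ T {f : El T → ℕ} → (∀ t → f t ≡ 0) → ∑ T f ≡ 0
∑-zero T e = trans (∑-cong T e) (∑-*ˡ T 0 (λ _ → 0))

∑-swap : ∀ S T (f : El S → El T → ℕ) → ∑ S (λ s → ∑ T (f s)) ≡ ∑ T λ t → ∑ S λ s → f s t
∑-swap (fin zero)    T f = sym (∑-zero T λ _ → refl)
∑-swap (fin (suc n)) T f =
  trans (cong (∑ T (f zero) +_) (∑-swap (fin n) T (f ∘ suc))) (sym (∑-+ T _ _))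
∑-swap (sub zero)    T f = refl
∑-swap (sub (suc n)) T f =
  trans (cong₂ _+_ (∑-swap (sub n) T _) (∑-swap (sub n) T _)) (sym (∑-+ T _ _))
∑-swap (S ⊕ S′)      T f =
  trans (cong₂ _+_ (∑-swap S T _) (∑-swap S′ T _)) (sym (∑-+ T _ _))
∑-swap (S ⊗ S′)      T f =
  trans (∑-cong S λ s → ∑-swap S′ T _) (∑-swap S T _)

δ : ∀ T → El T → El T → ℕ
δ (fin _) zero    zero    = 1
δ (fin _) zero    (suc _) = 0
δ (fin _) (suc _) zero    = 0
δ (fin (suc n)) (suc i) (suc j) = δ (fin n) i j
δ (sub zero) [] [] = 1
δ (sub (suc n)) (outside ∷ p) (outside ∷ q) = δ (sub n) p q
δ (sub (suc n)) (outside ∷ p) (inside  ∷ q) = 0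
δ (sub (suc n)) (inside  ∷ p) (outside ∷ q) = 0
δ (sub (suc n)) (inside  ∷ p) (inside  ∷ q) = δ (sub n) p q
δ (S ⊕ T) (inj₁ x) (inj₁ y) = δ S x y
δ (S ⊕ T) (inj₁ x) (inj₂ y) = 0
δ (S ⊕ T) (inj₂ x) (inj₁ y) = 0
δ (S ⊕ T) (inj₂ x) (inj₂ y) = δ T x y
δ (S ⊗ T) (x , y) (x′ , y′) = δ S x x′ * δ T y y′

data Compare (T : Code) (s t : El T) : Set where
  same : δ T s t ≡ 1 → s ≡ t → Compare T s t
  diff : δ T s t ≡ 0 → s ≢ t → Compare T s t

compareE : ∀ T (s t : El T) → Compare T s t
compareE (fin _) zero zero = same refl refl
compareE (fin _) zero (suc _) = diff refl λ ()
compareE (fin _) (suc _) zero = diff refl λ ()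
compareE (fin (suc n)) (suc i) (suc j) with compareE (fin n) i j
... | same e p = same e (cong suc p)
... | diff e p = diff e (p ∘ FP.suc-injective)
compareE (sub zero) [] [] = same refl refl
compareE (sub (suc n)) (outside ∷ p) (outside ∷ q) with compareE (sub n) p q
... | same e r = same e (cong (_ ∷_) r)
... | diff e r = diff e λ { refl → r refl }
compareE (sub (suc n)) (outside ∷ p) (inside ∷ q) = diff refl λ ()
compareE (sub (suc n)) (inside ∷ p) (outside ∷ q) = diff refl λ ()
compareE (sub (suc n)) (inside ∷ p) (inside ∷ q) with compareE (sub n) p q
... | same e r = same e (cong (_ ∷_) r)
... | diff e r = diff e λ { refl → r refl }
compareE (S ⊕ T) (inj₁ x) (inj₁ y) with compareE S x y
... | same e r = same e (cong inj₁ r)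
... | diff e r = diff e λ { refl → r refl }
compareE (S ⊕ T) (inj₁ x) (inj₂ y) = diff refl λ ()
compareE (S ⊕ T) (inj₂ x) (inj₁ y) = diff refl λ ()
compareE (S ⊕ T) (inj₂ x) (inj₂ y) with compareE T x y
... | same e r = same e (cong inj₂ r)
... | diff e r = diff e λ { refl → r refl }
compareE (S ⊗ T) (x , y) (x′ , y′) with compareE S x x′ | compareE T y y′
... | diff e r | _        = diff (cong (_* δ T y y′) e) λ { refl → r refl }
... | same e r | diff d p = diff (trans (cong (δ S x x′ *_) d) (*-zeroʳ (δ S x x′))) λ { refl → p refl }
... | same e r | same d p = same (cong₂ _*_ e d) (cong₂ _,_ r p)

decEq : ∀ T (s t : El T) → Dec (s ≡ t)
decEq T s t with compareE T s t
... | same _ p = yes p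
... | diff _ p = no p

δ-refl : ∀ T t → δ T t t ≡ 1
δ-refl T t with compareE T t t
... | same e _ = e
... | diff _ p = ⊥-elim (p refl)

δ-≢ : ∀ T {s t} → s ≢ t → δ T s t ≡ 0
δ-≢ T {s} {t} s≢t with compareE T s t
... | same _ p = ⊥-elim (s≢t p)
... | diff e _ = e

δ≤1 : ∀ T s t → δ T s t ≤ 1
δ≤1 T s t with compareE T s t
... | same e _ = ≤-reflexive e
... | diff e _ = ≤-trans (≤-reflexive e) z≤n

∑-δ : ∀ T s (f : El T → ℕ) → ∑ T (λ t → δ T s t * f t) ≡ f s
∑-δ (fin (suc n)) zero f =
  trans (cong (1 * f zero +_) (∑-zero (fin n) λ _ → refl)) (trans (+-identityʳ _) (*-identityˡ _))
∑-δ (fin (suc n)) (suc i) f = ∑-δ (fin n) i (f ∘ suc)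
∑-δ (sub zero) [] f = *-identityˡ _
∑-δ (sub (suc n)) (outside ∷ p) f =
  trans (cong₂ _+_ (∑-δ (sub n) p _) (∑-zero (sub n) λ _ → refl)) (+-identityʳ _)
∑-δ (sub (suc n)) (inside ∷ p) f =
  trans (cong₂ _+_ (∑-zero (sub n) λ _ → refl) (∑-δ (sub n) p _)) refl
∑-δ (S ⊕ T) (inj₁ x) f = trans (cong₂ _+_ (∑-δ S x _) (∑-zero T λ _ → refl)) (+-identityʳ _)
∑-δ (S ⊕ T) (inj₂ y) f = cong₂ _+_ (∑-zero S λ _ → refl) (∑-δ T y _)
∑-δ (S ⊗ T) (x , y) f =
  trans (∑-cong S λ s → trans (∑-cong T λ t → *-assoc (δ S x s) _ _)
                              (trans (∑-*ˡ T (δ S x s) _) (cong (δ S x s *_) (∑-δ T y _))))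
        (∑-δ S x _)

∑-δ₁ : ∀ T s → ∑ T (δ T s) ≡ 1
∑-δ₁ T s = trans (∑-cong T λ t → sym (*-identityʳ _)) (∑-δ T s λ _ → 1)

off : ∀ T → El T → (El T → ℕ) → El T → ℕ
off T s f t = (1 ∸ δ T s t) * f t

∑-remove : ∀ T s (f : El T → ℕ) → ∑ T f ≡ f s + ∑ T (off T s f)
∑-remove T s f = trans (∑-cong T pointwise) (trans (∑-+ T _ _) (cong (_+ ∑ T (off T s f)) (∑-δ T s f)))
  where
  pointwise : ∀ t → f t ≡ δ T s t * f t + off T s f t
  pointwise t with δ T s t | δ≤1 T s t
  ... | zero        | _ = sym (+-identityʳ _)
  ... | suc zero    | _ = sym (trans (+-identityʳ _) (+-identityʳ _))
  ... | suc (suc _) | s≤s ()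

off-≢ : ∀ T {s t} (f : El T → ℕ) → s ≢ t → off T s f t ≡ f t
off-≢ T f s≢t rewrite δ-≢ T s≢t = *-identityˡ _

≤∑ : ∀ T (f : El T → ℕ) t → f t ≤ ∑ T f
≤∑ T f t = ≤-trans (m≤m+n _ _) (≤-reflexive (sym (∑-remove T t f)))

∑≡0⇒≡0 : ∀ T {f : El T → ℕ} → ∑ T f ≡ 0 → ∀ t → f t ≡ 0
∑≡0⇒≡0 T {f} e t = n≤0⇒n≡0 (≤-trans (≤∑ T f t) (≤-reflexive e))

two≤∑ : ∀ T (f : El T → ℕ) {s t} → s ≢ t → f s + f t ≤ ∑ T f
two≤∑ T f {s} {t} s≢t = ≤-trans
  (+-monoʳ-≤ (f s) (≤-trans (≤-reflexive (sym (off-≢ T f s≢t))) (≤∑ T _ t)))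
  (≤-reflexive (sym (∑-remove T s f)))

0<m+n : ∀ m {n} → 0 < m + n → 0 < m ⊎ 0 < n
0<m+n zero    p = inj₂ p
0<m+n (suc _) p = inj₁ z<s

∑>0⇒∃ : ∀ T {f : El T → ℕ} → 0 < ∑ T f → ∃ λ t → 0 < f t
∑>0⇒∃ (fin (suc n)) {f} p =
  [ (zero ,_) , (λ q → map suc id (∑>0⇒∃ (fin n) q)) ]′ (0<m+n (f zero) p)
∑>0⇒∃ (sub zero) p = [] , p
∑>0⇒∃ (sub (suc n)) {f} p =
  [ (λ q → map (outside ∷_) id (∑>0⇒∃ (sub n) q)) , (λ q → map (inside ∷_) id (∑>0⇒∃ (sub n) q)) ]′
    (0<m+n (∑ (sub n) (f ∘ (outside ∷_))) p)
∑>0⇒∃ (S ⊕ T) {f} p =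
  [ (λ q → map inj₁ id (∑>0⇒∃ S q)) , (λ q → map inj₂ id (∑>0⇒∃ T q)) ]′ (0<m+n (∑ S (f ∘ inj₁)) p)
∑>0⇒∃ (S ⊗ T) p = let s , q = ∑>0⇒∃ S p ; t , r = ∑>0⇒∃ T q in (s , t) , r

𝟙 : ∀ {p} {P : Set p} → Dec P → ℕ
𝟙 (yes _) = 1
𝟙 (no _)  = 0

𝟙-yes : ∀ {p} {P : Set p} (d : Dec P) → P → 𝟙 d ≡ 1
𝟙-yes (yes _) _ = refl
𝟙-yes (no ¬p) p = ⊥-elim (¬p p)

𝟙-no : ∀ {p} {P : Set p} (d : Dec P) → ¬ P → 𝟙 d ≡ 0
𝟙-no (yes p) ¬p = ⊥-elim (¬p p)
𝟙-no (no _)  _  = refl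

𝟙-cong : ∀ {p q} {P : Set p} {Q : Set q} (d : Dec P) (e : Dec Q) → (P → Q) → (Q → P) → 𝟙 d ≡ 𝟙 e
𝟙-cong (yes p) e f g = sym (𝟙-yes e (f p))
𝟙-cong (no ¬p) e f g = sym (𝟙-no e (¬p ∘ g))

𝟙>0⇒ : ∀ {p} {P : Set p} (d : Dec P) → 0 < 𝟙 d → P
𝟙>0⇒ (yes p) _ = p

-- The sum of the indicators is positive exactly when there is a witness, and `∑>0⇒∃` recovers one.
exists? : ∀ T {P : El T → Set} → (∀ t → Dec (P t)) → Dec (∃ P)
exists? T P? with ∑ T (λ t → 𝟙 (P? t)) in eq
... | zero  = no λ (t , p) → 0≢1+n (trans (sym (∑≡0⇒≡0 T eq t)) (𝟙-yes (P? t) p))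
... | suc _ with ∑>0⇒∃ T (subst (0 <_) (sym eq) z<s)
... | t , p = yes (t , 𝟙>0⇒ (P? t) p)

-- Rounding a matrix with prescribed margins

∑-mono-< : ∀ T {f g : El T → ℕ} → (∀ t → f t ≤ g t) → ∀ t → f t < g t → ∑ T f < ∑ T g
∑-mono-< T {f} {g} f≤g t ft<gt = subst₂ _<_ (sym (∑-remove T t f)) (sym (∑-remove T t g))
  (+-mono-<-≤ ft<gt (∑-mono T λ u → *-monoʳ-≤ (1 ∸ δ T t u) (f≤g u)))

∣∑ : ∀ T {q} {f : El T → ℕ} → (∀ t → q ∣ f t) → q ∣ ∑ T f
∣∑ T {q} {f} q∣f = divides (∑ T λ t → quotient (q∣f t))
  (trans (∑-cong T λ t → m∣n⇒n≡quotient*m (q∣f t)) (∑-*ʳ T q _))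

-- Otherwise all other terms, and with them `f t`, would be multiples of `q`. So a non-integral
-- entry is never alone in its row or column, which keeps the walk below going.
∤-other : ∀ T {q} {f : El T → ℕ} → q ∣ ∑ T f → ∀ t → ¬ q ∣ f t → ∃ λ u → t ≢ u × ¬ q ∣ f u
∤-other T {q} {f} q∣∑ t q∤ft
  with exists? T (λ u → ¬? (decEq T t u) ×-dec ¬? (q ∣? f u))
... | yes found = found
... | no none = ⊥-elim (q∤ft (∣m+n∣m⇒∣n (subst (q ∣_) (trans (∑-remove T t f) (+-comm (f t) _)) q∣∑) (∣∑ T others)))
  where
  others : ∀ u → q ∣ off T t f u
  others u with compareE T t u
  ... | same e refl rewrite e = q ∣0
  ... | diff e t≢u  rewrite e =
    ∣n⇒∣m*n 1 (decidable-stable (q ∣? f u) λ q∤fu → none (u , t≢u , q∤fu))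

module Rounding (R Q : Code) (q : ℕ) where

  Matrix : Set
  Matrix = El R → El Q → ℕ

  -- Entries are numerators over the common denominator `q`: rounding means reaching multiples of
  -- `q`, and all arithmetic stays in the natural numbers.
  Frac : Matrix → El R → El Q → Set
  Frac a ρ i = ¬ q ∣ a ρ i

  unit : El R → El Q → Matrix
  unit r j ρ i = δ R r ρ * δ Q j i

  unit-row : ∀ r j ρ → ∑ Q (unit r j ρ) ≡ δ R r ρ
  unit-row r j ρ = trans (∑-*ˡ Q (δ R r ρ) _) (trans (cong (δ R r ρ *_) (∑-δ₁ Q j)) (*-identityʳ (δ R r ρ)))

  unit-col : ∀ r j i → ∑ R (λ ρ → unit r j ρ i) ≡ δ Q j i
  unit-col r j i = trans (∑-*ʳ R (δ Q j i) _) (trans (cong (_* δ Q j i) (∑-δ₁ R r)) (*-identityˡ (δ Q j i)))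

  unit≤1 : ∀ r j ρ i → unit r j ρ i ≤ 1
  unit≤1 r j ρ i = *-mono-≤ (δ≤1 R r ρ) (δ≤1 Q j i)

  unit-refl : ∀ r j → unit r j r j ≡ 1
  unit-refl r j = cong₂ _*_ (δ-refl R r) (δ-refl Q j)

  unit-row≢ : ∀ {r ρ} j i → r ≢ ρ → unit r j ρ i ≡ 0
  unit-row≢ {r} {ρ} j i r≢ρ = cong (_* δ Q j i) (δ-≢ R r≢ρ)

  unit-col≢ : ∀ r ρ {j i} → j ≢ i → unit r j ρ i ≡ 0
  unit-col≢ r ρ j≢i = trans (cong (δ R r ρ *_) (δ-≢ Q j≢i)) (*-zeroʳ (δ R r ρ))

  _⊞_ : Matrix → Matrix → Matrix
  (a ⊞ b) ρ i = a ρ i + b ρ i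

  Vanish : Matrix → Matrix → El R → El Q → Set
  Vanish P N ρ i = P ρ i ≡ 0 × N ρ i ≡ 0

  Supported : Matrix → Matrix → Matrix → Set
  Supported a P N = ∀ ρ i → Frac a ρ i ⊎ Vanish P N ρ i

  -- P − N is a nonzero {-1,0,1}-matrix with zero margins.
  record Shift : Set where
    field
      P N      : Matrix
      rows     : ∀ ρ → ∑ Q (P ρ) ≡ ∑ Q (N ρ)
      cols     : ∀ i → ∑ R (λ ρ → P ρ i) ≡ ∑ R (λ ρ → N ρ i)
      P≤1      : ∀ ρ i → P ρ i ≤ 1
      N≤1      : ∀ ρ i → N ρ i ≤ 1
      row₀     : El R
      col₀     : El Q
      P₀≡1     : P row₀ col₀ ≡ 1
      N₀≡0     : N row₀ col₀ ≡ 0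

  module _ (a : Matrix) where

    -- A walk along fractional entries, alternately inside a column and inside
    -- a row, with no column used twice (v i ≢ 0 iff column i has been used).
    -- The part of the walk after its visit to column j, leading from row
    -- `from` to the current row r, contributes the signed entries P − N.
    record Tail (v : El Q → ℕ) (r : El R) (last j : El Q) : Set where
      field
        from     : El R
        frac     : Frac a from j
        P N      : Matrix
        rows     : ∀ ρ → ∑ Q (P ρ) + δ R r ρ ≡ ∑ Q (N ρ) + δ R from ρ
        cols     : ∀ i → ∑ R (λ ρ → P ρ i) ≡ ∑ R (λ ρ → N ρ i)
        P≤1      : ∀ ρ i → P ρ i ≤ 1
        N≤1      : ∀ ρ i → N ρ i ≤ 1
        support  : Supported a P N
        fresh    : ∀ ρ i → v i ≡ 0 ⊎ i ≡ j → Vanish P N ρ i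
        progress : j ≡ last ⊎ ∃₂ λ ρ i → P ρ i ≡ 1 × N ρ i ≡ 0

    plus-unit≤1 : ∀ (A : Matrix) r j → (∀ ρ i → A ρ i ≤ 1) → (∀ ρ → A ρ j ≡ 0) →
                  ∀ ρ i → (A ⊞ unit r j) ρ i ≤ 1
    plus-unit≤1 A r j A≤1 Aj≡0 ρ i with decEq Q j i
    ... | yes refl = subst (λ z → z + unit r j ρ j ≤ 1) (sym (Aj≡0 ρ)) (unit≤1 r j ρ j)
    ... | no j≢i   = subst (λ z → A ρ i + z ≤ 1) (sym (unit-col≢ r ρ j≢i))
                       (subst (_≤ 1) (sym (+-identityʳ _)) (A≤1 ρ i))

    plus-units-supported : ∀ {P N} r r′ j → Frac a r j → Frac a r′ j → Supported a P N →
                           Supported a (P ⊞ unit r j) (N ⊞ unit r′ j)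
    plus-units-supported r r′ j f f′ s ρ i with s ρ i
    ... | inj₁ g = inj₁ g
    ... | inj₂ (p , n) with decEq Q j i
    ...   | no j≢i = inj₂ (cong₂ _+_ p (unit-col≢ r ρ j≢i) , cong₂ _+_ n (unit-col≢ r′ ρ j≢i))
    ...   | yes refl with decEq R r ρ | decEq R r′ ρ
    ...     | yes refl | _        = inj₁ f
    ...     | no _     | yes refl = inj₁ f′
    ...     | no ¬e    | no ¬e′   =
      inj₂ (cong₂ _+_ p (unit-row≢ j j ¬e) , cong₂ _+_ n (unit-row≢ j j ¬e′))

    plus-units-cols : ∀ {P N : Matrix} r r′ j → (∀ i → ∑ R (λ ρ → P ρ i) ≡ ∑ R (λ ρ → N ρ i)) →
                      ∀ i → ∑ R (λ ρ → (P ⊞ unit r j) ρ i) ≡ ∑ R (λ ρ → (N ⊞ unit r′ j) ρ i)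
    plus-units-cols r r′ j c i = trans (∑-+ R _ _) (trans
      (cong₂ _+_ (c i) (trans (unit-col r j i) (sym (unit-col r′ j i)))) (sym (∑-+ R _ _)))

    plus-unit-row : ∀ (A : Matrix) r j ρ → ∑ Q ((A ⊞ unit r j) ρ) ≡ ∑ Q (A ρ) + δ R r ρ
    plus-unit-row A r j ρ = trans (∑-+ Q _ _) (cong (∑ Q (A ρ) +_) (unit-row r j ρ))

    -- Column `j` was used before: entering it at `(r , j)` and leaving it at `(from , j)` turns the
    -- tail into a closed cycle and cancels the two δ terms of `rows`. By `j ≢ last` the tail is not
    -- empty, so the shift is not zero.
    close : ∀ {v r last j} → j ≢ last → Frac a r j → Tail v r last j →
            Σ Shift λ s → Supported a (Shift.P s) (Shift.N s)
    close {v} {r} {last} {j} j≢last f t with Tail.progress t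
    ... | inj₁ e = ⊥-elim (j≢last e)
    ... | inj₂ (ρ₀ , i₀ , p₀ , n₀) = record
      { P    = P ⊞ unit r j
      ; N    = N ⊞ unit from j
      ; rows = λ ρ → trans (plus-unit-row P r j ρ) (trans (rows ρ) (sym (plus-unit-row N from j ρ)))
      ; cols = plus-units-cols r from j cols
      ; P≤1  = plus-unit≤1 P r j P≤1 λ ρ → proj₁ (fresh ρ j (inj₂ refl))
      ; N≤1  = plus-unit≤1 N from j N≤1 λ ρ → proj₂ (fresh ρ j (inj₂ refl))
      ; row₀ = ρ₀
      ; col₀ = i₀
      ; P₀≡1 = cong₂ _+_ p₀ (unit-col≢ r ρ₀ j≢i₀)
      ; N₀≡0 = cong₂ _+_ n₀ (unit-col≢ from ρ₀ j≢i₀)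
      } , plus-units-supported r from j f frac support
      where
      open Tail t
      j≢i₀ : j ≢ i₀
      j≢i₀ refl = 0≢1+n (trans (sym (proj₁ (fresh ρ₀ j (inj₂ refl)))) p₀)

    -- The entry `(r , j′)`, reached inside row `r`, receives +1, and `(r′ , j′)`, reached inside
    -- column `j′`, receives -1.
    extend : ∀ {v r last j} r′ j′ → v j′ ≡ 0 → v j ≢ 0 → r ≢ r′ → Frac a r j′ → Frac a r′ j′ →
             Tail v r last j → Tail (λ i → v i + δ Q j′ i) r′ j′ j
    extend {v} {r} {last} {j} r′ j′ vj′ vj r≢r′ f f′ t = record
      { from = from
      ; frac = frac
      ; P    = P ⊞ unit r j′
      ; N    = N ⊞ unit r′ j′
      ; rows = λ ρ → trans (cong (_+ δ R r′ ρ) (trans (plus-unit-row P r j′ ρ) (rows ρ)))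
          (trans ([m+n]+o≡[m+o]+n (∑ Q (N ρ)) _ _) (cong (_+ δ R from ρ) (sym (plus-unit-row N r′ j′ ρ))))
      ; cols = plus-units-cols r r′ j′ cols
      ; P≤1  = plus-unit≤1 P r j′ P≤1 λ ρ → proj₁ (fresh ρ j′ (inj₁ vj′))
      ; N≤1  = plus-unit≤1 N r′ j′ N≤1 λ ρ → proj₂ (fresh ρ j′ (inj₁ vj′))
      ; support = plus-units-supported r r′ j′ f f′ support
      ; fresh = λ ρ i c →
          let j′≢i = still-unused i c
              p , n = fresh ρ i (Data.Sum.map (m+n≡0⇒m≡0 (v i)) id c)
          in cong₂ _+_ p (unit-col≢ r ρ j′≢i) , cong₂ _+_ n (unit-col≢ r′ ρ j′≢i)
      ; progress = inj₂ (r , j′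
          , cong₂ _+_ (proj₁ (fresh r j′ (inj₁ vj′))) (unit-refl r j′)
          , cong₂ _+_ (proj₂ (fresh r j′ (inj₁ vj′))) (unit-row≢ j′ j′ (r≢r′ ∘ sym)))
      }
      where
      open Tail t
      still-unused : ∀ i → v i + δ Q j′ i ≡ 0 ⊎ i ≡ j → j′ ≢ i
      still-unused i (inj₁ e) refl = 0≢1+n (trans (sym e) (trans (cong₂ _+_ vj′ (δ-refl Q i)) refl))
      still-unused i (inj₂ refl) refl = vj vj′

    start : ∀ v r j → Frac a r j → Tail v r j j
    start v r j f = record
      { from = r ; frac = f ; P = λ _ _ → 0 ; N = λ _ _ → 0 ; rows = λ _ → refl ; cols = λ _ → refl
      ; P≤1 = λ _ _ → z≤n ; N≤1 = λ _ _ → z≤n ; support = λ _ _ → inj₂ (refl , refl)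
      ; fresh = λ _ _ _ → refl , refl ; progress = inj₁ refl }

    module _ (rowsum : ∀ ρ → q ∣ ∑ Q (a ρ)) (colsum : ∀ i → q ∣ ∑ R λ ρ → a ρ i) where

      walk : ∀ fuel v r last → ∑ Q (λ i → 1 ∸ v i) ≤ fuel → Frac a r last →
             (∀ j → v j ≢ 0 → Tail v r last j) → Σ Shift λ s → Supported a (Shift.P s) (Shift.N s)
      walk fuel v r last bound f tails with ∤-other Q (rowsum r) last f
      ... | j′ , last≢j′ , f′ with v j′ ≟ 0
      ...   | no used = close (last≢j′ ∘ sym) f′ (tails j′ used)
      ...   | yes unused with fuel | ∤-other R (colsum j′) r f′
      ...     | zero    | _ = ⊥-elim (0≢1+n
                (trans (sym (∑≡0⇒≡0 Q (n≤0⇒n≡0 bound) j′)) (cong (1 ∸_) unused)))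
      ...     | suc fuel′ | r′ , r≢r′ , f″ = walk fuel′ v′ r′ j′ bound′ f″ tails′
        where
        v′ : El Q → ℕ
        v′ i = v i + δ Q j′ i
        less : ∀ i → (1 ∸ v′ i) ≤ 1 ∸ v i
        less i = ∸-monoʳ-≤ 1 (m≤m+n (v i) _)
        strict : (1 ∸ v′ j′) < 1 ∸ v j′
        strict = subst₂ (λ x y → (1 ∸ (x + y)) < 1 ∸ x) (sym unused) (sym (δ-refl Q j′)) z<s
        bound′ : ∑ Q (λ i → 1 ∸ v′ i) ≤ fuel′
        bound′ = s≤s⁻¹ (≤-trans (∑-mono-< Q less j′ strict) bound)
        tails′ : ∀ j → v′ j ≢ 0 → Tail v′ r′ j′ j
        tails′ j used with v j ≟ 0
        ... | no vj≢0 = extend r′ j′ unused vj≢0 r≢r′ f′ f″ (tails j vj≢0)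
        ... | yes vj≡0 with compareE Q j′ j
        ...   | same _ refl = start v′ r′ j f″
        ...   | diff e _    = ⊥-elim (used (cong₂ _+_ vj≡0 e))

      fractional-shift : ∀ r j → Frac a r j → Σ Shift λ s → Supported a (Shift.P s) (Shift.N s)
      fractional-shift r j f = walk _ (δ Q j) r j ≤-refl f only
        where
        only : ∀ i → δ Q j i ≢ 0 → Tail (δ Q j) r j i
        only i p with compareE Q j i
        ... | same _ refl = start (δ Q j) r j f
        ... | diff e _    = ⊥-elim (p e)

  -- In `bound`, `f` ranges over all integral upper bounds of `a ρ i / q`. Keeping every one of them
  -- means that no entry exceeds its quotient rounded up.
  record _⇝_ (a b : Matrix) : Set where
    field
      rows  : ∀ ρ → ∑ Q (b ρ) ≡ ∑ Q (a ρ)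
      cols  : ∀ i → ∑ R (λ ρ → b ρ i) ≡ ∑ R (λ ρ → a ρ i)
      bound : ∀ ρ i f → a ρ i ≤ q * f → b ρ i ≤ q * f

  ⇝-refl : ∀ {a} → a ⇝ a
  ⇝-refl = record { rows = λ _ → refl ; cols = λ _ → refl ; bound = λ _ _ _ → id }

  ⇝-trans : ∀ {a b c} → a ⇝ b → b ⇝ c → a ⇝ c
  ⇝-trans x y = record
    { rows  = λ ρ → trans (Y.rows ρ) (X.rows ρ)
    ; cols  = λ i → trans (Y.cols i) (X.cols i)
    ; bound = λ ρ i f → Y.bound ρ i f ∘ X.bound ρ i f }
    where
    module X = _⇝_ x
    module Y = _⇝_ y

  frac? : ∀ a ρ i → Dec (Frac a ρ i)
  frac? a ρ i = ¬? (q ∣? a ρ i)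

  #frac : Matrix → ℕ
  #frac a = ∑ (R ⊗ Q) λ (ρ , i) → 𝟙 (frac? a ρ i)

  module _ (s : Shift) where
    open Shift s

    apply : Matrix → Matrix
    apply a ρ i = (a ρ i + P ρ i) ∸ N ρ i

    frac⇒>0 : ∀ {a ρ i} → Frac a ρ i → 0 < a ρ i
    frac⇒>0 f = n≢0⇒n>0 λ e → f (subst (q ∣_) (sym e) (q ∣0))

    module _ {a} (supp : Supported a P N) where

      apply-+ : ∀ ρ i → apply a ρ i + N ρ i ≡ a ρ i + P ρ i
      apply-+ ρ i = m∸n+n≡m (N≤ (supp ρ i))
        where
        N≤ : Frac a ρ i ⊎ Vanish P N ρ i → N ρ i ≤ a ρ i + P ρ i
        N≤ (inj₁ f)       = ≤-trans (N≤1 ρ i) (≤-trans (frac⇒>0 {a} f) (m≤m+n _ _))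
        N≤ (inj₂ (_ , n)) = ≤-trans (≤-reflexive n) z≤n

      apply-⇝ : a ⇝ apply a
      apply-⇝ = record
        { rows = λ ρ → +-cancelʳ-≡ (∑ Q (N ρ)) _ _ (trans (sym (∑-+ Q _ _))
            (trans (∑-cong Q (apply-+ ρ)) (trans (∑-+ Q _ _) (cong (∑ Q (a ρ) +_) (rows ρ)))))
        ; cols = λ i → +-cancelʳ-≡ (∑ R λ ρ → N ρ i) _ _ (trans (sym (∑-+ R _ _))
            (trans (∑-cong R λ ρ → apply-+ ρ i)
              (trans (∑-+ R _ _) (cong (∑ R (λ ρ → a ρ i) +_) (cols i)))))
        ; bound = λ ρ i f a≤ → ≤-trans (m∸n≤m _ (N ρ i)) (bound′ ρ i f a≤ (supp ρ i)) }
        where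
        bound′ : ∀ ρ i f → a ρ i ≤ q * f → Frac a ρ i ⊎ Vanish P N ρ i → a ρ i + P ρ i ≤ q * f
        bound′ ρ i f a≤ (inj₁ fr) = ≤-trans (+-monoʳ-≤ (a ρ i) (P≤1 ρ i)) (subst (_≤ q * f) (+-comm 1 _)
          (≤∧≢⇒< a≤ λ e → fr (subst (q ∣_) (sym e) (m∣m*n f))))
        bound′ ρ i f a≤ (inj₂ (p , _)) = subst (_≤ q * f) (sym (trans (cong (a ρ i +_) p) (+-identityʳ _))) a≤

      apply-vanish : ∀ {ρ i} → Vanish P N ρ i → apply a ρ i ≡ a ρ i
      apply-vanish {ρ} {i} (p , n) = trans (cong₂ (λ x y → (a ρ i + x) ∸ y) p n) (+-identityʳ _)

    -- The shift is repeated until some entry in its support is a multiple of `q`. Until then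
    -- entries move by at most one and pass no multiple, so the support stays fractional. The entry
    -- at `row₀`, `col₀` grows by one each time, so this happens within `k` steps.
    push : ∀ k a → Supported a P N → q ∣ a row₀ col₀ + k → Σ Matrix λ b → a ⇝ b × #frac b < #frac a
    push zero a supp q∣ with supp row₀ col₀
    ... | inj₁ f       = ⊥-elim (f (subst (q ∣_) (+-identityʳ _) q∣))
    ... | inj₂ (p , _) = ⊥-elim (0≢1+n (trans (sym p) P₀≡1))
    push (suc k) a supp q∣
      with exists? (R ⊗ Q) (λ (ρ , i) → (q ∣? apply a ρ i) ×-dec (0 <? P ρ i + N ρ i))
    ... | yes ((ρ , i) , q∣b , moved) = apply a , apply-⇝ supp
        , ∑-mono-< (R ⊗ Q) (λ (ρ , i) → pointwise ρ i (supp ρ i)) (ρ , i) (strict (supp ρ i))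
      where
      pointwise : ∀ ρ i → Frac a ρ i ⊎ Vanish P N ρ i → 𝟙 (frac? (apply a) ρ i) ≤ 𝟙 (frac? a ρ i)
      pointwise ρ i (inj₁ f) = subst (𝟙 (frac? (apply a) ρ i) ≤_) (sym (𝟙-yes (frac? a ρ i) f)) (𝟙≤1 _)
        where
        𝟙≤1 : ∀ {A : Set} (d : Dec A) → 𝟙 d ≤ 1
        𝟙≤1 (yes _) = ≤-refl
        𝟙≤1 (no _)  = z≤n
      pointwise ρ i (inj₂ z) = ≤-reflexive (𝟙-cong _ _ (subst (λ x → ¬ q ∣ x) (apply-vanish supp z))
        (subst (λ x → ¬ q ∣ x) (sym (apply-vanish supp z))))
      strict : Frac a ρ i ⊎ Vanish P N ρ i → 𝟙 (frac? (apply a) ρ i) < 𝟙 (frac? a ρ i)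
      strict (inj₁ f) = subst₂ _<_ (sym (𝟙-no (frac? (apply a) ρ i) λ g → g q∣b))
        (sym (𝟙-yes (frac? a ρ i) f)) z<s
      strict (inj₂ (p , n)) = ⊥-elim (<-irrefl refl (subst (0 <_) (cong₂ _+_ p n) moved))
    ... | no none = let b , a′⇝b , less = push k (apply a) supp′ q∣′
                    in b , ⇝-trans (apply-⇝ supp) a′⇝b , ≤-trans less fewer
      where
      supp′ : Supported (apply a) P N
      supp′ ρ i with q ∣? apply a ρ i
      ... | no f = inj₁ f
      ... | yes q∣b with P ρ i + N ρ i in e
      ...   | zero  = inj₂ (m+n≡0⇒m≡0 (P ρ i) e , m+n≡0⇒n≡0 (P ρ i) e)
      ...   | suc _ = ⊥-elim (none ((ρ , i) , q∣b , subst (0 <_) (sym e) z<s))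
      q∣′ : q ∣ apply a row₀ col₀ + k
      q∣′ = subst (q ∣_) (sym (trans (cong₂ (λ x y → (a row₀ col₀ + x ∸ y) + k) P₀≡1 N₀≡0)
        (+-assoc (a row₀ col₀) 1 k))) q∣
      fewer : #frac (apply a) ≤ #frac a
      fewer = ∑-mono (R ⊗ Q) λ (ρ , i) → helper ρ i (supp ρ i)
        where
        helper : ∀ ρ i → Frac a ρ i ⊎ Vanish P N ρ i → 𝟙 (frac? (apply a) ρ i) ≤ 𝟙 (frac? a ρ i)
        helper ρ i z with frac? (apply a) ρ i
        ... | no _ = z≤n
        helper ρ i (inj₁ f) | yes _ = ≤-reflexive (sym (𝟙-yes (frac? a ρ i) f))
        helper ρ i (inj₂ z) | yes g = ≤-reflexive (sym (𝟙-yes (frac? a ρ i) (subst (λ x → ¬ q ∣ x) (apply-vanish supp z) g)))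

  clear-fractions : ∀ n a → #frac a ≤ n → (∀ ρ → q ∣ ∑ Q (a ρ)) → (∀ i → q ∣ ∑ R λ ρ → a ρ i) → 0 < q →
                    Σ Matrix λ b → a ⇝ b × (∀ ρ i → q ∣ b ρ i)
  clear-fractions n a bound rowsum colsum q>0 with exists? (R ⊗ Q) (λ (ρ , i) → frac? a ρ i)
  ... | no none = a , ⇝-refl , λ ρ i → decidable-stable (q ∣? a ρ i) λ f → none ((ρ , i) , f)
  ... | yes ((ρ , i) , f) with n
  ...   | zero = ⊥-elim (0≢1+n (trans (sym (∑≡0⇒≡0 (R ⊗ Q) (n≤0⇒n≡0 bound) (ρ , i))) (𝟙-yes (frac? a ρ i) f)))
  ...   | suc n′ =
    let s , supp = fractional-shift a rowsum colsum ρ i f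
        x = a (Shift.row₀ s) (Shift.col₀ s)
        -- `x + pred q * x` is `q * x`, a multiple of `q`, so this budget is large enough.
        b , a⇝b , less = push s (pred q * x) a supp (subst (q ∣_) (q*x x) (m∣m*n x))
        module B = _⇝_ a⇝b
        c , b⇝c , q∣c = clear-fractions n′ b (s≤s⁻¹ (≤-trans less bound))
          (λ ρ → subst (q ∣_) (sym (B.rows ρ)) (rowsum ρ))
          (λ i → subst (q ∣_) (sym (B.cols i)) (colsum i)) q>0
    in c , ⇝-trans a⇝b b⇝c , q∣c
    where
    q*x : ∀ x → q * x ≡ x + pred q * x
    q*x x = cong (_* x) (sym (suc-pred q {{>-nonZero q>0}}))

  round : ∀ a → (∀ ρ → q ∣ ∑ Q (a ρ)) → (∀ i → q ∣ ∑ R λ ρ → a ρ i) → 0 < q → Σ Matrix λ b →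
          (∀ ρ → q * ∑ Q (b ρ) ≡ ∑ Q (a ρ)) × (∀ i → q * ∑ R (λ ρ → b ρ i) ≡ ∑ R λ ρ → a ρ i) ×
          (∀ ρ i f → a ρ i ≤ q * f → b ρ i ≤ f)
  round a rowsum colsum q>0 with clear-fractions (#frac a) a ≤-refl rowsum colsum q>0
  ... | c , a⇝c , q∣c = b
      , (λ ρ → trans (sym (∑-*ˡ Q q (b ρ))) (trans (∑-cong Q λ i → sym (c≡ ρ i)) (rows ρ)))
      , (λ i → trans (sym (∑-*ˡ R q λ ρ → b ρ i)) (trans (∑-cong R λ ρ → sym (c≡ ρ i)) (cols i)))
      , (λ ρ i f a≤ → *-cancelˡ-≤ q {{>-nonZero q>0}} (subst (_≤ q * f) (c≡ ρ i) (bound ρ i f a≤)))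
    where
    open _⇝_ a⇝c
    b : Matrix
    b ρ i = quotient (q∣c ρ i)
    c≡ : ∀ ρ i → c ρ i ≡ q * b ρ i
    c≡ ρ i = m∣n⇒n≡m*quotient (q∣c ρ i)

-- Splitting off one vertex

nC0≡1 : ∀ n → n C 0 ≡ 1
nC0≡1 zero    = refl
nC0≡1 (suc n) = nCn≡1 0

pascal : ∀ n k → suc n C suc k ≡ n C k + n C suc k
pascal n k = sym (nCk+nC[k+1]≡[n+1]C[k+1] n k)

-- The identity k C(n,k) = n C(n-1,k-1), shifted to avoid subtraction; it follows by induction from
-- Pascal's rule.
absorption : ∀ n k → suc k * (suc n C suc k) ≡ suc n * (n C k)
absorption zero zero = refl
absorption zero (suc k) = trans (cong (suc (suc k) *_) (k>n⇒nCk≡0 {1} {suc (suc k)} (s<s z<s)))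
  (trans (*-zeroʳ (suc (suc k))) (sym (cong (1 *_) (k>n⇒nCk≡0 {0} {suc k} z<s))))
absorption (suc n) zero = trans (*-identityˡ _) (trans (nC1≡n (suc (suc n)))
  (sym (trans (cong (suc (suc n) *_) (nC0≡1 (suc n))) (*-identityʳ _))))
absorption (suc n) (suc k) = begin
  suc (suc k) * (suc (suc n) C suc (suc k))
    ≡⟨ cong (suc (suc k) *_) (pascal (suc n) (suc k)) ⟩
  suc (suc k) * (A + B)
    ≡⟨ split (suc k) A B ⟩
  A + suc k * A + suc (suc k) * B
    ≡⟨ cong₂ (λ y z → A + y + z) (absorption n k) (absorption n (suc k)) ⟩
  A + suc n * (n C k) + suc n * (n C suc k)
    ≡⟨ join (suc n) A (n C k) (n C suc k) ⟩
  A + suc n * (n C k + n C suc k)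
    ≡⟨ cong (λ z → A + suc n * z) (pascal n k) ⟨
  suc (suc n) * A ∎
  where
  open ≡-Reasoning
  A = suc n C suc k
  B = suc n C suc (suc k)
  split : ∀ k a b → suc k * (a + b) ≡ a + k * a + suc k * b
  split = solve-∀
  join : ∀ n a y z → a + n * y + n * z ≡ a + n * (y + z)
  join = solve-∀

δ-sym : ∀ T s t → δ T s t ≡ δ T t s
δ-sym T s t with compareE T s t
... | same e refl = refl
... | diff e s≢t  = trans e (sym (δ-≢ T (s≢t ∘ sym)))

-- `g` is `n / suc p` rounded up; the deficit `e` becomes the slack of a row.
ceiling : ∀ p n → Σ (ℕ × ℕ) λ (g , e) → n + e ≡ suc p * g × e ≤ p
ceiling p zero = (0 , 0) , sym (*-zeroʳ (suc p)) , z≤n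
ceiling p (suc n) with ceiling p n
... | (g , suc e) , eq , e≤ = (g , e) , trans (sym (+-suc n e)) eq , ≤-trans (n≤1+n e) e≤
... | (g , zero)  , eq , _  = (suc g , p)
  , trans (cong (λ z → suc (z + p)) (trans (sym (+-identityʳ n)) eq)) (lemma p g) , ≤-refl
  where
  lemma : ∀ p g → suc (suc p * g + p) ≡ suc p * suc g
  lemma = solve-∀

-- Of the `m * (suc p C w)` edges with `w` vertices in the block, the number that contain one chosen
-- vertex of it.
lower : ℕ → ℕ → ℕ → ℕ
lower p m zero    = 0
lower p m (suc w) = m * (p C w)

lower-weight : ∀ p m w → suc p * lower p m w ≡ w * (m * (suc p C w))
lower-weight p m zero    = *-zeroʳ (suc p)
lower-weight p m (suc w) = begin
  suc p * (m * (p C w))          ≡⟨ m*[n*o]≡n*[m*o] (suc p) m _ ⟩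
  m * (suc p * (p C w))          ≡⟨ cong (m *_) (absorption p w) ⟨
  m * (suc w * (suc p C suc w))  ≡⟨ m*[n*o]≡n*[m*o] m (suc w) _ ⟩
  suc w * (m * (suc p C suc w))  ∎
  where open ≡-Reasoning

-- One vertex is split off a block of suc p amalgamated vertices.  Class c has
-- x c t edges of type t, each meeting the block w t times; h c t of them will
-- contain the new vertex.  Every set {t | lab c t ≡ κ} receives at most its
-- fair share of the d c edges of class c at the new vertex, rounded up.
module Split (K : ℕ) (T : Code) (l p : ℕ) (w M : El T → ℕ) (d : Fin K → ℕ)
             (x : Fin K → El T → ℕ) (lab : Fin K → El T → Fin l)
             (total  : ∀ t → ∑ (fin K) (λ c → x c t) ≡ M t * (suc p C w t))
             (weight : ∀ c → ∑ T (λ t → w t * x c t) ≡ suc p * d c) where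

  classWeight : Fin K → Fin l → ℕ
  classWeight c κ = ∑ T λ t → δ (fin l) (lab c t) κ * (w t * x c t)

  ∑-classes : ∀ c (f : El T → ℕ) → ∑ (fin l) (λ κ → ∑ T λ t → δ (fin l) (lab c t) κ * f t) ≡ ∑ T f
  ∑-classes c f = trans (∑-swap (fin l) T _) (∑-cong T λ t →
    trans (∑-*ʳ (fin l) (f t) _) (trans (cong (_* f t) (∑-δ₁ (fin l) (lab c t))) (*-identityˡ _)))

  present⇒w≤ : ∀ c t → 0 < x c t → w t ≤ suc p
  present⇒w≤ c t pos with w t ≤? suc p
  ... | yes le = le
  ... | no nle = ⊥-elim (<-irrefl refl (≤-trans pos (≤-trans (≤∑ (fin K) (λ c → x c t) c) (≤-reflexive
      (trans (total t) (trans (cong (M t *_) (k>n⇒nCk≡0 (≰⇒> nle))) (*-zeroʳ (M t))))))))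

  record Hits : Set where
    field
      h     : Fin K → El T → ℕ
      h-tot : ∀ t → ∑ (fin K) (λ c → h c t) ≡ lower p (M t) (w t)
      h-deg : ∀ c → ∑ T (h c) ≡ d c
      h≤x   : ∀ c t → h c t ≤ x c t
      fair  : ∀ c κ → suc p * ∑ T (λ t → δ (fin l) (lab c t) κ * h c t) ≤ classWeight c κ + p

  private
    g e : Fin K → Fin l → ℕ
    g c κ = proj₁ (proj₁ (ceiling p (classWeight c κ)))
    e c κ = proj₂ (proj₁ (ceiling p (classWeight c κ)))

    q*g : ∀ c κ → classWeight c κ + e c κ ≡ suc p * g c κ
    q*g c κ = proj₁ (proj₂ (ceiling p (classWeight c κ)))

    R Q : Code
    R = fin K ⊗ fin l
    Q = T ⊕ fin K

    open Rounding R Q (suc p)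

    -- The last K columns are slack, making all row sums divisible by suc p.
    a : El R → El Q → ℕ
    a (c , κ) (inj₁ t)  = δ (fin l) (lab c t) κ * (w t * x c t)
    a (c , κ) (inj₂ c′) = δ (fin K) c c′ * e c κ

    row : ∀ c κ → ∑ Q (a (c , κ)) ≡ suc p * g c κ
    row c κ = trans (cong (classWeight c κ +_) (∑-δ (fin K) c λ _ → e c κ)) (q*g c κ)

    col-type : ∀ t → ∑ R (λ ρ → a ρ (inj₁ t)) ≡ suc p * lower p (M t) (w t)
    col-type t = begin
      ∑ (fin K) (λ c → ∑ (fin l) λ κ → δ (fin l) (lab c t) κ * (w t * x c t))
        ≡⟨ ∑-cong (fin K) (λ c → ∑-δ (fin l) (lab c t) λ _ → w t * x c t) ⟩
      ∑ (fin K) (λ c → w t * x c t)  ≡⟨ ∑-*ˡ (fin K) (w t) _ ⟩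
      w t * ∑ (fin K) (λ c → x c t)  ≡⟨ cong (w t *_) (total t) ⟩
      w t * (M t * (suc p C w t))    ≡⟨ lower-weight p (M t) (w t) ⟨
      suc p * lower p (M t) (w t)    ∎
      where open ≡-Reasoning

    ∑-diagonal : ∀ c (f : Fin K → Fin l → ℕ) →
      ∑ R (λ (c′ , κ) → δ (fin K) c′ c * f c′ κ) ≡ ∑ (fin l) (f c)
    ∑-diagonal c f = trans
      (∑-cong (fin K) λ c′ → trans (∑-*ˡ (fin l) (δ (fin K) c′ c) (f c′)) (cong (_* ∑ (fin l) (f c′)) (δ-sym (fin K) c′ c)))
      (∑-δ (fin K) c λ c′ → ∑ (fin l) (f c′))

    -- Consequently `suc p` divides the total slack of a class, which is the condition on slack
    -- columns that `round` asks for.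
    ∑-e : ∀ c → suc p * ∑ (fin l) (g c) ≡ suc p * d c + ∑ (fin l) (e c)
    ∑-e c = begin
      suc p * ∑ (fin l) (g c)                            ≡⟨ ∑-*ˡ (fin l) (suc p) (g c) ⟨
      ∑ (fin l) (λ κ → suc p * g c κ)                    ≡⟨ ∑-cong (fin l) (q*g c) ⟨
      ∑ (fin l) (λ κ → classWeight c κ + e c κ)          ≡⟨ ∑-+ (fin l) _ _ ⟩
      ∑ (fin l) (classWeight c) + ∑ (fin l) (e c)
        ≡⟨ cong (_+ ∑ (fin l) (e c)) (trans (∑-classes c _) (weight c)) ⟩
      suc p * d c + ∑ (fin l) (e c)                      ∎
      where open ≡-Reasoning

    rounded = round a
      (λ (c , κ) → subst (suc p ∣_) (sym (row c κ)) (m∣m*n (g c κ)))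
      (λ { (inj₁ t) → subst (suc p ∣_) (sym (col-type t)) (m∣m*n _)
         ; (inj₂ c) → subst (suc p ∣_) (sym (∑-diagonal c e))
             (∣m+n∣m⇒∣n (subst (suc p ∣_) (∑-e c) (m∣m*n _)) (m∣m*n (d c))) })
      z<s

    b : El R → El Q → ℕ
    b = proj₁ rounded

    b-row : ∀ c κ → ∑ Q (b (c , κ)) ≡ g c κ
    b-row c κ = *-cancelˡ-≡ _ _ (suc p) (trans (proj₁ (proj₂ rounded) (c , κ)) (row c κ))

    b-col : ∀ i → suc p * ∑ R (λ ρ → b ρ i) ≡ ∑ R λ ρ → a ρ i
    b-col = proj₁ (proj₂ (proj₂ rounded))

    b≤ : ∀ ρ i f → a ρ i ≤ suc p * f → b ρ i ≤ f
    b≤ = proj₂ (proj₂ (proj₂ rounded))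

    -- Entries off the label of `t` vanish already in `a`. On it the share `w t * x c t / suc p` is
    -- at most `x c t`, because a type that is present has `w t ≤ suc p`.
    b-supp : ∀ c κ t → b (c , κ) (inj₁ t) ≤ δ (fin l) (lab c t) κ * x c t
    b-supp c κ t = b≤ (c , κ) (inj₁ t) _ (subst (a (c , κ) (inj₁ t) ≤_) (m*[n*o]≡n*[m*o] (δ (fin l) (lab c t) κ) (suc p) (x c t))
      (*-monoʳ-≤ (δ (fin l) (lab c t) κ) (w*x≤ (x c t) refl)))
      where
      w*x≤ : ∀ y → x c t ≡ y → w t * x c t ≤ suc p * x c t
      w*x≤ zero    eq = subst (λ y → w t * y ≤ suc p * y) (sym eq) (≤-trans (≤-reflexive (*-zeroʳ (w t))) z≤n)
      w*x≤ (suc _) eq = *-monoˡ-≤ (x c t) (present⇒w≤ c t (subst (0 <_) (sym eq) z<s))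

    b-slack : ∀ c c′ κ → b (c , κ) (inj₂ c′) ≡ δ (fin K) c c′ * b (c , κ) (inj₂ c′)
    b-slack c c′ κ with compareE (fin K) c c′
    ... | same eq _ rewrite eq = sym (*-identityˡ _)
    ... | diff eq _ rewrite eq = n≤0⇒n≡0 (b≤ (c , κ) (inj₂ c′) 0
      (subst (λ z → z * e c κ ≤ suc p * 0) (sym eq) z≤n))

    h : Fin K → El T → ℕ
    h c t = ∑ (fin l) λ κ → b (c , κ) (inj₁ t)

    slack : Fin K → ℕ
    slack c = ∑ (fin l) λ κ → b (c , κ) (inj₂ c)

    q*slack : ∀ c → suc p * slack c ≡ ∑ (fin l) (e c)
    q*slack c = trans (cong (suc p *_) (sym (trans
        (∑-cong (fin K) λ c′ → ∑-cong (fin l) λ κ → b-slack c′ c κ)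
        (∑-diagonal c λ c′ κ → b (c′ , κ) (inj₂ c)))))
      (trans (b-col (inj₂ c)) (∑-diagonal c e))

    ∑-g : ∀ c → ∑ T (h c) + slack c ≡ ∑ (fin l) (g c)
    ∑-g c = begin
      ∑ T (h c) + slack c
        ≡⟨ cong₂ _+_ (∑-swap T (fin l) λ t κ → b (c , κ) (inj₁ t)) (∑-cong (fin l) λ κ →
             sym (trans (∑-cong (fin K) λ c′ → b-slack c c′ κ) (∑-δ (fin K) c λ c′ → b (c , κ) (inj₂ c′)))) ⟩
      ∑ (fin l) (λ κ → ∑ T λ t → b (c , κ) (inj₁ t)) + ∑ (fin l) (λ κ → ∑ (fin K) λ c′ → b (c , κ) (inj₂ c′))
        ≡⟨ ∑-+ (fin l) _ _ ⟨
      ∑ (fin l) (λ κ → ∑ Q (b (c , κ)))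
        ≡⟨ ∑-cong (fin l) (b-row c) ⟩
      ∑ (fin l) (g c) ∎
      where open ≡-Reasoning

    -- Rounding up the rows overshoots by exactly the slack. The slack column keeps its margin under
    -- rounding, so taking it away leaves precisely `d c`.
    deg-h : ∀ c → ∑ T (h c) ≡ d c
    deg-h c = *-cancelˡ-≡ _ _ (suc p) (+-cancelʳ-≡ (suc p * slack c) _ _ (begin
      suc p * ∑ T (h c) + suc p * slack c  ≡⟨ *-distribˡ-+ (suc p) _ (slack c) ⟨
      suc p * (∑ T (h c) + slack c)        ≡⟨ cong (suc p *_) (∑-g c) ⟩
      suc p * ∑ (fin l) (g c)              ≡⟨ ∑-e c ⟩
      suc p * d c + ∑ (fin l) (e c)        ≡⟨ cong (suc p * d c +_) (q*slack c) ⟨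
      suc p * d c + suc p * slack c        ∎))
      where open ≡-Reasoning

    δh≤b : ∀ c κ t → δ (fin l) (lab c t) κ * h c t ≤ b (c , κ) (inj₁ t)
    δh≤b c κ t with compareE (fin l) (lab c t) κ
    ... | diff eq _ rewrite eq = z≤n
    ... | same eq refl rewrite eq = ≤-reflexive (trans (*-identityˡ _) (trans
        (∑-cong (fin l) pointwise) (∑-δ (fin l) (lab c t) λ κ → b (c , κ) (inj₁ t))))
      where
      pointwise : ∀ κ → b (c , κ) (inj₁ t) ≡ δ (fin l) (lab c t) κ * b (c , κ) (inj₁ t)
      pointwise κ with compareE (fin l) (lab c t) κ
      ... | same eq′ _ rewrite eq′ = sym (*-identityˡ _)
      ... | diff eq′ _ rewrite eq′ = n≤0⇒n≡0
        (subst (λ z → b (c , κ) (inj₁ t) ≤ z * x c t) eq′ (b-supp c κ t))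

  hits : Hits
  hits = record
    { h = h
    ; h-tot = λ t → *-cancelˡ-≡ _ _ (suc p) (trans (b-col (inj₁ t)) (col-type t))
    ; h-deg = deg-h
    ; h≤x = λ c t → ≤-trans (∑-mono (fin l) λ κ → b-supp c κ t)
        (≤-reflexive (∑-δ (fin l) (lab c t) λ _ → x c t))
    ; fair = λ c κ → ≤-trans (*-monoʳ-≤ (suc p) (≤-trans (∑-mono T (δh≤b c κ))
        (≤-trans (m≤m+n _ _) (≤-reflexive (b-row c κ)))))
        (≤-trans (≤-reflexive (sym (q*g c κ)))
          (+-monoʳ-≤ (classWeight c κ) (proj₂ (proj₂ (ceiling p (classWeight c κ))))))
    }

-- Connected detachment of a whole block

bit : Bool → ℕ
bit false = 0
bit true  = 1

-- The connectivity invariant. A blank edge needs three incidences because a hit spends one of them,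
-- and the edge then lies in the new vertex's component, which must have two left.
Spread : ∀ {K T l} (w : El T → ℕ) (x : Fin K → El T → ℕ) (lab : Fin K → El T → Fin (suc l)) → Fin K → Set
Spread {K} {T} {l} w x lab c = ∀ t → 0 < x c t →
  (lab c t ≡ zero × 3 ≤ w t) ⊎
  (lab c t ≢ zero × 2 ≤ ∑ T λ s → δ (fin (suc l)) (lab c s) (lab c t) * (w s * x c s))

-- A type t stands for edges already having a trace on the old vertices; lab
-- groups the types whose traces are connected to each other.  The label zero
-- is reserved for the empty trace, whose edges are not connected to each other.
-- `connected` says that a 2-colouring of the old connected groups and of the
-- new vertices that no edge of class c crosses is constant.
record Detachment (K : ℕ) (T : Code) (l p : ℕ) (w M : El T → ℕ) (d : Fin K → ℕ)
                  (x : Fin K → El T → ℕ) (lab : Fin K → El T → Fin (suc l)) : Set where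
  field
    z      : Fin K → El T → Subset p → ℕ
    z-tot  : ∀ t Z → ∑ (fin K) (λ c → z c t Z) ≡ 𝟙 (∣ Z ∣ ≟ w t) * M t
    z-type : ∀ c t → ∑ (sub p) (z c t) ≡ x c t
    z-deg  : ∀ c v → ∑ T (λ t → ∑ (sub p) λ Z → bit (lookup Z v) * z c t Z) ≡ d c
    connected : ∀ c → Spread {T = T} w x lab c → 2 ≤ d c → (φ : El T → Bool) (U : Fin p → Bool) →
      (∀ s t → 0 < x c s → 0 < x c t → lab c s ≡ lab c t → lab c t ≢ zero → φ s ≡ φ t) →
      (∀ t Z v → lab c t ≢ zero → 0 < z c t Z → lookup Z v ≡ true → U v ≡ φ t) →
      (∀ t Z u v → lab c t ≡ zero → 0 < z c t Z → lookup Z u ≡ true → lookup Z v ≡ true → U u ≡ U v) →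
      (∀ t v → lab c t ≢ zero → 0 < x c t → φ t ≡ U v) × (∀ u v → U u ≡ U v)

module DetachStep (K : ℕ) (T : Code) (l p : ℕ) (w M : El T → ℕ) (d : Fin K → ℕ)
             (x : Fin K → El T → ℕ) (lab : Fin K → El T → Fin (suc l))
             (total  : ∀ t → ∑ (fin K) (λ c → x c t) ≡ M t * (suc p C w t))
             (weight : ∀ c → ∑ T (λ t → w t * x c t) ≡ suc p * d c)
             (hits : Split.Hits K T (suc l) p w M d x lab total weight) where

  open Split K T (suc l) p w M d x lab total weight hiding (hits)
  open Hits hits

  -- `inj₁ t` stands for the edges of type `t` that miss the new vertex, `inj₂ t` for those that
  -- contain it. When `w t` is zero there are none of the latter, so `M′` is zero there.
  w′ M′ : El (T ⊕ T) → ℕ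
  w′ (inj₁ t) = w t
  w′ (inj₂ t) = pred (w t)
  M′ (inj₁ t) = M t
  M′ (inj₂ t) with w t
  ... | zero  = 0
  ... | suc _ = M t

  x′ : Fin K → El (T ⊕ T) → ℕ
  x′ c (inj₁ t) = x c t ∸ h c t
  x′ c (inj₂ t) = h c t

  x′+h : ∀ c t → x′ c (inj₁ t) + h c t ≡ x c t
  x′+h c t = m∸n+n≡m (h≤x c t)

  hitCount : Fin K → Fin (suc l) → ℕ
  hitCount c κ = ∑ T λ t → δ (fin (suc l)) (lab c t) κ * h c t

  -- suc zero labels the group of the new vertex, which absorbs all groups it hits.
  relabel : ℕ → Fin (suc l) → Fin (suc (suc l))
  relabel n       zero    = zero
  relabel zero    (suc κ) = suc (suc κ)
  relabel (suc _) (suc κ) = suc zero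

  data Relabeled (n : ℕ) (κ : Fin (suc l)) : Set where
    isBlank : κ ≡ zero → relabel n κ ≡ zero → Relabeled n κ
    isHit   : κ ≢ zero → 0 < n → relabel n κ ≡ suc zero → Relabeled n κ
    isUnhit : ∀ κ′ → n ≡ 0 → κ ≡ suc κ′ → relabel n κ ≡ suc (suc κ′) → Relabeled n κ

  relabeled : ∀ n κ → Relabeled n κ
  relabeled n       zero    = isBlank refl refl
  relabeled zero    (suc κ) = isUnhit κ refl refl refl
  relabeled (suc n) (suc κ) = isHit (λ ()) z<s refl

  lab′ : Fin K → El (T ⊕ T) → Fin (suc (suc l))
  lab′ c (inj₁ t) = relabel (hitCount c (lab c t)) (lab c t)
  lab′ c (inj₂ t) = suc zero

  lower-M′ : ∀ t → lower p (M t) (w t) ≡ M′ (inj₂ t) * (p C w′ (inj₂ t))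
  lower-M′ t with w t
  ... | zero  = refl
  ... | suc _ = refl

  lower-pascal : ∀ m v → m * (suc p C v) ≡ m * (p C v) + lower p m v
  lower-pascal m zero    = trans (cong (m *_) (trans (nC0≡1 (suc p)) (sym (nC0≡1 p)))) (sym (+-identityʳ _))
  lower-pascal m (suc v) = trans (cong (m *_) (pascal p v))
    (trans (*-distribˡ-+ m (p C v) _) (+-comm (m * (p C v)) _))

  total′ : ∀ t → ∑ (fin K) (λ c → x′ c t) ≡ M′ t * (p C w′ t)
  total′ (inj₁ t) = +-cancelʳ-≡ (∑ (fin K) λ c → h c t) _ _ (begin
    ∑ (fin K) (λ c → x′ c (inj₁ t)) + ∑ (fin K) (λ c → h c t)  ≡⟨ ∑-+ (fin K) _ _ ⟨
    ∑ (fin K) (λ c → x′ c (inj₁ t) + h c t)  ≡⟨ ∑-cong (fin K) (λ c → x′+h c t) ⟩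
    ∑ (fin K) (λ c → x c t)                  ≡⟨ trans (total t) (lower-pascal (M t) (w t)) ⟩
    M t * (p C w t) + lower p (M t) (w t)    ≡⟨ cong (M t * (p C w t) +_) (h-tot t) ⟨
    M t * (p C w t) + ∑ (fin K) (λ c → h c t) ∎)
    where open ≡-Reasoning
  total′ (inj₂ t) = trans (h-tot t) (lower-M′ t)

  pred-w*h : ∀ c t → h c t + pred (w t) * h c t ≡ w t * h c t
  pred-w*h c t = helper (w t) refl
    where
    helper : ∀ v → w t ≡ v → h c t + pred v * h c t ≡ v * h c t
    helper (suc v) _  = refl
    helper zero    eq = trans (+-identityʳ _) (∑≡0⇒≡0 (fin K) (trans (h-tot t) (cong (lower p (M t)) eq)) c)

  -- Incidences of type `t` with the block that remains after the splitting.
  rest : Fin K → El T → ℕ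
  rest c t = w t * x′ c (inj₁ t) + pred (w t) * h c t

  h+rest : ∀ c t → h c t + rest c t ≡ w t * x c t
  h+rest c t = begin
    h c t + (w t * x′ c (inj₁ t) + pred (w t) * h c t)  ≡⟨ m+[n+o]≡n+[m+o] (h c t) (w t * x′ c (inj₁ t)) (pred (w t) * h c t) ⟩
    w t * x′ c (inj₁ t) + (h c t + pred (w t) * h c t)  ≡⟨ cong (w t * x′ c (inj₁ t) +_) (pred-w*h c t) ⟩
    w t * x′ c (inj₁ t) + w t * h c t                   ≡⟨ *-distribˡ-+ (w t) _ (h c t) ⟨
    w t * (x′ c (inj₁ t) + h c t)                       ≡⟨ cong (w t *_) (x′+h c t) ⟩
    w t * x c t                                         ∎
    where open ≡-Reasoning

  ∑-rest : ∀ c → ∑ T (rest c) ≡ p * d c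
  ∑-rest c = +-cancelˡ-≡ (d c) _ _ (begin
    d c + ∑ T (rest c)           ≡⟨ cong (_+ ∑ T (rest c)) (h-deg c) ⟨
    ∑ T (h c) + ∑ T (rest c)     ≡⟨ ∑-+ T _ _ ⟨
    ∑ T (λ t → h c t + rest c t) ≡⟨ ∑-cong T (h+rest c) ⟩
    ∑ T (λ t → w t * x c t)      ≡⟨ weight c ⟩
    suc p * d c                  ∎)
    where open ≡-Reasoning

  weight′ : ∀ c → ∑ (T ⊕ T) (λ t → w′ t * x′ c t) ≡ p * d c
  weight′ c = trans (sym (∑-+ T _ _)) (∑-rest c)

  classRest : Fin K → Fin (suc l) → ℕ
  classRest c κ = ∑ T λ t → δ (fin (suc l)) (lab c t) κ * rest c t

  hits+rest : ∀ c κ → hitCount c κ + classRest c κ ≡ classWeight c κ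
  hits+rest c κ = trans (sym (∑-+ T _ _)) (∑-cong T λ t →
    trans (sym (*-distribˡ-+ (δ (fin (suc l)) (lab c t) κ) (h c t) _))
          (cong (δ (fin (suc l)) (lab c t) κ *_) (h+rest c t)))

  label≡ : ∀ c t κ {y} → 0 < δ (fin (suc l)) (lab c t) κ * y → lab c t ≡ κ × 0 < y
  label≡ c t κ {y} pos with compareE (fin (suc l)) (lab c t) κ
  ... | same e eq = eq , subst (0 <_) (trans (cong (_* y) e) (*-identityˡ y)) pos
  ... | diff e _  = ⊥-elim (<-irrefl refl (subst (0 <_) (cong (_* y) e) pos))

  inClass : ∀ c t (f : El T → ℕ) → f t ≤ ∑ T λ s → δ (fin (suc l)) (lab c s) (lab c t) * f s
  inClass c t f = ≤-trans (≤-reflexive (sym (trans (cong (_* f t) (δ-refl (fin (suc l)) (lab c t))) (*-identityˡ _))))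
    (≤∑ T (λ s → δ (fin (suc l)) (lab c s) (lab c t) * f s) t)

  unhit⇒h≡0 : ∀ c t → hitCount c (lab c t) ≡ 0 → h c t ≡ 0
  unhit⇒h≡0 c t e = n≤0⇒n≡0 (≤-trans (inClass c t (h c)) (≤-reflexive e))

  -- Incidences of the new vertex's component with the remaining block.
  merged : Fin K → ℕ
  merged c = ∑ (T ⊕ T) λ s → δ (fin (suc (suc l))) (lab′ c s) (suc zero) * (w′ s * x′ c s)

  mergedPart : Fin K → El T → ℕ
  mergedPart c t = δ (fin (suc (suc l))) (lab′ c (inj₁ t)) (suc zero) * (w t * x′ c (inj₁ t)) + pred (w t) * h c t

  -- What the edges with old label `κ` contribute to `merged c`: all remaining incidences of a hit
  -- component, but for label `zero` only those of the edges that were themselves hit.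
  part : Fin K → Fin (suc l) → ℕ
  part c κ = ∑ T λ t → δ (fin (suc l)) (lab c t) κ * mergedPart c t

  merged-parts : ∀ c → merged c ≡ ∑ (fin (suc l)) (part c)
  merged-parts c = trans (cong (∑ T (λ t → δ (fin (suc (suc l))) (lab′ c (inj₁ t)) (suc zero) * (w t * x′ c (inj₁ t))) +_)
      (∑-cong T λ t → *-identityˡ _))
    (trans (sym (∑-+ T _ _)) (sym (∑-classes c (mergedPart c))))

  classRest≤part : ∀ c κ → 0 < hitCount c (suc κ) → classRest c (suc κ) ≤ part c (suc κ)
  classRest≤part c κ hit = ∑-mono T pointwise
    where
    pointwise : ∀ t → δ (fin (suc l)) (lab c t) (suc κ) * rest c t ≤ δ (fin (suc l)) (lab c t) (suc κ) * mergedPart c t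
    pointwise t with compareE (fin (suc l)) (lab c t) (suc κ)
    ... | diff e _ rewrite e = z≤n
    ... | same _ eq = *-monoʳ-≤ (δ (fin (suc l)) (lab c t) (suc κ)) (+-monoˡ-≤ _ (≤-reflexive
        (sym (trans (cong (_* (w t * x′ c (inj₁ t))) one) (*-identityˡ _)))))
      where
      relabel-hit : ∀ n → 0 < n → relabel n (suc κ) ≡ suc zero
      relabel-hit (suc n) _ = refl
      one : δ (fin (suc (suc l))) (lab′ c (inj₁ t)) (suc zero) ≡ 1
      one = cong (λ κ′ → δ (fin (suc (suc l))) κ′ (suc zero))
        (trans (cong (λ κ′ → relabel (hitCount c κ′) κ′) eq) (relabel-hit _ hit))

  module _ (c : Fin K) (spread : Spread {T = T} w x lab c) (2≤d : 2 ≤ d c) where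

    hit-present : ∀ {t} → 0 < h c t → 0 < x c t
    hit-present pos = ≤-trans pos (h≤x c _)

    someHit : ∃ λ t → 0 < h c t
    someHit = ∑>0⇒∃ T (subst (0 <_) (sym (h-deg c)) (≤-trans z<s 2≤d))

    classWeight≥2 : ∀ κ → 0 < classWeight c κ → 2 ≤ classWeight c κ
    classWeight≥2 κ pos with ∑>0⇒∃ T pos
    ... | t , pos′ with label≡ c t κ pos′
    ... | refl , wx>0 with spread t (n≢0⇒n>0 λ e → <⇒≢ wx>0 (sym (trans (cong (w t *_) e) (*-zeroʳ (w t)))))
    ...   | inj₂ (_ , two) = two
    ...   | inj₁ (_ , 3≤w) = ≤-trans (≤-trans (n≤1+n 2) (≤-trans 3≤w (m≤m*n′ (w t) (x c t) wx>0))) (inClass c t λ s → w s * x c s)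
      where
      m≤m*n′ : ∀ m n → 0 < m * n → m ≤ m * n
      m≤m*n′ m zero    pos = ⊥-elim (<⇒≢ pos (sym (*-zeroʳ m)))
      m≤m*n′ m (suc n) _   = m≤m*n m (suc n)

    -- A blank edge has at least three incidences and spends one on the new vertex.
    blank-hit : ∀ t → lab c t ≡ zero → 0 < h c t → 2 ≤ part c zero
    blank-hit t eq pos = ≤-trans (*-mono-≤ (pred-mono-≤ w≥3) pos) (≤-trans (m≤n+m _ _)
      (subst (λ κ → mergedPart c t ≤ part c κ) eq (inClass c t (mergedPart c))))
      where
      w≥3 : 3 ≤ w t
      w≥3 with spread t (hit-present pos)
      ... | inj₁ (_ , 3≤w)   = 3≤w
      ... | inj₂ (≢zero , _) = ⊥-elim (≢zero eq)

    module _ (p>0 : 0 < p) where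

      -- If all `W` incidences were hit, fairness would give `suc p * W ≤ W + p`, hence `W ≤ 1` as
      -- `p` is positive; but `W` is at least two.
      classRest≥1 : ∀ κ → 0 < hitCount c κ → 1 ≤ classRest c κ
      classRest≥1 κ hit = n≢0⇒n>0 contra
        where
        W = classWeight c κ
        contra : classRest c κ ≢ 0
        contra e = <⇒≱ W≥2 (*-cancelˡ-≤ p {{>-nonZero p>0}}
            (subst (p * W ≤_) (sym (*-identityʳ p)) (+-cancelˡ-≤ W _ _ (subst (λ H → suc p * H ≤ W + p) H≡W (fair c κ)))))
          where
          H≡W : hitCount c κ ≡ W
          H≡W = trans (sym (+-identityʳ _)) (trans (cong (hitCount c κ +_) (sym e)) (hits+rest c κ))
          W≥2 : 2 ≤ W
          W≥2 = classWeight≥2 κ (subst (0 <_) H≡W hit)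

      -- Let `O` be the weight of all other groups, so that `r + O ≡ p * d c`. If `O` is zero, then
      -- `r` is `p * d c`, at least two. Otherwise `O ≥ 2`, and fairness reads `p * d c ≤ r + p`: it
      -- gives `O ≤ p`, so `p ≥ 2`, and with `d c ≥ 2` also `p ≤ r`.
      only-hit : ∀ κ → hitCount c κ ≡ d c → 2 ≤ classRest c κ
      only-hit κ H≡d = helper O refl
        where
        open ≤-Reasoning
        W = classWeight c κ
        r = classRest c κ
        O = ∑ (fin (suc l)) (off (fin (suc l)) κ (classWeight c))
        W+O : W + O ≡ suc p * d c
        W+O = trans (sym (∑-remove (fin (suc l)) κ (classWeight c))) (trans (∑-classes c _) (weight c))
        d+r : d c + r ≡ W
        d+r = trans (cong (_+ r) (sym H≡d)) (hits+rest c κ)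
        r+O : r + O ≡ p * d c
        r+O = +-cancelˡ-≡ (d c) _ _ (trans (sym (+-assoc (d c) r O)) (trans (cong (_+ O) d+r) W+O))
        pd≤r+p : p * d c ≤ r + p
        pd≤r+p = +-cancelˡ-≤ (d c) _ _ (subst (suc p * d c ≤_) (trans (cong (_+ p) (sym d+r)) (+-assoc (d c) r p))
          (subst (λ H → suc p * H ≤ W + p) H≡d (fair c κ)))
        2≤off : ∀ κ′ → 0 < off (fin (suc l)) κ (classWeight c) κ′ → 2 ≤ off (fin (suc l)) κ (classWeight c) κ′
        2≤off κ′ pos with compareE (fin (suc l)) κ κ′
        ... | same e _ rewrite e = ⊥-elim (<-irrefl refl pos)
        ... | diff e _ rewrite e = subst (2 ≤_) (sym (*-identityˡ _)) (classWeight≥2 κ′ (subst (0 <_) (*-identityˡ _) pos))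
        helper : ∀ o → O ≡ o → 2 ≤ r
        helper zero O≡0 = ≤-trans 2≤d (≤-trans (≤-trans (≤-reflexive (sym (*-identityˡ (d c)))) (*-monoˡ-≤ (d c) p>0))
          (≤-reflexive (trans (sym r+O) (trans (cong (r +_) O≡0) (+-identityʳ r)))))
        helper (suc _) O≡ = ≤-trans 2≤p p≤r
          where
          2≤O : 2 ≤ O
          2≤O with ∑>0⇒∃ (fin (suc l)) (subst (0 <_) (sym O≡) z<s)
          ... | κ′ , pos = ≤-trans (2≤off κ′ pos) (≤∑ (fin (suc l)) (off (fin (suc l)) κ (classWeight c)) κ′)
          2≤p : 2 ≤ p
          2≤p = ≤-trans 2≤O (+-cancelˡ-≤ r _ _ (≤-trans (≤-reflexive r+O) pd≤r+p))
          p≤r : p ≤ r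
          p≤r = +-cancelʳ-≤ p _ _ (≤-trans (≤-trans (≤-reflexive (double p)) (*-monoʳ-≤ p 2≤d)) pd≤r+p)
            where
            double : ∀ p → p + p ≡ p * 2
            double = solve-∀

      ≢zero⇒classRest≤part : ∀ κ → κ ≢ zero → 0 < hitCount c κ → classRest c κ ≤ part c κ
      ≢zero⇒classRest≤part zero    ≢z _   = ⊥-elim (≢z refl)
      ≢zero⇒classRest≤part (suc κ) _  hit = classRest≤part c κ hit

      -- Two hit groups keep at least one free incidence each.  A single hit group
      -- takes all d c hits, and then fairness leaves it two.
      merged≥2 : 2 ≤ merged c
      merged≥2 = subst (2 ≤_) (sym (merged-parts c)) bound
        where
        part≤ : ∀ κ → part c κ ≤ ∑ (fin (suc l)) (part c)
        part≤ = ≤∑ (fin (suc l)) (part c)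
        t₁ = proj₁ someHit
        κ₁ = lab c t₁
        hit₁ : 0 < hitCount c κ₁
        hit₁ = ≤-trans (proj₂ someHit) (inClass c t₁ (h c))
        hit? : ∀ κ → Dec (κ₁ ≢ κ × 0 < hitCount c κ)
        hit? κ = ¬? (κ₁ F.≟ κ) ×-dec (0 <? hitCount c κ)
        alone : ¬ (∃ λ κ → κ₁ ≢ κ × 0 < hitCount c κ) → hitCount c κ₁ ≡ d c
        alone none = trans (sym (+-identityʳ _)) (trans (cong (hitCount c κ₁ +_) (sym (∑-zero (fin (suc l)) off≡0)))
          (trans (sym (∑-remove (fin (suc l)) κ₁ (hitCount c))) (trans (∑-classes c (h c)) (h-deg c))))
          where
          off≡0 : ∀ κ → off (fin (suc l)) κ₁ (hitCount c) κ ≡ 0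
          off≡0 κ with compareE (fin (suc l)) κ₁ κ
          ... | same e _ rewrite e = refl
          ... | diff e ≢κ rewrite e = trans (*-identityˡ _) (n≤0⇒n≡0 (≮⇒≥ λ pos → none (κ , ≢κ , pos)))
        bound : 2 ≤ ∑ (fin (suc l)) (part c)
        bound with κ₁ F.≟ zero
        ... | yes eq = ≤-trans (blank-hit t₁ eq (proj₂ someHit)) (part≤ zero)
        ... | no ≢zero with exists? (fin (suc l)) hit?
        ...   | no none = ≤-trans (only-hit κ₁ (alone none))
                  (≤-trans (≢zero⇒classRest≤part κ₁ ≢zero hit₁) (part≤ κ₁))
        ...   | yes (κ₂ , κ₁≢κ₂ , hit₂) with κ₂ F.≟ zero
        ...     | no κ₂≢zero = ≤-trans (+-mono-≤
                    (≤-trans (classRest≥1 κ₁ hit₁) (≢zero⇒classRest≤part κ₁ ≢zero hit₁))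
                    (≤-trans (classRest≥1 κ₂ hit₂) (≢zero⇒classRest≤part κ₂ κ₂≢zero hit₂)))
                  (two≤∑ (fin (suc l)) (part c) κ₁≢κ₂)
        ...     | yes refl with ∑>0⇒∃ T hit₂
        ...       | t₂ , pos = ≤-trans (blank-hit t₂ (proj₁ (label≡ c t₂ zero pos)) (proj₂ (label≡ c t₂ zero pos))) (part≤ zero)

      Heavy : Fin (suc (suc l)) → Set
      Heavy κ′ = κ′ ≢ zero × 2 ≤ ∑ (T ⊕ T) λ s → δ (fin (suc (suc l))) (lab′ c s) κ′ * (w′ s * x′ c s)

      -- Components that are not hit lose no incidence, and blank edges that are missed keep their
      -- weight. Everything else lies in the new vertex's component, which `merged≥2` covers.
      spread′ : Spread {T = T ⊕ T} w′ x′ lab′ c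
      spread′ (inj₂ t) _ = inj₂ ((λ ()) , merged≥2)
      spread′ (inj₁ t) pos with relabeled (hitCount c (lab c t)) (lab c t)
      ... | isBlank eq e = inj₁ (e , [ proj₂ , (λ (n , _) → ⊥-elim (n eq)) ]′ (spread t (≤-trans pos (m∸n≤m (x c t) (h c t)))))
      ... | isHit _ _ e = inj₂ (subst Heavy (sym e) ((λ ()) , merged≥2))
      ... | isUnhit κ none eq e = inj₂ (subst Heavy (sym e) ((λ ()) , ≤-trans two (≤-trans (∑-mono T pointwise) (m≤m+n _ _))))
        where
        two : 2 ≤ classWeight c (suc κ)
        two with spread t (≤-trans pos (m∸n≤m (x c t) (h c t)))
        ... | inj₁ (z , _) = ⊥-elim (case trans (sym eq) z of λ ())
        ... | inj₂ (_ , q) = subst (λ κ′ → 2 ≤ classWeight c κ′) eq q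
        pointwise : ∀ s → δ (fin (suc l)) (lab c s) (suc κ) * (w s * x c s) ≤
                          δ (fin (suc (suc l))) (lab′ c (inj₁ s)) (suc (suc κ)) * (w s * x′ c (inj₁ s))
        pointwise s with compareE (fin (suc l)) (lab c s) (suc κ)
        ... | diff e′ _ = ≤-trans (≤-reflexive (cong (_* (w s * x c s)) e′)) z≤n
        ... | same e′ eq″ = ≤-reflexive (cong₂ (λ i j → i * (w s * j))
            (trans e′ (sym (trans (cong (λ κ′ → δ (fin (suc (suc l))) κ′ (suc (suc κ))) lab′s) (δ-refl (fin (suc (suc l))) (suc (suc κ))))))
            (sym (cong (x c s ∸_) (unhit⇒h≡0 c s unhit′))))
          where
          unhit′ : hitCount c (lab c s) ≡ 0
          unhit′ = trans (cong (hitCount c) (trans eq″ (sym eq))) none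
          lab′s : lab′ c (inj₁ s) ≡ suc (suc κ)
          lab′s = cong₂ relabel unhit′ eq″

  module Assemble (D : Detachment K (T ⊕ T) (suc l) p w′ M′ d x′ lab′) where

    module D = Detachment D

    z : Fin K → El T → Subset (suc p) → ℕ
    z c t (false ∷ Z) = D.z c (inj₁ t) Z
    z c t (true ∷ Z)  = D.z c (inj₂ t) Z

    z-tot : ∀ t Z → ∑ (fin K) (λ c → z c t Z) ≡ 𝟙 (∣ Z ∣ ≟ w t) * M t
    z-tot t (false ∷ Z) = D.z-tot (inj₁ t) Z
    z-tot t (true ∷ Z)  = trans (D.z-tot (inj₂ t) Z) sizes
      where
      sizes : 𝟙 (∣ Z ∣ ≟ pred (w t)) * M′ (inj₂ t) ≡ 𝟙 (suc ∣ Z ∣ ≟ w t) * M t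
      sizes with w t
      ... | zero  = *-zeroʳ (𝟙 (∣ Z ∣ ≟ 0))
      ... | suc v = cong (_* M t) (𝟙-cong (∣ Z ∣ ≟ v) (suc ∣ Z ∣ ≟ suc v) (cong suc) suc-injective)

    z-type : ∀ c t → ∑ (sub (suc p)) (z c t) ≡ x c t
    z-type c t = trans (cong₂ _+_ (D.z-type c (inj₁ t)) (D.z-type c (inj₂ t))) (x′+h c t)

    z-deg : ∀ c v → ∑ T (λ t → ∑ (sub (suc p)) λ Z → bit (lookup Z v) * z c t Z) ≡ d c
    z-deg c zero = trans (∑-cong T λ t → trans (cong₂ _+_ (∑-zero (sub p) λ _ → refl)
      (∑-cong (sub p) λ Z → *-identityˡ _)) (D.z-type c (inj₂ t))) (h-deg c)
    z-deg c (suc v) = trans (∑-+ T _ _) (D.z-deg c v)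

    -- All hit components share the colour `U zero` with the new vertex, so they can be handed to
    -- `D` as one group. That group contains a present edge by `someHit`, and `D` compares it with
    -- every remaining vertex.
    connected : ∀ c → Spread {T = T} w x lab c → 2 ≤ d c → (φ : El T → Bool) (U : Fin (suc p) → Bool) →
      (∀ s t → 0 < x c s → 0 < x c t → lab c s ≡ lab c t → lab c t ≢ zero → φ s ≡ φ t) →
      (∀ t Z v → lab c t ≢ zero → 0 < z c t Z → lookup Z v ≡ true → U v ≡ φ t) →
      (∀ t Z u v → lab c t ≡ zero → 0 < z c t Z → lookup Z u ≡ true → lookup Z v ≡ true → U u ≡ U v) →
      (∀ t v → lab c t ≢ zero → 0 < x c t → φ t ≡ U v) × (∀ u v → U u ≡ U v)
    connected c spread 2≤d φ U onClasses onTypes onBlank = (λ t v ≢z pos → trans (φ≡U₀ t ≢z pos) (U₀≡ v)) , λ u v → trans (sym (U₀≡ u)) (U₀≡ v)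
      where
      hit⇒φ≡U₀ : ∀ t → lab c t ≢ zero → 0 < h c t → φ t ≡ U zero
      hit⇒φ≡U₀ t ≢z pos with ∑>0⇒∃ (sub p) (subst (0 <_) (sym (D.z-type c (inj₂ t))) pos)
      ... | Z , pos′ = sym (onTypes t (true ∷ Z) zero ≢z pos′ refl)

      hitClass⇒φ≡U₀ : ∀ t → lab c t ≢ zero → 0 < x c t → 0 < hitCount c (lab c t) → φ t ≡ U zero
      hitClass⇒φ≡U₀ t ≢z present pos with ∑>0⇒∃ T pos
      ... | s , pos′ with label≡ c s (lab c t) pos′
      ... | eq , hit = trans (onClasses t s present (hit-present c spread 2≤d hit) (sym eq) s≢z) (hit⇒φ≡U₀ s s≢z hit)
        where
        s≢z : lab c s ≢ zero
        s≢z = subst (_≢ zero) (sym eq) ≢z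

      φ′ : El (T ⊕ T) → Bool
      φ′ (inj₁ t) = φ t
      φ′ (inj₂ _) = U zero

      present : ∀ t → 0 < x′ c (inj₁ t) → 0 < x c t
      present t pos = ≤-trans pos (m∸n≤m (x c t) (h c t))

      relabel≢zero : ∀ n κ → relabel n κ ≢ zero → κ ≢ zero
      relabel≢zero n zero    ≢z _ = ≢z refl
      relabel≢zero n (suc κ) _  ()

      merged⇒φ≡U₀ : ∀ t → 0 < x′ c t → lab′ c t ≡ suc zero → φ′ t ≡ U zero
      merged⇒φ≡U₀ (inj₂ t) _ _ = refl
      merged⇒φ≡U₀ (inj₁ t) pos eq with relabeled (hitCount c (lab c t)) (lab c t)
      ... | isBlank _ e     = ⊥-elim (case trans (sym e) eq of λ ())
      ... | isUnhit _ _ _ e = ⊥-elim (case trans (sym e) eq of λ ())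
      ... | isHit ≢z hit _  = hitClass⇒φ≡U₀ t ≢z (present t pos) hit

      unmerged : ∀ t κ → lab′ c (inj₁ t) ≡ suc (suc κ) → lab c t ≡ suc κ
      unmerged t κ eq with relabeled (hitCount c (lab c t)) (lab c t)
      ... | isBlank _ e      = ⊥-elim (case trans (sym e) eq of λ ())
      ... | isHit _ _ e      = ⊥-elim (case trans (sym e) eq of λ ())
      ... | isUnhit κ′ _ q e = trans q (cong suc (FP.suc-injective (FP.suc-injective (trans (sym e) eq))))

      onClasses′ : ∀ s t → 0 < x′ c s → 0 < x′ c t → lab′ c s ≡ lab′ c t → lab′ c t ≢ zero → φ′ s ≡ φ′ t
      onClasses′ s t s>0 t>0 eq ≢z = byLabel s t s>0 t>0 (lab′ c t) eq refl ≢z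
        where
        byLabel : ∀ s t → 0 < x′ c s → 0 < x′ c t → ∀ κ → lab′ c s ≡ κ → lab′ c t ≡ κ → κ ≢ zero → φ′ s ≡ φ′ t
        byLabel s t s>0 t>0 zero          e e′ ≢z = ⊥-elim (≢z refl)
        byLabel s t s>0 t>0 (suc zero)    e e′ ≢z = trans (merged⇒φ≡U₀ s s>0 e) (sym (merged⇒φ≡U₀ t t>0 e′))
        byLabel (inj₁ s) (inj₁ t) s>0 t>0 (suc (suc κ)) e e′ ≢z = onClasses s t (present s s>0) (present t t>0)
          (trans (unmerged s κ e) (sym (unmerged t κ e′))) λ q → case trans (sym (unmerged t κ e′)) q of λ ()
        byLabel (inj₂ _) _ _ _ (suc (suc _)) () _ _
        byLabel (inj₁ _) (inj₂ _) _ _ (suc (suc _)) _ () _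

      onTypes′ : ∀ t Z v → lab′ c t ≢ zero → 0 < D.z c t Z → lookup Z v ≡ true → U (suc v) ≡ φ′ t
      onTypes′ (inj₁ t) Z v ≢z pos v∈Z = onTypes t (false ∷ Z) (suc v) (relabel≢zero _ (lab c t) ≢z) pos v∈Z
      onTypes′ (inj₂ t) Z v ≢z pos v∈Z with lab c t F.≟ zero
      ... | yes z = onBlank t (true ∷ Z) (suc v) zero z pos v∈Z refl
      ... | no ≢z′ = trans (onTypes t (true ∷ Z) (suc v) ≢z′ pos v∈Z) (sym (onTypes t (true ∷ Z) zero ≢z′ pos refl))

      onBlank′ : ∀ t Z u v → lab′ c t ≡ zero → 0 < D.z c t Z → lookup Z u ≡ true → lookup Z v ≡ true → U (suc u) ≡ U (suc v)
      onBlank′ (inj₂ t) Z u v () pos u∈Z v∈Z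
      onBlank′ (inj₁ t) Z u v eq pos u∈Z v∈Z with relabeled (hitCount c (lab c t)) (lab c t)
      ... | isBlank z _     = onBlank t (false ∷ Z) (suc u) (suc v) z pos u∈Z v∈Z
      ... | isHit _ _ e     = ⊥-elim (case trans (sym e) eq of λ ())
      ... | isUnhit _ _ _ e = ⊥-elim (case trans (sym e) eq of λ ())

      later : 0 < p → (∀ t v → lab′ c t ≢ zero → 0 < x′ c t → φ′ t ≡ U (suc v)) × (∀ u v → U (suc u) ≡ U (suc v))
      later p>0 = D.connected c (spread′ c spread 2≤d p>0) 2≤d φ′ (U ∘ suc) onClasses′ onTypes′ onBlank′

      U₀≡ : ∀ v → U zero ≡ U v
      U₀≡ zero    = refl
      U₀≡ (suc v) = proj₁ (later (≤-trans z<s (FP.toℕ<n v))) (inj₂ (proj₁ (someHit c spread 2≤d))) v (λ ()) (proj₂ (someHit c spread 2≤d))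

      φ≡U₀ : ∀ t → lab c t ≢ zero → 0 < x c t → φ t ≡ U zero
      φ≡U₀ t ≢z pos with relabeled (hitCount c (lab c t)) (lab c t)
      ... | isBlank z _    = ⊥-elim (≢z z)
      ... | isHit _ hit _  = hitClass⇒φ≡U₀ t ≢z pos hit
      ... | isUnhit κ none eq e = trans (proj₁ (later p>0) (inj₁ t) (F.fromℕ< p>0) lab′≢z x′>0) (sym (U₀≡ (suc (F.fromℕ< p>0))))
        where
        h≡0 : h c t ≡ 0
        h≡0 = unhit⇒h≡0 c t none
        x′>0 : 0 < x′ c (inj₁ t)
        x′>0 = subst (λ y → 0 < x c t ∸ y) (sym h≡0) pos
        lab′≢z : lab′ c (inj₁ t) ≢ zero
        lab′≢z z = case trans (sym e) z of λ ()
        weight>0 : 0 < classWeight c (lab c t)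
        weight>0 with spread t pos
        ... | inj₁ (z , _)   = ⊥-elim (≢z z)
        ... | inj₂ (_ , two) = ≤-trans z<s two
        classRest≤ : classRest c (lab c t) ≤ p * d c
        classRest≤ = ≤-trans (∑-mono T λ s → ≤-trans (*-monoˡ-≤ (rest c s) (δ≤1 (fin (suc l)) (lab c s) (lab c t)))
          (≤-reflexive (*-identityˡ _))) (≤-reflexive (∑-rest c))
        -- An unhit group has all of its positive weight in the remaining block, so there is a
        -- remaining vertex through which it is compared with the new one.
        pd>0 : 0 < p * d c
        pd>0 = ≤-trans (subst (0 <_) (trans (sym (hits+rest c (lab c t))) (cong (_+ classRest c (lab c t)) none)) weight>0) classRest≤
        p>0 : 0 < p
        p>0 = n≢0⇒n>0 λ p≡0 → <⇒≢ pd>0 (sym (cong (_* d c) p≡0))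

    detachment : Detachment K T l (suc p) w M d x lab
    detachment = record
      { z = z ; z-tot = z-tot ; z-type = z-type ; z-deg = z-deg ; connected = connected }

-- Each step doubles the types, recording whether the split vertex is contained, and adds one label.
-- With no vertex left, `total` forces `w t` to be zero for every type that is present.
detach : ∀ K T l p (w M : El T → ℕ) (d : Fin K → ℕ) (x : Fin K → El T → ℕ) (lab : Fin K → El T → Fin (suc l)) →
  (∀ t → ∑ (fin K) (λ c → x c t) ≡ M t * (p C w t)) → (∀ c → ∑ T (λ t → w t * x c t) ≡ p * d c) →
  Detachment K T l p w M d x lab
detach K T l zero w M d x lab total weight = record
  { z      = λ c t _ → x c t
  ; z-tot  = λ { t [] → trans (total t) (trans (*-comm (M t) _) (cong (_* M t) (0C (w t)))) }
  ; z-type = λ _ _ → refl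
  ; z-deg  = λ _ ()
  ; connected = λ _ _ _ _ _ _ _ _ → (λ _ ()) , λ ()
  }
  where
  0C : ∀ v → 0 C v ≡ 𝟙 (0 ≟ v)
  0C zero    = refl
  0C (suc v) = k>n⇒nCk≡0 {0} {suc v} z<s
detach K T l (suc p) w M d x lab total weight =
  S.Assemble.detachment (detach K (T ⊕ T) (suc l) p S.w′ S.M′ d S.x′ S.lab′ S.total′ S.weight′)
  where
  module S = DetachStep K T l p w M d x lab total weight (Split.hits K T (suc l) p w M d x lab total weight)

-- Numbers of edges of each type in each class

∑-const : ∀ K a → ∑ (fin K) (λ _ → a) ≡ K * a
∑-const zero    a = refl
∑-const (suc K) a = cong (a +_) (∑-const K a)

∑-𝟙< : ∀ k K → k ≤ K → ∑ (fin K) (λ c → 𝟙 (toℕ c <? k)) ≡ k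
∑-𝟙< zero    K       _         = ∑-zero (fin K) λ c → 𝟙-no (toℕ c <? 0) λ ()
∑-𝟙< (suc k) (suc K) (s≤s k≤K) = cong₂ _+_ (𝟙-yes (0 <? suc k) z<s)
  (trans (∑-cong (fin K) λ c → 𝟙-cong (suc (toℕ c) <? suc k) (toℕ c <? k) s<s⁻¹ s<s) (∑-𝟙< k K k≤K))

-- Units of cost `t` are handed out one at a time. If none fits any more, every class has less than
-- `t` left, and the surplus `K * t` in the hypothesis rules this out.
fill : ∀ K t n (ρ : Fin K → ℕ) → 0 < t → t * n + K * t ≤ ∑ (fin K) ρ →
       Σ (Fin K → ℕ) λ y → ∑ (fin K) y ≡ n × (∀ c → t * y c ≤ ρ c)
fill K t zero    ρ _   _    = (λ _ → 0) , ∑-zero (fin K) (λ _ → refl) , λ c → ≤-trans (≤-reflexive (*-zeroʳ t)) z≤n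
fill K t (suc n) ρ t>0 room with fill K t n ρ t>0 (≤-trans (+-monoˡ-≤ (K * t) (*-monoʳ-≤ t (n≤1+n n))) room)
... | y , ∑y , y≤ with exists? (fin K) (λ c → t * y c + t ≤? ρ c)
...   | yes (c , fits) = (λ c′ → y c′ + δ (fin K) c c′)
        , trans (∑-+ (fin K) y _) (trans (cong₂ _+_ ∑y (∑-δ₁ (fin K) c)) (+-comm n 1)) , y′≤
  where
  y′≤ : ∀ c′ → t * (y c′ + δ (fin K) c c′) ≤ ρ c′
  y′≤ c′ with compareE (fin K) c c′
  ... | diff e _    rewrite e = subst (λ v → t * v ≤ ρ c′) (sym (+-identityʳ _)) (y≤ c′)
  ... | same e refl rewrite e = subst (_≤ ρ c′) (sym (trans (*-distribˡ-+ t (y c′) 1) (cong (t * y c′ +_) (*-identityʳ t)))) fits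
...   | no none = ⊥-elim (<⇒≱ more (≤-trans (∑-mono (fin K) λ c → <⇒≤ (≰⇒> λ fits → none (c , fits))) (≤-reflexive total)))
  where
  total : ∑ (fin K) (λ c → t * y c + t) ≡ t * n + K * t
  total = trans (∑-+ (fin K) _ _) (cong₂ _+_ (trans (∑-*ˡ (fin K) t y) (cong (t *_) ∑y)) (∑-const K t))
  more : t * n + K * t < ∑ (fin K) ρ
  more = ≤-trans (+-monoˡ-< (K * t) (*-monoʳ-< t {{>-nonZero t>0}} (n<1+n n))) room

vandermonde : ∀ a b k → ∑ (fin (suc k)) (λ i → (a C toℕ i) * (b C (k ∸ toℕ i))) ≡ (a + b) C k
vandermonde zero b k = trans
  (cong₂ _+_ (*-identityˡ _) (∑-zero (fin k) λ i → cong (_* (b C (k ∸ suc (toℕ i)))) (k>n⇒nCk≡0 {0} {suc (toℕ i)} z<s)))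
  (+-identityʳ _)
vandermonde (suc a) b zero = trans (+-identityʳ _) (trans (cong₂ _*_ (nC0≡1 (suc a)) (nC0≡1 b)) (sym (nC0≡1 (suc a + b))))
vandermonde (suc a) b (suc k) = begin
  (suc a C 0) * (b C suc k) + ∑ (fin (suc k)) (λ i → (suc a C suc (toℕ i)) * (b C (k ∸ toℕ i)))
    ≡⟨ cong₂ _+_ (cong (_* (b C suc k)) (trans (nC0≡1 (suc a)) (sym (nC0≡1 a)))) (∑-cong (fin (suc k)) λ i →
         trans (cong (_* (b C (k ∸ toℕ i))) (pascal a (toℕ i))) (*-distribʳ-+ (b C (k ∸ toℕ i)) (a C toℕ i) _)) ⟩
  (a C 0) * (b C suc k) + ∑ (fin (suc k)) (λ i → (a C toℕ i) * (b C (k ∸ toℕ i)) + (a C suc (toℕ i)) * (b C (k ∸ toℕ i)))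
    ≡⟨ cong ((a C 0) * (b C suc k) +_) (trans (∑-+ (fin (suc k)) f g) (+-comm (∑ (fin (suc k)) f) (∑ (fin (suc k)) g))) ⟩
  (a C 0) * (b C suc k) + (∑ (fin (suc k)) (λ i → (a C suc (toℕ i)) * (b C (k ∸ toℕ i))) + ∑ (fin (suc k)) (λ i → (a C toℕ i) * (b C (k ∸ toℕ i))))
    ≡⟨ +-assoc ((a C 0) * (b C suc k)) _ _ ⟨
  ∑ (fin (suc (suc k))) (λ i → (a C toℕ i) * (b C (suc k ∸ toℕ i))) + ∑ (fin (suc k)) (λ i → (a C toℕ i) * (b C (k ∸ toℕ i)))
    ≡⟨ cong₂ _+_ (vandermonde a b (suc k)) (vandermonde a b k) ⟩
  ((a + b) C suc k) + ((a + b) C k)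
    ≡⟨ +-comm ((a + b) C suc k) _ ⟩
  ((a + b) C k) + ((a + b) C suc k)
    ≡⟨ pascal (a + b) k ⟨
  (suc a + b) C suc k ∎
  where
  open ≡-Reasoning
  f g : Fin (suc k) → ℕ
  f i = (a C toℕ i) * (b C (k ∸ toℕ i))
  g i = (a C suc (toℕ i)) * (b C (k ∸ toℕ i))

-- C(a,k) / C(b,k) is the product of the factors (a-i) / (b-i) for i < k. The hypothesis says 4
-- (a-k+1) ≤ 5 (b-k+1), that is, the last factor is at most 5/4, and this implies the same for the
-- earlier ones.
choose-ratio : ∀ k a b → 4 * a + k ≤ 5 * b + 1 → 4 ^ k * (a C k) ≤ 5 ^ k * (b C k)
choose-ratio zero    a       b       _ = ≤-reflexive (cong (1 *_) (trans (nC0≡1 a) (sym (nC0≡1 b))))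
choose-ratio (suc k) zero    b       _ = ≤-trans (≤-reflexive (trans (cong (4 ^ suc k *_) (k>n⇒nCk≡0 {0} {suc k} z<s)) (*-zeroʳ (4 ^ suc k)))) z≤n
choose-ratio (suc k) (suc a) zero    le = ⊥-elim (<⇒≱ (+-mono-≤ {1} {4 * suc a} {1} (s≤s z≤n) (s≤s z≤n)) le)
choose-ratio (suc k) (suc a) (suc b) le = *-cancelˡ-≤ (suc k) (begin
  suc k * (4 * 4 ^ k * (suc a C suc k))    ≡⟨ regroup (suc k) 4 (4 ^ k) _ ⟩
  4 * 4 ^ k * (suc k * (suc a C suc k))    ≡⟨ cong (4 * 4 ^ k *_) (absorption a k) ⟩
  4 * 4 ^ k * (suc a * (a C k))            ≡⟨ pair 4 (4 ^ k) (suc a) (a C k) ⟩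
  4 * suc a * (4 ^ k * (a C k))            ≤⟨ *-mono-≤ 4a≤5b (choose-ratio k a b le′) ⟩
  5 * suc b * (5 ^ k * (b C k))            ≡⟨ pair 5 (5 ^ k) (suc b) (b C k) ⟨
  5 * 5 ^ k * (suc b * (b C k))            ≡⟨ cong (5 * 5 ^ k *_) (absorption b k) ⟨
  5 * 5 ^ k * (suc k * (suc b C suc k))    ≡⟨ regroup (suc k) 5 (5 ^ k) _ ⟨
  suc k * (5 * 5 ^ k * (suc b C suc k))    ∎)
  where
  open ≤-Reasoning
  regroup : ∀ k x y z → k * (x * y * z) ≡ x * y * (k * z)
  regroup = solve-∀
  pair : ∀ x y a z → x * y * (a * z) ≡ x * a * (y * z)
  pair = solve-∀
  4a≤5b : 4 * suc a ≤ 5 * suc b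
  4a≤5b = +-cancelʳ-≤ 1 _ _ (≤-trans (+-monoʳ-≤ (4 * suc a) (s≤s z≤n)) le)
  le′ : 4 * a + k ≤ 5 * b + 1
  le′ = +-cancelʳ-≤ 5 _ _ (subst₂ _≤_ (lhs a k) (rhs b) le)
    where
    lhs : ∀ a k → 4 * suc a + suc k ≡ 4 * a + k + 5
    lhs = solve-∀
    rhs : ∀ b → 5 * suc b + 1 ≡ 5 * b + 1 + 5
    rhs = solve-∀

-- Class c still needs degree D c in total on the old vertices and A c in total
-- on the new ones.  Numbers of edges with 4, 3, 2 old vertices are chosen
-- greedily; the numbers for 1 and 0 old vertices are then forced, and they are
-- nonnegative because 4 D c ≤ A c.
balance : ∀ K (D A u : Fin K → ℕ) (N : Fin 5 → ℕ) → (∀ c → A c ≡ 4 * D c + 5 * u c) →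
  ∑ (fin K) D ≡ ∑ (fin 5) (λ i → toℕ i * N i) → ∑ (fin K) A ≡ ∑ (fin 5) (λ i → (5 ∸ toℕ i) * N i) →
  K * 4 ≤ N (suc zero) → Σ (Fin K → Fin 5 → ℕ) λ y → (∀ i → ∑ (fin K) (λ c → y c i) ≡ N i) ×
    (∀ c → ∑ (fin 5) (λ i → toℕ i * y c i) ≡ D c) × (∀ c → ∑ (fin 5) (λ i → (5 ∸ toℕ i) * y c i) ≡ A c)
balance K D A u N A≡ ∑D ∑A room = y , ∑y , ydeg , yrest
  where
  i0 i1 i2 i3 i4 : Fin 5
  i0 = zero
  i1 = suc zero
  i2 = suc (suc zero)
  i3 = suc (suc (suc zero))
  i4 = suc (suc (suc (suc zero)))

  residual : ∀ t n (ρ y : Fin K → ℕ) → ∑ (fin K) y ≡ n → (∀ c → t * y c ≤ ρ c) →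
             ∑ (fin K) (λ c → ρ c ∸ t * y c) + t * n ≡ ∑ (fin K) ρ
  residual t n ρ y ∑y y≤ = trans (cong (∑ (fin K) (λ c → ρ c ∸ t * y c) +_) (trans (cong (t *_) (sym ∑y)) (sym (∑-*ˡ (fin K) t y))))
    (trans (sym (∑-+ (fin K) _ _)) (∑-cong (fin K) λ c → m∸n+n≡m (y≤ c)))

  -- Edges with a single old vertex cost 1 and are assigned last, so their number `N i1` can serve
  -- as the surplus in each of the three greedy fillings.
  room₄ : 4 * N i4 + K * 4 ≤ ∑ (fin K) D
  room₄ = subst (4 * N i4 + K * 4 ≤_) (sym ∑D) (≤-trans (+-monoʳ-≤ (4 * N i4) room)
    (subst (4 * N i4 + N i1 ≤_) (shape (N i0) (N i1) (N i2) (N i3) (N i4)) (m≤m+n _ _)))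
    where
    shape : ∀ a b c d e → (4 * e + b) + (2 * c + 3 * d) ≡ 0 * a + (1 * b + (2 * c + (3 * d + (4 * e + 0))))
    shape = solve-∀
  f₄ = fill K 4 (N i4) D z<s room₄
  y₄ = proj₁ f₄
  D₃ : Fin K → ℕ
  D₃ c = D c ∸ 4 * y₄ c
  res₄ : ∑ (fin K) D₃ + 4 * N i4 ≡ ∑ (fin K) D
  res₄ = residual 4 (N i4) D y₄ (proj₁ (proj₂ f₄)) (proj₂ (proj₂ f₄))
  ∑D₃ : ∑ (fin K) D₃ ≡ N i1 + 2 * N i2 + 3 * N i3
  ∑D₃ = +-cancelʳ-≡ (4 * N i4) _ _ (trans res₄ (trans ∑D (shape (N i0) (N i1) (N i2) (N i3) (N i4))))
    where
    shape : ∀ a b c d e → 0 * a + (1 * b + (2 * c + (3 * d + (4 * e + 0)))) ≡ b + 2 * c + 3 * d + 4 * e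
    shape = solve-∀
  K*≤ : ∀ t → t ≤ 4 → K * t ≤ N i1
  K*≤ t t≤4 = ≤-trans (*-monoʳ-≤ K t≤4) room
  f₃ = fill K 3 (N i3) D₃ z<s (≤-trans (+-monoʳ-≤ (3 * N i3) (K*≤ 3 (n≤1+n 3)))
    (≤-trans (subst (3 * N i3 + N i1 ≤_) (shape (N i1) (N i2) (N i3)) (m≤m+n _ _)) (≤-reflexive (sym ∑D₃))))
    where
    shape : ∀ b c d → (3 * d + b) + 2 * c ≡ b + 2 * c + 3 * d
    shape = solve-∀
  y₃ = proj₁ f₃
  D₂ : Fin K → ℕ
  D₂ c = D₃ c ∸ 3 * y₃ c
  ∑D₂ : ∑ (fin K) D₂ ≡ N i1 + 2 * N i2
  ∑D₂ = +-cancelʳ-≡ (3 * N i3) _ _ (trans (residual 3 (N i3) D₃ y₃ (proj₁ (proj₂ f₃)) (proj₂ (proj₂ f₃))) ∑D₃)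
  f₂ = fill K 2 (N i2) D₂ z<s (≤-trans (+-monoʳ-≤ (2 * N i2) (K*≤ 2 (≤-trans (n≤1+n 2) (n≤1+n 3))))
    (≤-reflexive (trans (+-comm (2 * N i2) _) (sym ∑D₂))))
  y₂ = proj₁ f₂
  y₁ y₀ : Fin K → ℕ
  y₁ c = D₂ c ∸ 2 * y₂ c
  ∑y₁ : ∑ (fin K) y₁ ≡ N i1
  ∑y₁ = +-cancelʳ-≡ (2 * N i2) _ _ (trans (residual 2 (N i2) D₂ y₂ (proj₁ (proj₂ f₂)) (proj₂ (proj₂ f₂))) ∑D₂)
  -- The solution of `5 * y₀ + 4 * y₁ + 3 * y₂ + 2 * y₃ + y₄ = 4 * D + 5 *
  -- u` once `D` is written as `y₁ + 2 * y₂ + 3 * y₃ + 4 * y₄`; no negative term survives.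
  y₀ c = u c + y₂ c + 2 * y₃ c + 3 * y₄ c

  y : Fin K → Fin 5 → ℕ
  y c zero                         = y₀ c
  y c (suc zero)                   = y₁ c
  y c (suc (suc zero))             = y₂ c
  y c (suc (suc (suc zero)))       = y₃ c
  y c (suc (suc (suc (suc zero)))) = y₄ c

  D≡ : ∀ c → D c ≡ y₁ c + 2 * y₂ c + 3 * y₃ c + 4 * y₄ c
  D≡ c = sym (trans (cong (λ v → v + 3 * y₃ c + 4 * y₄ c) (m∸n+n≡m (proj₂ (proj₂ f₂) c)))
    (trans (cong (_+ 4 * y₄ c) (m∸n+n≡m (proj₂ (proj₂ f₃) c))) (m∸n+n≡m (proj₂ (proj₂ f₄) c))))

  ydeg : ∀ c → ∑ (fin 5) (λ i → toℕ i * y c i) ≡ D c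
  ydeg c = trans (shape (y₀ c) (y₁ c) (y₂ c) (y₃ c) (y₄ c)) (sym (D≡ c))
    where
    shape : ∀ a b c d e → 0 * a + (1 * b + (2 * c + (3 * d + (4 * e + 0)))) ≡ b + 2 * c + 3 * d + 4 * e
    shape = solve-∀

  yrest : ∀ c → ∑ (fin 5) (λ i → (5 ∸ toℕ i) * y c i) ≡ A c
  yrest c = trans (shape (u c) (y₁ c) (y₂ c) (y₃ c) (y₄ c)) (sym (trans (A≡ c) (cong (λ v → 4 * v + 5 * u c) (D≡ c))))
    where
    shape : ∀ u b c d e → 5 * (u + c + 2 * d + 3 * e) + (4 * b + (3 * c + (2 * d + (1 * e + 0))))
            ≡ 4 * (b + 2 * c + 3 * d + 4 * e) + 5 * u
    shape = solve-∀

  ∑y₀ : ∑ (fin K) y₀ ≡ N i0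
  ∑y₀ = *-cancelˡ-≡ _ _ 5 (+-cancelʳ-≡ R _ _ (trans (sym expand) (trans (∑-cong (fin K) yrest) ∑A)))
    where
    R = 4 * N i1 + (3 * N i2 + (2 * N i3 + (1 * N i4 + 0)))
    expand : ∑ (fin K) (λ c → ∑ (fin 5) λ i → (5 ∸ toℕ i) * y c i) ≡ 5 * ∑ (fin K) y₀ + R
    expand = trans (∑-swap (fin K) (fin 5) λ c i → (5 ∸ toℕ i) * y c i)
      (cong₂ _+_ (∑-*ˡ (fin K) 5 y₀) (cong₂ _+_ (scaled 4 y₁ ∑y₁) (cong₂ _+_ (scaled 3 y₂ (proj₁ (proj₂ f₂)))
        (cong₂ _+_ (scaled 2 y₃ (proj₁ (proj₂ f₃))) (cong (_+ 0) (scaled 1 y₄ (proj₁ (proj₂ f₄))))))))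
      where
      scaled : ∀ t (f : Fin K → ℕ) {n} → ∑ (fin K) f ≡ n → ∑ (fin K) (λ c → t * f c) ≡ t * n
      scaled t f e = trans (∑-*ˡ (fin K) t f) (cong (t *_) e)

  ∑y : ∀ i → ∑ (fin K) (λ c → y c i) ≡ N i
  ∑y zero                         = ∑y₀
  ∑y (suc zero)                   = ∑y₁
  ∑y (suc (suc zero))             = proj₁ (proj₂ f₂)
  ∑y (suc (suc (suc zero)))       = proj₁ (proj₂ f₃)
  ∑y (suc (suc (suc (suc zero)))) = proj₁ (proj₂ f₄)

-- The classes c < k are the ones that extend the k given r-factors.
oldDeg : ∀ {K} → ℕ → ℕ → Fin K → ℕ
oldDeg k r c = 𝟙 (toℕ c <? k) * r

∑-oldDeg : ∀ k K r → k ≤ K → ∑ (fin K) (oldDeg k r) ≡ k * r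
∑-oldDeg k K r k≤K = trans (∑-*ʳ (fin K) r _) (cong (_* r) (∑-𝟙< k K k≤K))

oldDeg≤ : ∀ {K} k {r s} (c : Fin K) → r ≤ s → oldDeg k r c ≤ s
oldDeg≤ k {r} c r≤s with toℕ c <? k
... | yes _ = ≤-trans (≤-reflexive (*-identityˡ r)) r≤s
... | no _  = z≤n

-- With `4m ≤ N` each of the four factors of the quotient is at most 5/4, and (5/4)^4 = 625/256 is
-- below 3 = 768/256.
4C≤3C : ∀ m′ N′ → 4 * suc m′ ≤ suc N′ → (m′ + suc N′) C 4 ≤ 3 * (suc N′ C 4)
4C≤3C m′ N′ le = *-cancelˡ-≤ 256 (≤-trans (choose-ratio 4 (m′ + suc N′) (suc N′) cond)
  (≤-trans (*-monoˡ-≤ (suc N′ C 4) (≤ᵇ⇒≤ 625 768 _)) (≤-reflexive (*-assoc 256 3 (suc N′ C 4)))))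
  where
  cond : 4 * (m′ + suc N′) + 4 ≤ 5 * suc N′ + 1
  cond = ≤-trans (subst₂ _≤_ (lhs m′ N′) (rhs N′) (+-monoˡ-≤ (4 * suc N′) le)) (m≤m+n _ 1)
    where
    lhs : ∀ m n → 4 * suc m + 4 * suc n ≡ 4 * (m + suc n) + 4
    lhs = solve-∀
    rhs : ∀ n → suc n + 4 * suc n ≡ 5 * suc n
    rhs = solve-∀

module TypeCounts (m′ N′ s r lam K k : ℕ)
  (Ks : K * s ≡ lam * ((m′ + suc N′) C 4)) (kr : k * r ≡ lam * (m′ C 4)) (k≤K : k ≤ K)
  (r<s : r < s) (0<r : 0 < r) (6≤m : 6 ≤ suc m′) (4m≤N : 4 * suc m′ ≤ suc N′)
  (5∣rm : 5 ∣ r * suc m′) (5∣sn : 5 ∣ s * (suc m′ + suc N′)) where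

  m N : ℕ
  m = suc m′
  N = suc N′

  -- Edges with `i` old vertices; those with five are coloured already.
  count : Fin 5 → ℕ
  count i = lam * (N C (5 ∸ toℕ i)) * (m C toℕ i)

  private
    D A : Fin K → ℕ
    D c = m * (s ∸ oldDeg k r c)
    A c = N * s

    D+old : ∀ c → D c + m * oldDeg k r c ≡ m * s
    D+old c = trans (sym (*-distribˡ-+ m (s ∸ oldDeg k r c) _)) (cong (m *_) (m∸n+n≡m (oldDeg≤ k c (<⇒≤ r<s))))

    excess : ℕ
    excess = N ∸ 4 * m

    N≡ : N ≡ 4 * m + excess
    N≡ = sym (m+[n∸m]≡n 4m≤N)

    5∣s*excess : 5 ∣ s * excess
    5∣s*excess = ∣m+n∣m⇒∣n (subst (5 ∣_) (trans (cong (λ v → s * (m + v)) N≡) (split s m excess)) 5∣sn) (m∣m*n (s * m))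
      where
      split : ∀ s m e → s * (m + (4 * m + e)) ≡ 5 * (s * m) + s * e
      split = solve-∀

    5∣m*old : ∀ (c : Fin K) → 5 ∣ m * oldDeg k r c
    5∣m*old c with toℕ c <? k
    ... | yes _ = subst (5 ∣_) (trans (*-comm r m) (cong (m *_) (sym (*-identityˡ r)))) 5∣rm
    ... | no _  = subst (5 ∣_) (sym (*-zeroʳ m)) (5 ∣0)

    -- This number is `A c` minus four times `D c`. Modulo 5, `s * excess` agrees with
    -- `s * (m + N)`, so the divisibility conditions of both admissibilities make it a multiple of
    -- 5.
    5∣u : ∀ (c : Fin K) → 5 ∣ 4 * (m * oldDeg k r c) + s * excess
    5∣u c = ∣m∣n⇒∣m+n (∣n⇒∣m*n 4 (5∣m*old c)) 5∣s*excess

    u : Fin K → ℕ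
    u c = quotient (5∣u c)

    A≡ : ∀ c → A c ≡ 4 * D c + 5 * u c
    A≡ c = begin
      N * s                                                 ≡⟨ cong (_* s) N≡ ⟩
      (4 * m + excess) * s                                  ≡⟨ spread-s m excess s ⟩
      4 * (m * s) + s * excess                              ≡⟨ cong (λ v → 4 * v + s * excess) (D+old c) ⟨
      4 * (D c + m * oldDeg k r c) + s * excess             ≡⟨ assoc (D c) (m * oldDeg k r c) (s * excess) ⟩
      4 * D c + (4 * (m * oldDeg k r c) + s * excess)       ≡⟨ cong (4 * D c +_) (m∣n⇒n≡m*quotient (5∣u c)) ⟩
      4 * D c + 5 * u c                                     ∎
      where
      open ≡-Reasoning
      spread-s : ∀ m e s → (4 * m + e) * s ≡ 4 * (m * s) + s * e
      spread-s = solve-∀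
      assoc : ∀ d o e → 4 * (d + o) + e ≡ 4 * d + (4 * o + e)
      assoc = solve-∀

    -- Both sides count incidences of edges with old vertices; the second summand on the left is the
    -- part of the edges inside Y. Absorption turns the sum into a Vandermonde convolution.
    count-deg : ∑ (fin 5) (λ i → toℕ i * count i) + m * (lam * (m′ C 4)) ≡ m * (lam * ((m′ + N) C 4))
    count-deg = begin
      ∑ (fin 5) (λ i → toℕ i * count i) + m * (lam * (m′ C 4))
        ≡⟨ cong₂ _+_ (∑-cong (fin 4) term) (last (m′ C 4)) ⟩
      ∑ (fin 4) (λ i → lam * m * ((m′ C toℕ i) * (N C (4 ∸ toℕ i)))) + lam * m * ((m′ C 4) * 1)
        ≡⟨ collect (lam * m) (V zero) (V (suc zero)) (V (suc (suc zero))) (V (suc (suc (suc zero)))) _ ⟩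
      lam * m * (V zero + (V (suc zero) + (V (suc (suc zero)) + (V (suc (suc (suc zero))) + ((m′ C 4) * 1 + 0)))))
        ≡⟨ cong (λ v → lam * m * (V zero + (V (suc zero) + (V (suc (suc zero)) + (V (suc (suc (suc zero))) + ((m′ C 4) * v + 0)))))) (nC0≡1 N) ⟨
      lam * m * ∑ (fin 5) (λ i → (m′ C toℕ i) * (N C (4 ∸ toℕ i)))
        ≡⟨ cong (lam * m *_) (vandermonde m′ N 4) ⟩
      lam * m * ((m′ + N) C 4)
        ≡⟨ trans (cong (_* ((m′ + N) C 4)) (*-comm lam m)) (*-assoc m lam _) ⟩
      m * (lam * ((m′ + N) C 4)) ∎
      where
      open ≡-Reasoning
      V : Fin 4 → ℕ
      V i = (m′ C toℕ i) * (N C (4 ∸ toℕ i))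
      last : ∀ b → m * (lam * b) ≡ lam * m * (b * 1)
      last b = shape m lam b
        where
        shape : ∀ m lam b → m * (lam * b) ≡ lam * m * (b * 1)
        shape = solve-∀
      term : ∀ (i : Fin 4) → suc (toℕ i) * count (suc i) ≡ lam * m * V i
      term i = begin
        suc (toℕ i) * (lam * (N C (4 ∸ toℕ i)) * (m C suc (toℕ i)))  ≡⟨ shape (suc (toℕ i)) lam _ (m C suc (toℕ i)) ⟩
        lam * (N C (4 ∸ toℕ i)) * (suc (toℕ i) * (m C suc (toℕ i)))  ≡⟨ cong (lam * (N C (4 ∸ toℕ i)) *_) (absorption m′ (toℕ i)) ⟩
        lam * (N C (4 ∸ toℕ i)) * (m * (m′ C toℕ i))                  ≡⟨ shape′ lam (N C (4 ∸ toℕ i)) m (m′ C toℕ i) ⟩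
        lam * m * V i                                                 ∎
        where
        shape : ∀ i l a b → i * (l * a * b) ≡ l * a * (i * b)
        shape = solve-∀
        shape′ : ∀ l a m b → l * a * (m * b) ≡ l * m * (b * a)
        shape′ = solve-∀
      collect : ∀ x a b c d e → (x * a + (x * b + (x * c + (x * d + 0)))) + x * e ≡ x * (a + (b + (c + (d + (e + 0)))))
      collect = solve-∀

    count-rest : ∑ (fin 5) (λ i → (5 ∸ toℕ i) * count i) ≡ N * (lam * ((m′ + N) C 4))
    count-rest = begin
      ∑ (fin 5) (λ i → (5 ∸ toℕ i) * count i)
        ≡⟨ ∑-cong (fin 5) (λ i → term (4 ∸ toℕ i) (toℕ i) (5 ∸ toℕ i) (≤4 i)) ⟩
      ∑ (fin 5) (λ i → lam * N * ((m C toℕ i) * (N′ C (4 ∸ toℕ i))))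
        ≡⟨ ∑-*ˡ (fin 5) (lam * N) (λ i → (m C toℕ i) * (N′ C (4 ∸ toℕ i))) ⟩
      lam * N * ∑ (fin 5) (λ i → (m C toℕ i) * (N′ C (4 ∸ toℕ i)))
        ≡⟨ cong (lam * N *_) (trans (vandermonde m N′ 4) (cong (_C 4) (sym (+-suc m′ N′)))) ⟩
      lam * N * ((m′ + N) C 4)
        ≡⟨ trans (cong (_* ((m′ + N) C 4)) (*-comm lam N)) (*-assoc N lam _) ⟩
      N * (lam * ((m′ + N) C 4)) ∎
      where
      open ≡-Reasoning
      ≤4 : ∀ (i : Fin 5) → 5 ∸ toℕ i ≡ suc (4 ∸ toℕ i)
      ≤4 i = +-∸-assoc 1 (s≤s⁻¹ (FP.toℕ<n i))
      term : ∀ j i j′ → j′ ≡ suc j → j′ * (lam * (N C j′) * (m C i)) ≡ lam * N * ((m C i) * (N′ C j))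
      term j i _ refl = begin
        suc j * (lam * (N C suc j) * (m C i))  ≡⟨ shape (suc j) lam (N C suc j) (m C i) ⟩
        lam * (m C i) * (suc j * (N C suc j))  ≡⟨ cong (lam * (m C i) *_) (absorption N′ j) ⟩
        lam * (m C i) * (N * (N′ C j))         ≡⟨ shape′ lam (m C i) N (N′ C j) ⟩
        lam * N * ((m C i) * (N′ C j))         ∎
        where
        shape : ∀ i l a b → i * (l * a * b) ≡ l * b * (i * a)
        shape = solve-∀
        shape′ : ∀ l a m b → l * a * (m * b) ≡ l * m * (a * b)
        shape′ = solve-∀

    ∑D : ∑ (fin K) D ≡ ∑ (fin 5) (λ i → toℕ i * count i)
    ∑D = +-cancelʳ-≡ (m * (lam * (m′ C 4))) _ _ (begin
      ∑ (fin K) D + m * (lam * (m′ C 4))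
        ≡⟨ cong (∑ (fin K) D +_) (trans (∑-*ˡ (fin K) m (oldDeg k r)) (cong (m *_) (trans (∑-oldDeg k K r k≤K) kr))) ⟨
      ∑ (fin K) D + ∑ (fin K) (λ c → m * oldDeg k r c)  ≡⟨ ∑-+ (fin K) _ _ ⟨
      ∑ (fin K) (λ c → D c + m * oldDeg k r c)          ≡⟨ ∑-cong (fin K) D+old ⟩
      ∑ (fin K) (λ _ → m * s)                           ≡⟨ ∑-const K (m * s) ⟩
      K * (m * s)                                       ≡⟨ m*[n*o]≡n*[m*o] K m s ⟩
      m * (K * s)                                       ≡⟨ cong (m *_) Ks ⟩
      m * (lam * ((m′ + N) C 4))                        ≡⟨ count-deg ⟨
      ∑ (fin 5) (λ i → toℕ i * count i) + m * (lam * (m′ C 4)) ∎)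
      where open ≡-Reasoning

    ∑A : ∑ (fin K) A ≡ ∑ (fin 5) (λ i → (5 ∸ toℕ i) * count i)
    ∑A = begin
      ∑ (fin K) A                   ≡⟨ ∑-const K (N * s) ⟩
      K * (N * s)                   ≡⟨ m*[n*o]≡n*[m*o] K N s ⟩
      N * (K * s)                   ≡⟨ cong (N *_) Ks ⟩
      N * (lam * ((m′ + N) C 4))    ≡⟨ count-rest ⟨
      ∑ (fin 5) (λ i → (5 ∸ toℕ i) * count i) ∎
      where open ≡-Reasoning

    -- The constants meet here: `s ≥ 2` gives `4 * K ≤ 2 * (K * s)`, `n ≥ 5m` costs a factor 3 in
    -- passing from C(n-1,4) to C(N,4), and 2 * 3 = 6 is at most `m`.
    room : K * 4 ≤ count (suc zero)
    room = begin
      K * 4                              ≡⟨ shape K ⟩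
      2 * (K * 2)                        ≤⟨ *-monoʳ-≤ 2 (*-monoʳ-≤ K (≤-trans (s≤s 0<r) r<s)) ⟩
      2 * (K * s)                        ≡⟨ cong (2 *_) Ks ⟩
      2 * (lam * ((m′ + N) C 4))         ≤⟨ *-monoʳ-≤ 2 (*-monoʳ-≤ lam (4C≤3C m′ N′ 4m≤N)) ⟩
      2 * (lam * (3 * (N C 4)))          ≡⟨ shape′ lam (N C 4) ⟩
      lam * (N C 4) * 6                  ≤⟨ *-monoʳ-≤ (lam * (N C 4)) 6≤m ⟩
      lam * (N C 4) * m                  ≡⟨ cong (lam * (N C 4) *_) (nC1≡n m) ⟨
      lam * (N C 4) * (m C 1)            ∎
      where
      open ≤-Reasoning
      shape : ∀ K → K * 4 ≡ 2 * (K * 2)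
      shape = solve-∀
      shape′ : ∀ l c → 2 * (l * (3 * c)) ≡ l * c * 6
      shape′ = solve-∀

  typeCounts : Σ (Fin K → Fin 5 → ℕ) λ y → (∀ i → ∑ (fin K) (λ c → y c i) ≡ count i) ×
    (∀ c → ∑ (fin 5) (λ i → toℕ i * y c i) ≡ m * (s ∸ oldDeg k r c)) ×
    (∀ c → ∑ (fin 5) (λ i → (5 ∸ toℕ i) * y c i) ≡ N * s)
  typeCounts = balance K D A u count A≡ ∑D ∑A room

-- Components, degrees and double counting

-- Adjacent pairs are processed one by one, each redirecting one label to another. Only `Adj` has to
-- be decidable; equal labels are then a decidable relation between `Adj` and `R`.
components : ∀ {n} {Adj R : Fin n → Fin n → Set} → (∀ u v → Dec (Adj u v)) → IsEquivalence R →
  (∀ {u v} → Adj u v → R u v) →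
  Σ (Fin n → Fin n) λ lab → (∀ u v → lab u ≡ lab v → R u v) × (∀ u v → Adj u v → lab u ≡ lab v)
components {n} {Adj} {R} adj? R-equiv Adj⇒R =
  lab , sound , λ u v a → merged (∈-filter⁺ adj²? (∈-cartesianProduct⁺ (∈-allFin u) (∈-allFin v)) a)
  where
  module R = IsEquivalence R-equiv
  adj²? : (e : Fin n × Fin n) → Dec (Adj (proj₁ e) (proj₂ e))
  adj²? (u , v) = adj? u v

  redirect : Fin n → Fin n → Fin n → Fin n
  redirect a b w with w F.≟ a
  ... | yes _ = b
  ... | no _  = w

  redirect-≡ : ∀ a b → redirect a b a ≡ redirect a b b
  redirect-≡ a b with a F.≟ a | b F.≟ a
  ... | yes _  | yes _ = refl
  ... | yes _  | no _  = refl
  ... | no a≢a | _     = ⊥-elim (a≢a refl)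

  merge : (es : List (Fin n × Fin n)) → All (λ e → Adj (proj₁ e) (proj₂ e)) es →
    Σ (Fin n → Fin n) λ lab → (∀ u v → lab u ≡ lab v → R u v) × (∀ {u v} → (u , v) ∈ₗ es → lab u ≡ lab v)
  merge [] [] = id , (λ { u .u refl → R.refl }) , λ ()
  merge ((a , b) ∷ es) (ab ∷ adj) with merge es adj
  ... | lab , sound , merged = redirect (lab a) (lab b) ∘ lab , sound′ , merged′
    where
    sound′ : ∀ u v → redirect (lab a) (lab b) (lab u) ≡ redirect (lab a) (lab b) (lab v) → R u v
    sound′ u v eq with lab u F.≟ lab a | lab v F.≟ lab a
    ... | yes p | yes q = sound u v (trans p (sym q))
    ... | yes p | no _  = R.trans (sound u a p) (R.trans (Adj⇒R ab) (sound b v eq))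
    ... | no _  | yes q = R.trans (sound u b eq) (R.trans (R.sym (Adj⇒R ab)) (sound a v (sym q)))
    ... | no _  | no _  = sound u v eq
    merged′ : ∀ {u v} → (u , v) ∈ₗ ((a , b) ∷ es) → redirect (lab a) (lab b) (lab u) ≡ redirect (lab a) (lab b) (lab v)
    merged′ (here refl) = redirect-≡ (lab a) (lab b)
    merged′ (there e)   = cong (redirect (lab a) (lab b)) (merged e)

  pairs es : List (Fin n × Fin n)
  pairs = L.cartesianProduct (L.allFin n) (L.allFin n)
  es = L.filter adj²? pairs
  result = merge es (all-filter adj²? pairs)
  lab = proj₁ result
  sound = proj₁ (proj₂ result)
  merged : ∀ {u v} → (u , v) ∈ₗ es → lab u ≡ lab v
  merged = proj₂ (proj₂ result)

-- Degrees as sums over subsets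

sumOver : ∀ {A : Set} → (A → ℕ) → List A → ℕ
sumOver f []       = 0
sumOver f (x ∷ xs) = f x + sumOver f xs

sumOver-cong : ∀ {A : Set} {f g : A → ℕ} → (∀ x → f x ≡ g x) → ∀ xs → sumOver f xs ≡ sumOver g xs
sumOver-cong e []       = refl
sumOver-cong e (x ∷ xs) = cong₂ _+_ (e x) (sumOver-cong e xs)

sumOver-++ : ∀ {A : Set} (f : A → ℕ) xs ys → sumOver f (xs L.++ ys) ≡ sumOver f xs + sumOver f ys
sumOver-++ f []       ys = refl
sumOver-++ f (x ∷ xs) ys = trans (cong (f x +_) (sumOver-++ f xs ys)) (sym (+-assoc (f x) _ _))

sumOver-map : ∀ {A B : Set} (f : B → ℕ) (g : A → B) xs → sumOver f (L.map g xs) ≡ sumOver (f ∘ g) xs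
sumOver-map f g []       = refl
sumOver-map f g (x ∷ xs) = cong (f (g x) +_) (sumOver-map f g xs)

sumOver-cartesianProduct : ∀ {A B : Set} (f : A × B → ℕ) xs ys →
  sumOver f (L.cartesianProduct xs ys) ≡ sumOver (λ x → sumOver (λ y → f (x , y)) ys) xs
sumOver-cartesianProduct f []       ys = refl
sumOver-cartesianProduct f (x ∷ xs) ys = trans (sumOver-++ f (L.map (x ,_) ys) _)
  (cong₂ _+_ (sumOver-map f (x ,_) ys) (sumOver-cartesianProduct f xs ys))

length-filter : ∀ {A : Set} {P : A → Set} (P? : ∀ x → Dec (P x)) xs → L.length (L.filter P? xs) ≡ sumOver (λ x → 𝟙 (P? x)) xs
length-filter P? [] = refl
length-filter P? (x ∷ xs) with P? x
... | yes _ = cong suc (length-filter P? xs)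
... | no _  = length-filter P? xs

sumOver-filter : ∀ {A : Set} {P : A → Set} (P? : ∀ x → Dec (P x)) (f : A → ℕ) xs →
  sumOver f (L.filter P? xs) ≡ sumOver (λ x → 𝟙 (P? x) * f x) xs
sumOver-filter P? f [] = refl
sumOver-filter P? f (x ∷ xs) with P? x
... | yes _ = cong₂ _+_ (sym (*-identityˡ _)) (sumOver-filter P? f xs)
... | no _  = sumOver-filter P? f xs

sumOver-tabulate : ∀ {A : Set} n (f : A → ℕ) (g : Fin n → A) → sumOver f (L.tabulate g) ≡ ∑ (fin n) (f ∘ g)
sumOver-tabulate zero    f g = refl
sumOver-tabulate (suc n) f g = cong (f (g zero) +_) (sumOver-tabulate n f (g ∘ suc))

sumOver-subsets : ∀ n (f : Subset n → ℕ) → sumOver f (subsets n) ≡ ∑ (sub n) f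
sumOver-subsets zero    f = +-identityʳ _
sumOver-subsets (suc n) f = trans (sumOver-++ f (L.map (outside ∷_) (subsets n)) _) (cong₂ _+_
  (trans (sumOver-map f _ (subsets n)) (sumOver-subsets n _)) (trans (sumOver-map f _ (subsets n)) (sumOver-subsets n _)))

copies : ∀ {n lam k} → Colouring n lam k → Subset n → Fin k → ℕ
copies {k = k} χ S c = ∑ (fin _) λ i → δ (fin k) (χ S i) c

𝟙-× : ∀ {P Q : Set} (P? : Dec P) (Q? : Dec Q) → 𝟙 (P? ×-dec Q?) ≡ 𝟙 P? * 𝟙 Q?
𝟙-× (yes _) (yes _) = refl
𝟙-× (yes _) (no _)  = refl
𝟙-× (no _)  _       = refl

𝟙-∈ : ∀ {n} (v : Fin n) S → 𝟙 (v ∈? S) ≡ bit (lookup S v)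
𝟙-∈ v S with lookup S v in eq
... | true  = 𝟙-yes (v ∈? S) (VP.lookup⇒[]= v S eq)
... | false = 𝟙-no (v ∈? S) λ v∈S → case trans (sym (VP.[]=⇒lookup v∈S)) eq of λ ()

𝟙-≟ : ∀ {k} (c d : Fin k) → 𝟙 (c F.≟ d) ≡ δ (fin k) c d
𝟙-≟ {k} c d with compareE (fin k) c d
... | same e p = trans (𝟙-yes (c F.≟ d) p) (sym e)
... | diff e p = trans (𝟙-no (c F.≟ d) p) (sym e)

deg≡∑ : ∀ {n lam k} h (χ : Colouring n lam k) c v →
  deg h χ c v ≡ ∑ (sub n) λ S → 𝟙 (∣ S ∣ ≟ h) * (bit (lookup S v) * copies χ S c)
deg≡∑ {n} {lam} {k} h χ c v = begin
  deg h χ c v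
    ≡⟨ length-filter _ (edges n h lam) ⟩
  sumOver (λ (S , i) → 𝟙 ((v ∈? S) ×-dec (χ S i F.≟ c))) (edges n h lam)
    ≡⟨ sumOver-cong (λ (S , i) → trans (𝟙-× (v ∈? S) (χ S i F.≟ c)) (cong₂ _*_ (𝟙-∈ v S) (𝟙-≟ (χ S i) c))) (edges n h lam) ⟩
  sumOver (λ (S , i) → bit (lookup S v) * δ (fin k) (χ S i) c) (edges n h lam)
    ≡⟨ sumOver-cartesianProduct _ (hSubsets n h) (L.allFin lam) ⟩
  sumOver (λ S → sumOver (λ i → bit (lookup S v) * δ (fin k) (χ S i) c) (L.allFin lam)) (hSubsets n h)
    ≡⟨ sumOver-cong (λ S → trans (sumOver-tabulate lam _ id) (∑-*ˡ (fin lam) (bit (lookup S v)) _)) (hSubsets n h) ⟩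
  sumOver (λ S → bit (lookup S v) * copies χ S c) (hSubsets n h)
    ≡⟨ sumOver-filter _ _ (subsets n) ⟩
  sumOver (λ S → 𝟙 (∣ S ∣ ≟ h) * (bit (lookup S v) * copies χ S c)) (subsets n)
    ≡⟨ sumOver-subsets n _ ⟩
  ∑ (sub n) (λ S → 𝟙 (∣ S ∣ ≟ h) * (bit (lookup S v) * copies χ S c)) ∎
  where open ≡-Reasoning

∑-copies : ∀ {n lam k} (χ : Colouring n lam k) S → ∑ (fin k) (copies χ S) ≡ lam
∑-copies {lam = lam} {k} χ S = trans (∑-swap (fin k) (fin lam) _)
  (trans (∑-cong (fin lam) λ i → ∑-δ₁ (fin k) (χ S i)) (trans (∑-const lam 1) (*-identityʳ lam)))

∑-size : ∀ n h → ∑ (sub n) (λ S → 𝟙 (∣ S ∣ ≟ h)) ≡ n C h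
∑-size zero zero    = refl
∑-size zero (suc h) = sym (k>n⇒nCk≡0 {0} {suc h} z<s)
∑-size (suc n) zero = trans (cong₂ _+_ (∑-size n 0) (∑-zero (sub n) λ S → 𝟙-no (suc ∣ S ∣ ≟ 0) λ ()))
  (trans (+-identityʳ _) (trans (nC0≡1 n) (sym (nC0≡1 (suc n)))))
∑-size (suc n) (suc h) = trans (cong₂ _+_ (∑-size n (suc h)) (trans (∑-cong (sub n) λ S →
    𝟙-cong (suc ∣ S ∣ ≟ suc h) (∣ S ∣ ≟ h) suc-injective (cong suc)) (∑-size n h)))
  (trans (+-comm (n C suc h) _) (sym (pascal n h)))

∑-bit : ∀ {n} (S : Subset n) → ∑ (fin n) (λ v → bit (lookup S v)) ≡ ∣ S ∣
∑-bit []          = refl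
∑-bit (false ∷ S) = ∑-bit S
∑-bit (true ∷ S)  = cong suc (∑-bit S)

∑-deg-zero : ∀ {n lam k} h (χ : Colouring (suc n) lam k) → ∑ (fin k) (λ c → deg (suc h) χ c zero) ≡ lam * (n C h)
∑-deg-zero {n} {lam} {k} h χ = begin
  ∑ (fin k) (λ c → deg (suc h) χ c zero)
    ≡⟨ trans (∑-cong (fin k) λ c → deg≡∑ (suc h) χ c zero) (∑-swap (fin k) (sub (suc n)) λ c S → 𝟙 (∣ S ∣ ≟ suc h) * (bit (lookup S zero) * copies χ S c)) ⟩
  ∑ (sub (suc n)) (λ S → ∑ (fin k) λ c → 𝟙 (∣ S ∣ ≟ suc h) * (bit (lookup S zero) * copies χ S c))
    ≡⟨ ∑-cong (sub (suc n)) (λ S → trans (∑-*ˡ (fin k) (𝟙 (∣ S ∣ ≟ suc h)) _)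
         (cong (𝟙 (∣ S ∣ ≟ suc h) *_) (trans (∑-*ˡ (fin k) (bit (lookup S zero)) _) (cong (bit (lookup S zero) *_) (∑-copies χ S))))) ⟩
  ∑ (sub (suc n)) (λ S → 𝟙 (∣ S ∣ ≟ suc h) * (bit (lookup S zero) * lam))
    ≡⟨ cong₂ _+_ (∑-zero (sub n) λ S → *-zeroʳ (𝟙 (∣ S ∣ ≟ suc h)))
         (∑-cong (sub n) λ S → cong₂ _*_ (𝟙-cong (suc ∣ S ∣ ≟ suc h) (∣ S ∣ ≟ h) suc-injective (cong suc)) (*-identityˡ lam)) ⟩
  ∑ (sub n) (λ S → 𝟙 (∣ S ∣ ≟ h) * lam)
    ≡⟨ trans (∑-*ʳ (sub n) lam _) (trans (cong (_* lam) (∑-size n h)) (*-comm (n C h) lam)) ⟩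
  lam * (n C h) ∎
  where open ≡-Reasoning

∣∑-deg : ∀ {n lam k} h (χ : Colouring n lam k) c → h ∣ ∑ (fin n) (deg h χ c)
∣∑-deg {n} h χ c = subst (h ∣_) (sym (trans (∑-cong (fin n) (deg≡∑ h χ c)) (∑-swap (fin n) (sub n) _))) (∣∑ (sub n) each)
  where
  each : ∀ S → h ∣ ∑ (fin n) λ v → 𝟙 (∣ S ∣ ≟ h) * (bit (lookup S v) * copies χ S c)
  each S = subst (h ∣_) (sym (trans (∑-*ˡ (fin n) (𝟙 (∣ S ∣ ≟ h)) _) (cong (𝟙 (∣ S ∣ ≟ h) *_)
    (trans (∑-*ʳ (fin n) (copies χ S c) _) (cong (_* copies χ S c) (∑-bit S)))))) h∣
    where
    h∣ : h ∣ 𝟙 (∣ S ∣ ≟ h) * (∣ S ∣ * copies χ S c)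
    h∣ with ∣ S ∣ ≟ h
    ... | yes refl = ∣n⇒∣m*n 1 (m∣m*n (copies χ S c))
    ... | no _     = h ∣0

-- The degrees of the single vertex `zero` in all factors give `k * r`; the degree sum of one factor
-- counts each edge `suc h` times. The latter needs a factor to exist, hence the argument in
-- `Fin k`.
factorization-admissible : ∀ {n lam k} h r (χ : Colouring (suc n) lam k) → IsFactorization (suc h) r χ →
  k * r ≡ lam * (n C h) × (Fin k → Admissible (suc h) (suc n) r lam)
factorization-admissible {n} {lam} {k} h r χ regular = kr , λ c →
  subst (suc h ∣_) (trans (∑-cong (fin (suc n)) (regular c)) (trans (∑-const (suc n) r) (*-comm (suc n) r))) (∣∑-deg (suc h) χ c)
  , divides k (sym kr)
  where
  kr : k * r ≡ lam * (n C h)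
  kr = trans (sym (∑-const k r)) (trans (∑-cong (fin k) λ c → sym (regular c zero)) (∑-deg-zero h χ))

∑-++ : ∀ m N (f : Subset (m + N) → ℕ) → ∑ (sub (m + N)) f ≡ ∑ (sub m) λ X → ∑ (sub N) λ Z → f (X V.++ Z)
∑-++ zero    N f = refl
∑-++ (suc m) N f = cong₂ _+_ (∑-++ m N _) (∑-++ m N _)

∣++∣ : ∀ {m N} (X : Subset m) (Z : Subset N) → ∣ X V.++ Z ∣ ≡ ∣ X ∣ + ∣ Z ∣
∣++∣ []          Z = refl
∣++∣ (false ∷ X) Z = ∣++∣ X Z
∣++∣ (true ∷ X)  Z = cong suc (∣++∣ X Z)

take-++ : ∀ {m N} (X : Subset m) (Z : Subset N) → V.take m (X V.++ Z) ≡ X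
take-++ {m} X Z = VP.++-injectiveˡ _ X (VP.take++drop≡id m (X V.++ Z))

drop-++ : ∀ {m N} (X : Subset m) (Z : Subset N) → V.drop m (X V.++ Z) ≡ Z
drop-++ {m} X Z = VP.++-injectiveʳ (V.take m (X V.++ Z)) X (VP.take++drop≡id m (X V.++ Z))

∅ : ∀ {n} → Subset n
∅ = V.replicate _ outside

∣∅∣ : ∀ n → ∣ ∅ {n} ∣ ≡ 0
∣∅∣ zero    = refl
∣∅∣ (suc n) = ∣∅∣ n

size-0 : ∀ {n} (S : Subset n) → ∣ S ∣ ≡ 0 → S ≡ ∅
size-0 []          _ = refl
size-0 (false ∷ S) e = cong (outside ∷_) (size-0 S e)

embed-++ : ∀ {m} N (S : Subset m) → embed {m} {m + N} S ≡ S V.++ ∅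
embed-++ {m} N S = trans (VP.tabulate-cong pointwise) (VP.tabulate∘lookup (S V.++ ∅))
  where
  -- The local function of embed has no name; checking embed≡ makes Agda fill it in.
  F : Fin (m + N) → Bool
  F = _
  embed≡ : embed {m} {m + N} S ≡ V.tabulate F
  embed≡ = refl
  pointwise : ∀ v → F v ≡ lookup (S V.++ ∅ {N}) v
  pointwise v with toℕ v <? m
  ... | yes v<m = sym (VP.lookup-++-< S ∅ v v<m)
  ... | no v≮m  = sym (trans (VP.lookup-++-≥ S ∅ v (≮⇒≥ v≮m)) (VP.lookup-replicate (F.reduce≥ v (≮⇒≥ v≮m)) outside))

-- Turns the edge numbers of a detachment into a colouring of the `lam` copies of one set.
withFibres : ∀ K lam (f : Fin K → ℕ) → ∑ (fin K) f ≡ lam →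
  Σ (Fin lam → Fin K) λ F → ∀ c → ∑ (fin lam) (λ i → δ (fin K) (F i) c) ≡ f c
withFibres K zero      f ∑f = (λ ()) , λ c → sym (∑≡0⇒≡0 (fin K) ∑f c)
withFibres K (suc lam) f ∑f =
  (λ { zero → c₀ ; (suc i) → proj₁ F i }) , λ c → trans (cong (δ (fin K) c₀ c +_) (proj₂ F c)) (m+[n∸m]≡n (δ≤f c))
  where
  nonempty : ∃ λ c → 0 < f c
  nonempty = ∑>0⇒∃ (fin K) (subst (0 <_) (sym ∑f) z<s)
  c₀ = proj₁ nonempty
  δ≤f : ∀ c → δ (fin K) c₀ c ≤ f c
  δ≤f c with compareE (fin K) c₀ c
  ... | same e refl = subst (_≤ f c) (sym e) (proj₂ nonempty)
  ... | diff e _    = subst (_≤ f c) (sym e) z≤n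
  ∑f′ : ∑ (fin K) (λ c → f c ∸ δ (fin K) c₀ c) ≡ lam
  ∑f′ = suc-injective (trans (+-comm 1 _) (trans (cong (∑ (fin K) (λ c → f c ∸ δ (fin K) c₀ c) +_) (sym (∑-δ₁ (fin K) c₀)))
    (trans (sym (∑-+ (fin K) _ _)) (trans (∑-cong (fin K) λ c → m∸n+n≡m (δ≤f c)) ∑f))))
  F = withFibres K lam (λ c → f c ∸ δ (fin K) c₀ c) ∑f′

-- Extending a factorization

member⇒size>0 : ∀ {n} (X : Subset n) v → lookup X v ≡ true → 0 < ∣ X ∣
member⇒size>0 {n} X v v∈X = ≤-trans (≤-reflexive (sym (cong bit v∈X))) (≤-trans (≤∑ (fin n) (λ u → bit (lookup X u)) v) (≤-reflexive (∑-bit X)))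

pick : ∀ {n} (X : Subset n) → ∣ X ∣ ≡ 0 ⊎ ∃ λ v → lookup X v ≡ true
pick []          = inj₁ refl
pick (true ∷ X)  = inj₂ (zero , refl)
pick (false ∷ X) = Data.Sum.map id (map suc id) (pick X)

bit>0 : ∀ b {n} → 0 < bit b * n → b ≡ true × 0 < n
bit>0 true pos = refl , subst (0 <_) (*-identityˡ _) pos

not-⊆ : ∀ {n} (X Y : Subset n) → ∣ Y ∣ < ∣ X ∣ → ∃ λ v → lookup X v ≡ true × lookup Y v ≡ false
not-⊆ {n} X Y less with exists? (fin n) (λ v → (lookup X v Data.Bool.≟ true) ×-dec (lookup Y v Data.Bool.≟ false))
... | yes found = found
... | no none = ⊥-elim (<⇒≱ less (subst₂ _≤_ (∑-bit X) (∑-bit Y) (∑-mono (fin n) pointwise)))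
  where
  pointwise : ∀ v → bit (lookup X v) ≤ bit (lookup Y v)
  pointwise v with lookup X v in x | lookup Y v in y
  ... | false | _     = z≤n
  ... | true  | true  = ≤-refl
  ... | true  | false = ⊥-elim (none (v , x , y))

-- Only the summand matching `a` survives. A set of `a` old vertices is the trace of λ C(N,5-a)
-- edges; for `a` equal to 5 these are the given edges.
∑-types : ∀ N lam a →
  ∑ (fin 5) (λ i → 𝟙 (a ≟ toℕ i) * (lam * (N C (5 ∸ toℕ i)))) + 𝟙 (a ≟ 5) * lam ≡ 𝟙 (a ≤? 5) * lam * (N C (5 ∸ a))
∑-types N lam a = bySize a
  where
  collapse : ∀ l c → 1 * (l * c) + 0 + 0 ≡ 1 * l * c
  collapse = solve-∀
  bySize : ∀ a →
    ∑ (fin 5) (λ i → 𝟙 (a ≟ toℕ i) * (lam * (N C (5 ∸ toℕ i)))) + 𝟙 (a ≟ 5) * lam ≡ 𝟙 (a ≤? 5) * lam * (N C (5 ∸ a))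
  bySize 0 = collapse lam (N C 5)
  bySize 1 = collapse lam (N C 4)
  bySize 2 = collapse lam (N C 3)
  bySize 3 = collapse lam (N C 2)
  bySize 4 = collapse lam (N C 1)
  bySize 5 = sym (trans (cong (1 * lam *_) (nC0≡1 N)) (*-identityʳ _))
  bySize (suc (suc (suc (suc (suc (suc a)))))) = refl

Reach-trans : ∀ {n lam k h} {χ : Colouring n lam k} {c u v w} → Reach h χ c u v → Reach h χ c v w → Reach h χ c u w
Reach-trans here                    q = q
Reach-trans (step S e i f u∈S w∈S p) q = step S e i f u∈S w∈S (Reach-trans p q)

Reach-sym : ∀ {n lam k h} {χ : Colouring n lam k} {c u v} → Reach h χ c u v → Reach h χ c v u
Reach-sym here                     = here
Reach-sym (step S e i f u∈S w∈S p) = Reach-trans (Reach-sym p) (step S e i f w∈S u∈S here)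

-- The component of `u`, taken from a labelling by shared edges, is a cut that no edge crosses, so
-- it must be everything; equal labels then yield a path.
connected-by-cuts : ∀ {n lam k h} (χ : Colouring n lam k) (c : Fin k) →
  (∀ (U : Fin n → Bool) → (∀ S i → ∣ S ∣ ≡ h → χ S i ≡ c → ∀ a b → lookup S a ≡ true → lookup S b ≡ true → U a ≡ U b) →
     ∀ a b → U a ≡ U b) →
  IsConnectedFactor h χ c
connected-by-cuts {n} {lam} {k} {h} χ c noCut u v = sound u v (sym (cut≡ v))
  where
  Adj : Fin n → Fin n → Set
  Adj a b = ∃ λ (e : Subset n × Fin lam) → (∣ proj₁ e ∣ ≡ h × χ (proj₁ e) (proj₂ e) ≡ c) × lookup (proj₁ e) a ≡ true × lookup (proj₁ e) b ≡ true
  adj? : ∀ a b → Dec (Adj a b)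
  adj? a b = exists? (sub n ⊗ fin lam) λ (S , i) →
    ((∣ S ∣ ≟ h) ×-dec (χ S i F.≟ c)) ×-dec ((lookup S a Data.Bool.≟ true) ×-dec (lookup S b Data.Bool.≟ true))
  adj⇒reach : ∀ {a b} → Adj a b → Reach h χ c a b
  adj⇒reach {a} {b} ((S , i) , (size , colour) , a∈S , b∈S) =
    step S size i colour (VP.lookup⇒[]= a S a∈S) (VP.lookup⇒[]= b S b∈S) here
  labelling = components adj? (record { refl = here ; sym = Reach-sym ; trans = Reach-trans }) adj⇒reach
  lab = proj₁ labelling
  sound = proj₁ (proj₂ labelling)
  cut : Fin n → Bool
  cut w = does (lab w F.≟ lab u)
  cut≡ : ∀ w → lab w ≡ lab u
  cut≡ w with lab w F.≟ lab u | noCut cut (λ S i size colour a b a∈S b∈S →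
    cong (λ l → does (l F.≟ lab u)) (proj₂ (proj₂ labelling) a b ((S , i) , (size , colour) , a∈S , b∈S))) u w
  ... | yes eq | _ = eq
  ... | no _   | e with lab u F.≟ lab u
  ...   | yes _ = case e of λ ()
  ...   | no ≢  = ⊥-elim (≢ refl)

data Side {m N} (v : Fin (m + N)) : Set where
  old : ∀ (u : Fin m) → v ≡ u ↑ˡ N → Side v
  new : ∀ (u : Fin N) → v ≡ m ↑ʳ u → Side v

side : ∀ m N (v : Fin (m + N)) → Side {m} {N} v
side m N v with F.splitAt m v in eq
... | inj₁ u = old u (sym (FP.splitAt⁻¹-↑ˡ eq))
... | inj₂ u = new u (sym (FP.splitAt⁻¹-↑ʳ eq))

module Extension (m N s r lam K k : ℕ) (ψ : Colouring m lam k) (regular : IsFactorization 5 r ψ)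
  (k≤K : k ≤ K) (r<s : r < s) (0<r : 0 < r) (0<N : 0 < N)
  (y : Fin K → Fin 5 → ℕ) (yrest : ∀ c → ∑ (fin 5) (λ i → (5 ∸ toℕ i) * y c i) ≡ N * s)
  (D₁ : Detachment K (fin 5) 0 m toℕ (λ i → lam * (N C (5 ∸ toℕ i))) (λ c → s ∸ oldDeg k r c) y (λ _ _ → zero)) where

  module D₁ = Detachment D₁

  g : Fin k → Fin K
  g j = F.inject≤ j k≤K

  gψ : Colouring m lam K
  gψ X i = g (ψ X i)

  -- Edges of class `c` with trace `X` on Y: the given ones lie inside Y, the new ones come from the
  -- first detachment and have at most four vertices there.
  oldCopies newCopies x : Fin K → Subset m → ℕ
  oldCopies c X = 𝟙 (∣ X ∣ ≟ 5) * copies gψ X c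
  newCopies c X = ∑ (fin 5) λ i → D₁.z c i X
  x c X = newCopies c X + oldCopies c X

  w M : Subset m → ℕ
  w X = 5 ∸ ∣ X ∣
  M X = 𝟙 (∣ X ∣ ≤? 5) * lam

  z₁-size : ∀ c i X → 0 < D₁.z c i X → ∣ X ∣ ≡ toℕ i
  z₁-size c i X pos with ∣ X ∣ ≟ toℕ i | D₁.z-tot i X
  ... | yes e | _   = e
  ... | no _  | tot = ⊥-elim (<⇒≢ pos (sym (∑≡0⇒≡0 (fin K) tot c)))

  new-size : ∀ c X → 0 < newCopies c X → ∣ X ∣ < 5
  new-size c X pos with ∑>0⇒∃ (fin 5) pos
  ... | i , pos′ = subst (_< 5) (sym (z₁-size c i X pos′)) (FP.toℕ<n i)

  total : ∀ X → ∑ (fin K) (λ c → x c X) ≡ M X * (N C w X)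
  total X = trans (∑-+ (fin K) _ _) (trans (cong₂ _+_
      (trans (∑-swap (fin K) (fin 5) λ c i → D₁.z c i X) (∑-cong (fin 5) λ i → D₁.z-tot i X))
      (trans (∑-*ˡ (fin K) (𝟙 (∣ X ∣ ≟ 5)) _) (cong (𝟙 (∣ X ∣ ≟ 5) *_) (∑-copies gψ X))))
    (∑-types N lam ∣ X ∣))

  weight : ∀ c → ∑ (sub m) (λ X → w X * x c X) ≡ N * s
  weight c = trans (∑-cong (sub m) pointwise) (trans (∑-swap (sub m) (fin 5) λ X i → (5 ∸ toℕ i) * D₁.z c i X)
    (trans (∑-cong (fin 5) λ i → trans (∑-*ˡ (sub m) (5 ∸ toℕ i) _) (cong ((5 ∸ toℕ i) *_) (D₁.z-type c i))) (yrest c)))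
    where
    term : ∀ X i → w X * D₁.z c i X ≡ (5 ∸ toℕ i) * D₁.z c i X
    term X i with D₁.z c i X | z₁-size c i X
    ... | zero  | _    = trans (*-zeroʳ (w X)) (sym (*-zeroʳ (5 ∸ toℕ i)))
    ... | suc _ | size = cong (λ a → (5 ∸ a) * _) (size z<s)
    none : ∀ X → w X * oldCopies c X ≡ 0
    none X with ∣ X ∣ ≟ 5
    ... | yes e = cong (λ a → (5 ∸ a) * (1 * copies gψ X c)) e
    ... | no _  = *-zeroʳ (w X)
    pointwise : ∀ X → w X * x c X ≡ ∑ (fin 5) λ i → (5 ∸ toℕ i) * D₁.z c i X
    pointwise X = trans (*-distribˡ-+ (w X) (newCopies c X) _) (trans (cong₂ _+_
      (trans (sym (∑-*ˡ (fin 5) (w X) λ i → D₁.z c i X)) (∑-cong (fin 5) (term X))) (none X)) (+-identityʳ _))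

  new-deg : ∀ c v → ∑ (sub m) (λ X → bit (lookup X v) * newCopies c X) ≡ s ∸ oldDeg k r c
  new-deg c v = trans (∑-cong (sub m) λ X → sym (∑-*ˡ (fin 5) (bit (lookup X v)) λ i → D₁.z c i X))
    (trans (∑-swap (sub m) (fin 5) λ X i → bit (lookup X v) * D₁.z c i X) (D₁.z-deg c v))

  copies-g : ∀ c X j → toℕ j ≡ toℕ c → copies gψ X c ≡ copies ψ X j
  copies-g c X j e = ∑-cong (fin lam) λ i → δ-g (ψ X i)
    where
    δ-g : ∀ a → δ (fin K) (g a) c ≡ δ (fin k) a j
    δ-g a with compareE (fin k) a j
    ... | same e′ refl = trans (trans (cong (λ b → δ (fin K) b c) g≡) (δ-refl (fin K) c)) (sym e′)
      where
      g≡ : g j ≡ c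
      g≡ = FP.toℕ-injective (trans (FP.toℕ-inject≤ j k≤K) e)
    ... | diff e′ a≢j = trans (δ-≢ (fin K) λ q → a≢j (FP.toℕ-injective
        (trans (sym (FP.toℕ-inject≤ a k≤K)) (trans (cong toℕ q) (sym e))))) (sym e′)

  old-deg : ∀ c v → ∑ (sub m) (λ X → bit (lookup X v) * oldCopies c X) ≡ oldDeg k r c
  old-deg c v with toℕ c <? k
  ... | yes c<k = trans (∑-cong (sub m) λ X → trans (m*[n*o]≡n*[m*o] (bit (lookup X v)) (𝟙 (∣ X ∣ ≟ 5)) _)
        (cong (λ n → 𝟙 (∣ X ∣ ≟ 5) * (bit (lookup X v) * n)) (copies-g c X (F.fromℕ< c<k) (FP.toℕ-fromℕ< c<k))))
      (trans (sym (deg≡∑ 5 ψ (F.fromℕ< c<k) v)) (trans (regular _ v) (sym (*-identityˡ r))))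
  ... | no c≮k = ∑-zero (sub m) λ X → trans (cong (λ n → bit (lookup X v) * (𝟙 (∣ X ∣ ≟ 5) * n)) (∑-zero (fin lam) λ i →
        δ-≢ (fin K) λ q → c≮k (subst (_< k) (trans (sym (FP.toℕ-inject≤ (ψ X i) k≤K)) (cong toℕ q)) (FP.toℕ<n (ψ X i)))))
      (trans (cong (bit (lookup X v) *_) (*-zeroʳ (𝟙 (∣ X ∣ ≟ 5)))) (*-zeroʳ (bit (lookup X v))))

  x-deg : ∀ c v → ∑ (sub m) (λ X → bit (lookup X v) * x c X) ≡ s
  x-deg c v = trans (∑-cong (sub m) λ X → *-distribˡ-+ (bit (lookup X v)) (newCopies c X) _)
    (trans (∑-+ (sub m) _ _) (trans (cong₂ _+_ (new-deg c v) (old-deg c v)) (m∸n+n≡m (oldDeg≤ k c (<⇒≤ r<s)))))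

  Mono : Fin K → (Fin m → Bool) → Set
  Mono c U = ∀ X → 0 < x c X → ∀ a b → lookup X a ≡ true → lookup X b ≡ true → U a ≡ U b

  -- `Joined` speaks of 2-colourings because at this stage traces are merely counted and there are
  -- no edges yet to form a `Reach` path.
  Joined Adjacent : Fin K → Fin m → Fin m → Set
  Joined c u v = ∀ U → Mono c U → U u ≡ U v
  Adjacent c u v = ∃ λ X → 0 < x c X × lookup X u ≡ true × lookup X v ≡ true

  Joined-equivalence : ∀ c → IsEquivalence (Joined c)
  Joined-equivalence c = record
    { refl  = λ _ _ → refl
    ; sym   = λ p U mono → sym (p U mono)
    ; trans = λ p q U mono → trans (p U mono) (q U mono) }

  labelling : ∀ c → Σ (Fin m → Fin m) λ lab → (∀ u v → lab u ≡ lab v → Joined c u v) × (∀ u v → Adjacent c u v → lab u ≡ lab v)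
  labelling c = components
    (λ u v → exists? (sub m) λ X → (0 <? x c X) ×-dec ((lookup X u Data.Bool.≟ true) ×-dec (lookup X v Data.Bool.≟ true)))
    (Joined-equivalence c) λ (X , pos , u∈X , v∈X) U mono → mono X pos _ _ u∈X v∈X

  module Labelled (lab : Fin K → Fin m → Fin m) (sound : ∀ c u v → lab c u ≡ lab c v → Joined c u v)
                  (complete : ∀ c u v → Adjacent c u v → lab c u ≡ lab c v) where

    label : Fin K → (X : Subset m) → ∣ X ∣ ≡ 0 ⊎ (∃ λ v → lookup X v ≡ true) → Fin (suc m)
    label c X (inj₁ _)       = zero
    label c X (inj₂ (v , _)) = suc (lab c v)

    -- Any vertex of a present trace may be picked, since all of them lie in one component.
    lab₂ : Fin K → Subset m → Fin (suc m)
    lab₂ c X = label c X (pick X)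

    label-member : ∀ c X v → lookup X v ≡ true → 0 < x c X → lab₂ c X ≡ suc (lab c v)
    label-member c X v v∈X pos with pick X
    ... | inj₁ e         = ⊥-elim (<⇒≢ (member⇒size>0 X v v∈X) (sym e))
    ... | inj₂ (u , u∈X) = cong suc (complete c u v (X , pos , u∈X , v∈X))

    classWeight : Fin K → Fin (suc m) → ℕ
    classWeight c κ = ∑ (sub m) λ X → δ (fin (suc m)) (lab₂ c X) κ * (w X * x c X)

    new≤weight : ∀ c X → newCopies c X ≤ w X * x c X
    new≤weight c X with newCopies c X | new-size c X
    ... | zero  | _    = z≤n
    ... | suc n | size = ≤-trans (m≤m+n (suc n) (oldCopies c X))
        (≤-trans (≤-reflexive (sym (*-identityˡ _))) (*-monoˡ-≤ (suc n + oldCopies c X) (m<n⇒0<n∸m (size z<s))))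

    -- In a class that extends no given factor all `s ≥ 2` edges at `v` leave Y, and each meets the
    -- block at least once.
    heavy-new : ∀ c v → toℕ c ≮ k → 2 ≤ classWeight c (suc (lab c v))
    heavy-new c v c≮k = ≤-trans (≤-trans (≤-trans (s≤s 0<r) r<s) (≤-reflexive (sym newDegree))) (∑-mono (sub m) pointwise)
      where
      newDegree : ∑ (sub m) (λ X → bit (lookup X v) * newCopies c X) ≡ s
      newDegree = trans (new-deg c v) (cong (λ o → s ∸ o * r) (𝟙-no (toℕ c <? k) c≮k))
      pointwise : ∀ X → bit (lookup X v) * newCopies c X ≤ δ (fin (suc m)) (lab₂ c X) (suc (lab c v)) * (w X * x c X)
      pointwise X with lookup X v in v∈X
      ... | false = z≤n
      ... | true = helper (newCopies c X) refl
        where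
        helper : ∀ n → newCopies c X ≡ n → 1 * newCopies c X ≤ δ (fin (suc m)) (lab₂ c X) (suc (lab c v)) * (w X * x c X)
        helper zero    e = ≤-trans (≤-reflexive (cong (1 *_) e)) z≤n
        helper (suc n) e = *-mono-≤ (≤-reflexive (sym (trans (cong (λ κ → δ (fin (suc m)) κ (suc (lab c v)))
            (label-member c X v v∈X (≤-trans (subst (0 <_) (sym e) z<s) (m≤m+n _ _)))) (δ-refl (fin (suc m)) (suc (lab c v))))))
          (new≤weight c X)

    -- Since `r > 0`, `v` lies in a given edge `E` of five vertices, and by `r < s` each of these is
    -- in a new trace. The trace `X₁` through `v` has at most four vertices, so it misses some `u`
    -- in `E`; a new trace through `u` differs from `X₁` and belongs to the same component.
    heavy-old : ∀ c v → toℕ c < k → 2 ≤ classWeight c (suc (lab c v))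
    heavy-old c v c<k = twoPieces (not-⊆ E X₁ (subst (∣ X₁ ∣ <_) (sym ∣E∣) (new-size c X₁ (proj₂ (proj₂ piece₁)))))
      where
      old≡r : oldDeg k r c ≡ r
      old≡r = trans (cong (_* r) (𝟙-yes (toℕ c <? k) c<k)) (*-identityˡ r)
      oldEdge : ∃ λ X → 0 < bit (lookup X v) * oldCopies c X
      oldEdge = ∑>0⇒∃ (sub m) (subst (0 <_) (sym (trans (old-deg c v) old≡r)) 0<r)
      E = proj₁ oldEdge
      v∈E : lookup E v ≡ true
      v∈E = proj₁ (bit>0 (lookup E v) (proj₂ oldEdge))
      oldE : 0 < oldCopies c E
      oldE = proj₂ (bit>0 (lookup E v) (proj₂ oldEdge))
      ∣E∣ : ∣ E ∣ ≡ 5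
      ∣E∣ with ∣ E ∣ ≟ 5 | oldE
      ... | yes e | _ = e
      presentE : 0 < x c E
      presentE = ≤-trans oldE (m≤n+m _ _)
      piece : ∀ u → ∃ λ X → lookup X u ≡ true × 0 < newCopies c X
      piece u with ∑>0⇒∃ (sub m) (subst (0 <_) (sym (trans (new-deg c u) (cong (s ∸_) old≡r))) (m<n⇒0<n∸m r<s))
      ... | X , pos = X , bit>0 (lookup X u) pos
      piece₁ = piece v
      X₁ = proj₁ piece₁
      contribution : ∀ X u → lookup X u ≡ true → lookup E u ≡ true → 0 < newCopies c X →
        1 ≤ δ (fin (suc m)) (lab₂ c X) (suc (lab c v)) * (w X * x c X)
      contribution X u u∈X u∈E pos = *-mono-≤ (≤-reflexive (sym (trans (cong (λ κ → δ (fin (suc m)) κ (suc (lab c v)))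
          (trans (label-member c X u u∈X (≤-trans pos (m≤m+n _ _))) (cong suc (complete c u v (E , presentE , u∈E , v∈E)))))
          (δ-refl (fin (suc m)) (suc (lab c v))))))
        (≤-trans pos (new≤weight c X))
      twoPieces : (∃ λ u → lookup E u ≡ true × lookup X₁ u ≡ false) → 2 ≤ classWeight c (suc (lab c v))
      twoPieces (u , u∈E , u∉X₁) = ≤-trans
        (+-mono-≤ (contribution X₁ v (proj₁ (proj₂ piece₁)) v∈E (proj₂ (proj₂ piece₁)))
                  (contribution X₂ u (proj₁ (proj₂ (piece u))) u∈E (proj₂ (proj₂ (piece u)))))
        (two≤∑ (sub m) (λ X → δ (fin (suc m)) (lab₂ c X) (suc (lab c v)) * (w X * x c X)) X₁≢X₂)
        where
        X₂ = proj₁ (piece u)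
        X₁≢X₂ : X₁ ≢ X₂
        X₁≢X₂ e = case trans (sym u∉X₁) (trans (cong (λ X → lookup X u) e) (proj₁ (proj₂ (piece u)))) of λ ()

    spread : ∀ c → Spread {T = sub m} w x lab₂ c
    spread c X pos with pick X in eq
    ... | inj₁ e = inj₁ (refl , subst (λ a → 3 ≤ 5 ∸ a) (sym e) (s≤s (s≤s (s≤s z≤n))))
    ... | inj₂ (v , v∈X) with toℕ c <? k
    ...   | yes c<k = inj₂ ((λ ()) , heavy-old c v c<k)
    ...   | no c≮k  = inj₂ ((λ ()) , heavy-new c v c≮k)

    module Colour (D₂ : Detachment K (sub m) m N w M (λ _ → s) x lab₂) where

      module D₂ = Detachment D₂

      z₂-size : ∀ c X Z → 0 < D₂.z c X Z → ∣ X ∣ + ∣ Z ∣ ≡ 5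
      z₂-size c X Z pos with ∣ Z ∣ ≟ w X | ∣ X ∣ ≤? 5 | D₂.z-tot X Z
      ... | no _  | _       | tot = ⊥-elim (<⇒≢ pos (sym (∑≡0⇒≡0 (fin K) tot c)))
      ... | yes _ | no _    | tot = ⊥-elim (<⇒≢ pos (sym (∑≡0⇒≡0 (fin K) tot c)))
      ... | yes e | yes X≤5 | _   = trans (cong (∣ X ∣ +_) e) (m+[n∸m]≡n X≤5)

      z₂-full : ∀ X Z → ∣ X ∣ + ∣ Z ∣ ≡ 5 → ∑ (fin K) (λ c → D₂.z c X Z) ≡ lam
      z₂-full X Z e = trans (D₂.z-tot X Z) (trans (cong₂ _*_
          (𝟙-yes (∣ Z ∣ ≟ w X) (trans (sym (m+n∸m≡n ∣ X ∣ ∣ Z ∣)) (cong (_∸ ∣ X ∣) e)))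
          (trans (cong (_* lam) (𝟙-yes (∣ X ∣ ≤? 5) (≤-trans (m≤m+n _ _) (≤-reflexive e)))) (*-identityˡ lam)))
        (*-identityˡ lam))

      fibres : ∀ X Z → ∣ X ∣ + ∣ Z ∣ ≡ 5 → Fin lam → Fin K
      fibres X Z e = proj₁ (withFibres K lam (λ c → D₂.z c X Z) (z₂-full X Z e))

      colour : Subset m → Subset N → Fin lam → Fin K
      colour X Z with ∣ X ∣ ≟ 5 | (∣ X ∣ + ∣ Z ∣) ≟ 5
      ... | no _ | yes e = fibres X Z e
      -- Sets of five old vertices keep their given colour. Any other set that gets here does not
      -- have five elements, and its value is irrelevant.
      ... | _    | _     = gψ X

      colour-old : ∀ X Z → ∣ X ∣ ≡ 5 → ∀ i → colour X Z i ≡ gψ X i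
      colour-old X Z e i with ∣ X ∣ ≟ 5 | (∣ X ∣ + ∣ Z ∣) ≟ 5
      ... | yes _ | _ = refl
      ... | no ≢5 | _ = ⊥-elim (≢5 e)

      -- Only the empty `Z` completes a trace of size five, so the second detachment puts all copies
      -- of `X` there, and these are the given ones.
      old-z : ∀ c X Z → ∣ X ∣ ≡ 5 → ∣ X ∣ + ∣ Z ∣ ≡ 5 → copies gψ X c ≡ D₂.z c X Z
      old-z c X Z X5 e = sym (begin
        D₂.z c X Z                                 ≡⟨ +-identityʳ _ ⟨
        D₂.z c X Z + 0                             ≡⟨ cong (D₂.z c X Z +_) (∑-zero (sub N) others) ⟨
        D₂.z c X Z + ∑ (sub N) (off (sub N) Z (D₂.z c X))  ≡⟨ ∑-remove (sub N) Z (D₂.z c X) ⟨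
        ∑ (sub N) (D₂.z c X)                       ≡⟨ D₂.z-type c X ⟩
        newCopies c X + oldCopies c X              ≡⟨ cong₂ _+_ new≡0 (trans (cong (_* copies gψ X c) (𝟙-yes (∣ X ∣ ≟ 5) X5)) (*-identityˡ _)) ⟩
        copies gψ X c                              ∎)
        where
        open ≡-Reasoning
        new≡0 : newCopies c X ≡ 0
        new≡0 = n≤0⇒n≡0 (≮⇒≥ λ pos → <⇒≢ (new-size c X pos) X5)
        ∅-only : ∀ Z → ∣ X ∣ + ∣ Z ∣ ≡ 5 → Z ≡ ∅
        ∅-only Z e = size-0 Z (+-cancelˡ-≡ 5 _ _ (trans (cong (_+ ∣ Z ∣) (sym X5)) e))
        others : ∀ Z′ → off (sub N) Z (D₂.z c X) Z′ ≡ 0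
        others Z′ with compareE (sub N) Z Z′
        ... | same e′ _   = cong (λ o → (1 ∸ o) * D₂.z c X Z′) e′
        ... | diff e′ Z≢Z′ = trans (cong (λ o → (1 ∸ o) * D₂.z c X Z′) e′) (trans (*-identityˡ _)
            (n≤0⇒n≡0 (≮⇒≥ λ pos → Z≢Z′ (trans (∅-only Z e) (sym (∅-only Z′ (z₂-size c X Z′ pos)))))))

      colour-z : ∀ c X Z → ∣ X ∣ + ∣ Z ∣ ≡ 5 → ∑ (fin lam) (λ i → δ (fin K) (colour X Z i) c) ≡ D₂.z c X Z
      colour-z c X Z e with ∣ X ∣ ≟ 5 | (∣ X ∣ + ∣ Z ∣) ≟ 5
      ... | yes X5 | _     = old-z c X Z X5 e
      ... | no _   | yes q = proj₂ (withFibres K lam (λ c → D₂.z c X Z) (z₂-full X Z q)) c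
      ... | no _   | no ≢5 = ⊥-elim (≢5 e)

      χ : Colouring (m + N) lam K
      χ S i = colour (V.take m S) (V.drop m S) i

      χ-++ : ∀ X Z i → χ (X V.++ Z) i ≡ colour X Z i
      χ-++ X Z i = cong₂ (λ X Z → colour X Z i) (take-++ X Z) (drop-++ X Z)

      copies-χ : ∀ c X Z → ∣ X ∣ + ∣ Z ∣ ≡ 5 → copies χ (X V.++ Z) c ≡ D₂.z c X Z
      copies-χ c X Z e = trans (∑-cong (fin lam) λ i → cong (λ d → δ (fin K) d c) (χ-++ X Z i)) (colour-z c X Z e)

      deg-χ : ∀ c v → deg 5 χ c v ≡ ∑ (sub m) λ X → ∑ (sub N) λ Z → bit (lookup (X V.++ Z) v) * D₂.z c X Z
      deg-χ c v = trans (deg≡∑ 5 χ c v) (trans (∑-++ m N _) (∑-cong (sub m) λ X → ∑-cong (sub N) λ Z → pointwise X Z))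
        where
        pointwise : ∀ X Z → 𝟙 (∣ X V.++ Z ∣ ≟ 5) * (bit (lookup (X V.++ Z) v) * copies χ (X V.++ Z) c) ≡
                            bit (lookup (X V.++ Z) v) * D₂.z c X Z
        pointwise X Z with ∣ X V.++ Z ∣ ≟ 5
        ... | yes e = trans (*-identityˡ _) (cong (bit (lookup (X V.++ Z) v) *_) (copies-χ c X Z (trans (sym (∣++∣ X Z)) e)))
        ... | no ≢5 = sym (trans (cong (bit (lookup (X V.++ Z) v) *_) (n≤0⇒n≡0 (≮⇒≥ λ pos → ≢5 (trans (∣++∣ X Z) (z₂-size c X Z pos)))))
              (*-zeroʳ (bit (lookup (X V.++ Z) v))))

      regular-χ : IsFactorization 5 s χ
      regular-χ c v with side m N v
      ... | old u refl = trans (deg-χ c (u ↑ˡ N)) (trans (∑-cong (sub m) λ X → trans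
            (trans (∑-cong (sub N) λ Z → cong (λ b → bit b * D₂.z c X Z) (VP.lookup-++ˡ X Z u)) (∑-*ˡ (sub N) (bit (lookup X u)) _))
            (cong (bit (lookup X u) *_) (D₂.z-type c X))) (x-deg c u))
      ... | new u refl = trans (deg-χ c (m ↑ʳ u)) (trans (∑-cong (sub m) λ X →
            ∑-cong (sub N) λ Z → cong (λ b → bit b * D₂.z c X Z) (VP.lookup-++ʳ X Z u)) (D₂.z-deg c u))

      noCut : ∀ c (U : Fin (m + N) → Bool) →
        (∀ S i → ∣ S ∣ ≡ 5 → χ S i ≡ c → ∀ a b → lookup S a ≡ true → lookup S b ≡ true → U a ≡ U b) → ∀ a b → U a ≡ U b
      noCut c U mono a b = trans (const a) (sym (const b))
        where
        onPiece : ∀ X Z → 0 < D₂.z c X Z → ∀ a b → lookup (X V.++ Z) a ≡ true → lookup (X V.++ Z) b ≡ true → U a ≡ U b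
        onPiece X Z pos with ∑>0⇒∃ (fin lam) (subst (0 <_) (sym (copies-χ c X Z (z₂-size c X Z pos))) pos)
        ... | i , pos′ = mono (X V.++ Z) i (trans (∣++∣ X Z) (z₂-size c X Z pos)) χ≡c
          where
          χ≡c : χ (X V.++ Z) i ≡ c
          χ≡c with compareE (fin K) (χ (X V.++ Z) i) c
          ... | same _ e = e
          ... | diff e _ = ⊥-elim (<⇒≢ pos′ (sym e))

        inOld : ∀ X Z u → lookup X u ≡ true → lookup (X V.++ Z) (u ↑ˡ N) ≡ true
        inOld X Z u = trans (VP.lookup-++ˡ X Z u)
        inNew : ∀ (X : Subset m) Z u → lookup Z u ≡ true → lookup (X V.++ Z) (m ↑ʳ u) ≡ true
        inNew X Z u = trans (VP.lookup-++ʳ X Z u)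

        mono-old : Mono c (λ u → U (u ↑ˡ N))
        mono-old X pos a b a∈X b∈X with ∑>0⇒∃ (sub N) (subst (0 <_) (sym (D₂.z-type c X)) pos)
        ... | Z , pos′ = onPiece X Z pos′ (a ↑ˡ N) (b ↑ˡ N) (inOld X Z a a∈X) (inOld X Z b b∈X)

        value : (X : Subset m) → ∣ X ∣ ≡ 0 ⊎ (∃ λ v → lookup X v ≡ true) → Bool
        -- An arbitrary value: an empty trace has label `zero`, and the conditions on colours of
        -- traces exclude that label.
        value X (inj₁ _)       = false
        value X (inj₂ (v , _)) = U (v ↑ˡ N)

        onClasses : ∀ X Y → 0 < x c X → 0 < x c Y → lab₂ c X ≡ lab₂ c Y → lab₂ c Y ≢ zero → value X (pick X) ≡ value Y (pick Y)
        onClasses X Y _ _ e ≢z with pick X | pick Y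
        ... | _            | inj₁ _       = ⊥-elim (≢z refl)
        ... | inj₂ (u , _) | inj₂ (v , _) = sound c u v (FP.suc-injective e) (λ u → U (u ↑ˡ N)) mono-old

        onTypes : ∀ X Z v → lab₂ c X ≢ zero → 0 < D₂.z c X Z → lookup Z v ≡ true → U (m ↑ʳ v) ≡ value X (pick X)
        onTypes X Z v ≢z pos v∈Z with pick X
        ... | inj₁ _         = ⊥-elim (≢z refl)
        ... | inj₂ (u , u∈X) = onPiece X Z pos (m ↑ʳ v) (u ↑ˡ N) (inNew X Z v v∈Z) (inOld X Z u u∈X)

        conclusion = D₂.connected c (spread c) (≤-trans (s≤s 0<r) r<s) (λ X → value X (pick X)) (λ u → U (m ↑ʳ u)) onClasses onTypes
          λ X Z u v _ pos u∈Z v∈Z → onPiece X Z pos (m ↑ʳ u) (m ↑ʳ v) (inNew X Z u u∈Z) (inNew X Z v v∈Z)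

        v₀ : Fin N
        v₀ = F.fromℕ< 0<N

        -- Each old vertex has degree `s > 0`, so it lies in a present trace, and the detachment
        -- ties the colour of that trace to `v₀`.
        const-old : ∀ u → U (u ↑ˡ N) ≡ U (m ↑ʳ v₀)
        const-old u with ∑>0⇒∃ (sub m) (subst (0 <_) (sym (x-deg c u)) (≤-trans z<s r<s))
        ... | X , pos with bit>0 (lookup X u) pos
        ... | u∈X , present with pick X | proj₁ conclusion X v₀
        ...   | inj₁ e         | _ = ⊥-elim (<⇒≢ (member⇒size>0 X u u∈X) (sym e))
        ...   | inj₂ (v , v∈X) | q = trans (mono-old X present u v u∈X v∈X) (q (λ ()) present)

        const : ∀ a → U a ≡ U (m ↑ʳ v₀)
        const a with side m N a
        ... | old u refl = const-old u
        ... | new u refl = proj₂ conclusion u v₀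

      extends : Extends (m + N) 5 s ψ
      extends = K , χ , (regular-χ , λ c → connected-by-cuts χ c (noCut c)) , g , FP.inject≤-injective k≤K k≤K _ _
        , λ X X5 i → trans (cong (λ S → χ S i) (embed-++ N X)) (trans (χ-++ X ∅ i) (colour-old X ∅ X5 i))

-- The equivalence

choose>0 : ∀ n k → k ≤ n → 0 < n C k
choose>0 n       zero    _         = ≤-reflexive (sym (nC0≡1 n))
choose>0 (suc n) (suc k) (s≤s k≤n) = ≤-trans (choose>0 n k k≤n) (≤-trans (m≤m+n _ _) (≤-reflexive (sym (pascal n k))))

module Necessity {m N lam k K h : ℕ} (ψ : Colouring m lam k) (χ : Colouring (m + N) lam K) (g : Fin k → Fin K)
  (extends : ∀ X → ∣ X ∣ ≡ h → ∀ i → χ (embed X) i ≡ g (ψ X i)) where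

  -- A path from an old to a new vertex is followed to its first new vertex; the edge of that step
  -- has vertices on both sides.
  crossing : ∀ {c a} u w → Reach h χ c a (m ↑ʳ w) → a ≡ u ↑ˡ N → ∃ λ S → ∃ λ i → ∣ S ∣ ≡ h × χ S i ≡ c ×
    (∃ λ u → u ↑ˡ N ∈ S) × (∃ λ w → m ↑ʳ w ∈ S)
  crossing u w here eq = ⊥-elim (<-irrefl (cong toℕ (sym eq)) (≤-trans
    (subst (_< m) (sym (FP.toℕ-↑ˡ u N)) (FP.toℕ<n u)) (≤-trans (m≤m+n m (toℕ w)) (≤-reflexive (sym (FP.toℕ-↑ʳ m w))))))
  crossing u w (step {w = b} S size i colour u∈S b∈S path) refl with side m N b
  ... | old u′ eq   = crossing u′ w path eq
  ... | new w′ refl = S , i , size , colour , (u , u∈S) , (w′ , b∈S)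

  -- The degree splits over the part `Z` outside Y: the summand at `∅` is at least the degree in the
  -- given factor, and the crossing edge adds to the rest.
  extraEdge : ∀ j S i u w → ∣ S ∣ ≡ h → χ S i ≡ g j → u ↑ˡ N ∈ S → m ↑ʳ w ∈ S → deg h ψ j u < deg h χ (g j) (u ↑ˡ N)
  extraEdge j S i u w size colour u∈S w∈S = begin-strict
    deg h ψ j u                                                    ≡⟨ deg≡∑ h ψ j u ⟩
    ∑ (sub m) (λ X → 𝟙 (∣ X ∣ ≟ h) * (bit (lookup X u) * copies ψ X j))  ≤⟨ ∑-mono (sub m) inner ⟩
    ∑ (sub m) (λ X → f X ∅)                                        <⟨ m<m+n _ (≤-trans outer (≤∑ (sub m) rest X₀)) ⟩
    ∑ (sub m) (λ X → f X ∅) + ∑ (sub m) rest                       ≡⟨ ∑-+ (sub m) _ _ ⟨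
    ∑ (sub m) (λ X → f X ∅ + rest X)                               ≡⟨ ∑-cong (sub m) (λ X → sym (∑-remove (sub N) ∅ (f X))) ⟩
    ∑ (sub m) (λ X → ∑ (sub N) (f X))                              ≡⟨ ∑-++ m N _ ⟨
    ∑ (sub (m + N)) (λ S → 𝟙 (∣ S ∣ ≟ h) * (bit (lookup S (u ↑ˡ N)) * copies χ S (g j)))
                                                                   ≡⟨ deg≡∑ h χ (g j) (u ↑ˡ N) ⟨
    deg h χ (g j) (u ↑ˡ N)                                         ∎
    where
    open ≤-Reasoning
    f : Subset m → Subset N → ℕ
    f X Z = 𝟙 (∣ X V.++ Z ∣ ≟ h) * (bit (lookup (X V.++ Z) (u ↑ˡ N)) * copies χ (X V.++ Z) (g j))
    rest : Subset m → ℕ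
    rest X = ∑ (sub N) (off (sub N) ∅ (f X))

    δ-g : ∀ a → δ (fin k) a j ≤ δ (fin K) (g a) (g j)
    δ-g a with compareE (fin k) a j
    ... | same e refl = ≤-trans (≤-reflexive e) (≤-reflexive (sym (δ-refl (fin K) (g a))))
    ... | diff e _    = ≤-trans (≤-reflexive e) z≤n

    inner : ∀ X → 𝟙 (∣ X ∣ ≟ h) * (bit (lookup X u) * copies ψ X j) ≤ f X ∅
    inner X with ∣ X ∣ ≟ h
    ... | no _     = z≤n
    ... | yes size = *-mono-≤ (≤-reflexive (sym (𝟙-yes (∣ X V.++ ∅ ∣ ≟ h) (trans (∣++∣ X ∅) (trans (cong (∣ X ∣ +_) (∣∅∣ N)) (trans (+-identityʳ _) size))))))
      (*-mono-≤ (≤-reflexive (cong bit (sym (VP.lookup-++ˡ X ∅ u)))) (∑-mono (fin lam) λ i → ≤-trans (δ-g (ψ X i))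
        (≤-reflexive (cong (λ c → δ (fin K) c (g j)) (trans (sym (extends X size i)) (cong (λ S → χ S i) (embed-++ N X)))))))

    X₀ = V.take m S
    Z₀ = V.drop m S
    S≡ : X₀ V.++ Z₀ ≡ S
    S≡ = VP.take++drop≡id m S
    Z₀≢∅ : ∅ ≢ Z₀
    Z₀≢∅ e = case trans (sym (VP.[]=⇒lookup w∈S)) (trans (cong (λ T → lookup T (m ↑ʳ w)) (sym S≡))
      (trans (VP.lookup-++ʳ X₀ Z₀ w) (trans (cong (λ Z → lookup Z w) (sym e)) (VP.lookup-replicate w outside)))) of λ ()
    outer : 0 < rest X₀
    outer = ≤-trans (≤-trans positive (≤-reflexive (sym (off-≢ (sub N) (f X₀) Z₀≢∅)))) (≤∑ (sub N) (off (sub N) ∅ (f X₀)) Z₀)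
      where
      positive : 0 < f X₀ Z₀
      positive = subst (λ T → 0 < 𝟙 (∣ T ∣ ≟ h) * (bit (lookup T (u ↑ˡ N)) * copies χ T (g j))) (sym S≡)
        (*-mono-≤ (≤-reflexive (sym (𝟙-yes (∣ S ∣ ≟ h) size))) (*-mono-≤ (≤-reflexive (cong bit (sym (VP.[]=⇒lookup u∈S))))
          (≤-trans (≤-reflexive (sym (trans (cong (λ c → δ (fin K) c (g j)) colour) (δ-refl (fin K) (g j)))))
            (≤∑ (fin lam) (λ i → δ (fin K) (χ S i) (g j)) i))))

module _ (m′ N′ r s lam : ℕ) (0<r : 0 < r) (0<s : 0 < s) (0<lam : 0 < lam) (5<m : 5 < suc m′)
         (4m≤N : 4 * suc m′ ≤ suc N′) (k : ℕ) (ψ : Colouring (suc m′) lam k) (regular : IsFactorization 5 r ψ) where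

  private
    m N : ℕ
    m = suc m′
    N = suc N′

    kr : k * r ≡ lam * (m′ C 4)
    kr = proj₁ (factorization-admissible 4 r ψ regular)

  necessary : Extends (m + N) 5 s ψ →
    (Admissible 5 m r lam × Admissible 5 (m + N) s lam) × (r < s × s * (m′ C 4) ≤ r * ((m′ + N) C 4))
  necessary (K , χ , (regular-χ , connected) , g , g-injective , extends) =
    (proj₂ (factorization-admissible 4 r ψ regular) j₀ , proj₂ (factorization-admissible 4 s χ regular-χ) (g j₀))
    , r<s , ratio
    where
    -- By `m > 5` the number λ C(m-1,4) is positive, so there is a given factor to argue with.
    0<k : 0 < k
    0<k = n≢0⇒n>0 λ e → <⇒≢ (*-mono-≤ 0<lam (choose>0 m′ 4 (≤-trans (n≤1+n 4) (s≤s⁻¹ 5<m)))) (trans (sym (cong (_* r) e)) kr)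
    j₀ : Fin k
    j₀ = F.fromℕ< 0<k
    Ks : K * s ≡ lam * ((m′ + N) C 4)
    Ks = proj₁ (factorization-admissible 4 s χ regular-χ)
    -- Given `kr` and `Ks`, the upper bound in (ii) amounts to `k ≤ K`, which injectivity of `g`
    -- provides.
    ratio : s * (m′ C 4) ≤ r * ((m′ + N) C 4)
    ratio = *-cancelˡ-≤ lam {{>-nonZero 0<lam}} (begin
      lam * (s * (m′ C 4))          ≡⟨ m*[n*o]≡n*[m*o] lam s _ ⟩
      s * (lam * (m′ C 4))          ≡⟨ cong (s *_) kr ⟨
      s * (k * r)                   ≤⟨ *-monoʳ-≤ s (*-monoˡ-≤ r (FP.injective⇒≤ g-injective)) ⟩
      s * (K * r)                   ≡⟨ m*[n*o]≡o*[n*m] s K r ⟩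
      r * (K * s)                   ≡⟨ cong (r *_) Ks ⟩
      r * (lam * ((m′ + N) C 4))    ≡⟨ m*[n*o]≡n*[m*o] r lam _ ⟩
      lam * (r * ((m′ + N) C 4))    ∎)
      where open ≤-Reasoning
    r<s : r < s
    r<s with Necessity.crossing ψ χ g extends zero zero (connected (g j₀) (zero ↑ˡ N) (m ↑ʳ zero)) refl
    ... | S , i , size , colour , (u , u∈S) , (w , w∈S) = subst₂ _<_ (regular j₀ u) (regular-χ (g j₀) (u ↑ˡ N))
      (Necessity.extraEdge ψ χ g extends j₀ S i u w size colour u∈S w∈S)

  sufficient : (Admissible 5 m r lam × Admissible 5 (m + N) s lam) × (r < s × s * (m′ C 4) ≤ r * ((m′ + N) C 4)) →
    Extends (m + N) 5 s ψ
  sufficient (((5∣rm , _) , (5∣sn , divides K Ks)) , (r<s , ratio)) = Col.extends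
    where
    -- The same equivalence read backwards: there are enough classes to give each factor its own.
    k≤K : k ≤ K
    k≤K = *-cancelʳ-≤ k K r {{>-nonZero 0<r}} (*-cancelˡ-≤ s {{>-nonZero 0<s}} (begin
      s * (k * r)                   ≡⟨ cong (s *_) kr ⟩
      s * (lam * (m′ C 4))          ≡⟨ m*[n*o]≡n*[m*o] s lam _ ⟩
      lam * (s * (m′ C 4))          ≤⟨ *-monoʳ-≤ lam ratio ⟩
      lam * (r * ((m′ + N) C 4))    ≡⟨ m*[n*o]≡n*[m*o] lam r _ ⟩
      r * (lam * ((m′ + N) C 4))    ≡⟨ cong (r *_) Ks ⟩
      r * (K * s)                   ≡⟨ m*[n*o]≡o*[n*m] r K s ⟩
      s * (K * r)                   ∎))
      where open ≤-Reasoning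
    open TypeCounts m′ N′ s r lam K k (sym Ks) kr k≤K r<s 0<r 5<m 4m≤N 5∣rm 5∣sn using (typeCounts)
    y = proj₁ typeCounts
    module Ext = Extension m N s r lam K k ψ regular k≤K r<s 0<r z<s y (proj₂ (proj₂ (proj₂ typeCounts)))
      (detach K (fin 5) 0 m toℕ (λ i → lam * (N C (5 ∸ toℕ i))) (λ c → s ∸ oldDeg k r c) y (λ _ _ → zero)
        (proj₁ (proj₂ typeCounts)) (proj₁ (proj₂ (proj₂ typeCounts))))
    module Lab = Ext.Labelled (λ c → proj₁ (Ext.labelling c)) (λ c → proj₁ (proj₂ (Ext.labelling c))) (λ c → proj₂ (proj₂ (Ext.labelling c)))
    module Col = Lab.Colour (detach K (sub m) m N Ext.w Ext.M (λ _ → s) Ext.x Lab.lab₂ Ext.total Ext.weight)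

theorem8p8 : (m n r s lam : ℕ) → 0 < r → 0 < s → 0 < lam →
    5 < m → 5 * m ≤ n →
    (k : ℕ) (ψ : Colouring m lam k) → IsFactorization 5 r ψ →
    (Extends n 5 s ψ ⇔
    ((Admissible 5 m r lam × Admissible 5 n s lam) ×
    (r < s × s * ((m ∸ 1) C 4) ≤ r * ((n ∸ 1) C 4))))
theorem8p8 (suc m′) n r s lam 0<r 0<s 0<lam 5<m 5m≤n k ψ regular
  with m≤n⇒∃[o]m+o≡n (≤-trans (m≤m+n (suc m′) (4 * suc m′)) 5m≤n)
... | zero , refl = ⊥-elim (<⇒≱ (s≤s z≤n) (+-cancelˡ-≤ (suc m′) (4 * suc m′) 0 5m≤n))
... | suc N′ , refl = mk⇔
  (necessary m′ N′ r s lam 0<r 0<s 0<lam 5<m 4m≤N k ψ regular)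
  (sufficient m′ N′ r s lam 0<r 0<s 0<lam 5<m 4m≤N k ψ regular)
  where
  4m≤N : 4 * suc m′ ≤ suc N′
  4m≤N = +-cancelˡ-≤ (suc m′) (4 * suc m′) (suc N′) 5m≤n
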